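{- There is a universal constant $\epsilon>0$ such that the following holds. Let $X$ be a set of $2n$ variables, $\mathbb{F}$ a field, and $f\in\mathbb{F}[X]$ a full max-rank polynomial. Let $\Phi$ be any $(s,d)$-product-sparse formula over $X$ of size at most $n^{\epsilon\log n}$. If $sd=o(n^{1/8})$, then (for all sufficiently large $n$) $\Phi$ does not compute $f$.
   Context: Polynomial coefficient matrix: for disjoint sets of variables $Y,Z$ and $f\in\mathbb{F}[Y,Z]$, $M_f$ is the matrix with rows indexed by monic multilinear monomials $p$ in $Y$ and columns by monic multilinear monomials $q$ in $Z$, with entries in $\mathbb{F}[Y,Z]$: $M_f(p,q)=G$ where $f$ is uniquely written as $f=pq\,G+Q$ with $G$ containing only variables appearing in $pq$ and $Q$ having no monomial that is divisible by $pq$ and contains only variables appearing in $pq$ (equivalently, $G=\sum m/(pq)$ over the terms $m$ of $f$ whose set of occurring variables is exactly the set of variables of $pq$). For $S:Y\cup Z\to\mathbb{F}$, $M_f|_S$ is the matrix obtained by evaluating every entry at $S$, and $\mathrm{maxrank}(M_f)=\max_S\mathrm{rank}(M_f|_S)$. For $X=\{x_1,\dots,x_{2n}\}$, $Y=\{y_1,\dots,y_n\}$, $Z=\{z_1,\dots,z_n\}$, a polynomial $f\in\mathbb{F}[X]$ is full max-rank if for every bijection (partition) $A:X\to Y\cup Z$, $\mathrm{maxrank}(M_{f^A})=2^n$, where $f^A$ is obtained by substituting $A(x)$ for each $x$. Formulas: an arithmetic formula is an arithmetic circuit (fan-in at most 2, leaves labelled by variables or constants) whose underlying graph is a tree; its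 size is its number of gates. For a gate $v$, $X_v$ is the set of variables appearing in the subformula rooted at $v$. A product gate $v$ with children $v_1,v_2$ is disjoint if $X_{v_1}\cap X_{v_2}=\emptyset$, and $s$-sparse if the polynomial computed by at least one of $v_1,v_2$ has at most $2^s$ monomials. The product-sparse depth of a node $v$ is the maximum number of non-disjoint product gates on any path from a leaf to $v$. A formula is $(s,d)$-product-sparse if every product gate is disjoint or $s$-sparse, and $d$ is the product-sparse depth of the root. -}

module Defs where

open import Level using (Level; _⊔_)
open import Algebra.Apartness.Bundles using (HeytingField; HeytingCommutativeRing)
open import Algebra.Bundles using (CommutativeRing)
import Algebra.Properties.Monoid.Sum as MonoidSum
import Algebra.Properties.Semiring.Exp as SemiringExp
open import Data.Bool using (if_then_else_)
open import Data.Bool.Properties using () renaming (_≟_ to _≟ᵇ_)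
open import Data.Fin using (Fin; splitAt)
open import Data.Fin.Subset using (Subset; ⁅_⁆; _∩_; _∪_; Empty)
  renaming (⊥ to ∅)
open import Data.Fin.Subset.Properties using (nonempty?)
open import Data.Integer using (∣_∣)
open import Data.List using (List; []; _∷_; foldr; map; filter; length; cartesianProductWith)
  renaming (_++_ to _++ˡ_)
open import Data.List.Membership.Propositional using (_∈_)
open import Data.Nat using (ℕ; suc; NonZero; _≤_; _≥_; _<ᵇ_; _∸_)
  renaming (_+_ to _+ⁿ_; _*_ to _*ⁿ_; _^_ to _^ⁿ_; _⊔_ to _⊔ⁿ_; _≟_ to _≟ⁿ_)
open import Data.Product using (Σ; ∃; _×_; _,_; proj₁; proj₂)
open import Data.Rational using (ℚ; ↥_; ↧ₙ_)
open import Data.Sum using (_⊎_)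
open import Data.Unit.Polymorphic using (⊤)
open import Data.Vec using (Vec; replicate; tabulate; lookup; zipWith; _++_)
  renaming (map to mapᵛ)
open import Data.Vec.Properties using (≡-dec)
open import Function.Bundles using (_↔_; Inverse)
open import Relation.Binary.PropositionalEquality using (_≡_)
open import Relation.Nullary using (¬_; does)

-- A monomial is its vector of exponents.
Monomial : ℕ → Set
Monomial m = Vec ℕ m

support : ∀ {m} → Monomial m → Subset m
support = mapᵛ (0 <ᵇ_)

-- A subset stands for the monic multilinear monomial it is the support of.
multilinear : ∀ {m} → Subset m → Monomial m
multilinear = mapᵛ (λ b → if b then 1 else 0)

module _ {c ℓ₁ ℓ₂ : Level} (F : HeytingField c ℓ₁ ℓ₂) where

  private
    module R = CommutativeRing
      (HeytingCommutativeRing.commutativeRing (HeytingField.heytingCommutativeRing F))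
  open R using (Carrier; _≈_; _+_; _*_; 0#; 1#)
  open MonoidSum R.+-monoid using () renaming (sum to ∑)
  open MonoidSum R.*-monoid using () renaming (sum to ∏)
  open SemiringExp R.semiring using (_^_)

  -- A formal sum of terms, in which a monomial may be repeated or have coefficient
  -- zero.  Polynomials are compared by _≈ᵖ_, never by _≡_.
  Poly : ℕ → Set c
  Poly m = List (Carrier × Monomial m)

  coeff : ∀ {m} → Poly m → Monomial m → Carrier
  coeff f e = foldr (λ t a → if does (≡-dec _≟ⁿ_ (proj₂ t) e) then proj₁ t + a else a) 0# f

  infix 4 _≈ᵖ_
  _≈ᵖ_ : ∀ {m} → Poly m → Poly m → Set ℓ₁
  f ≈ᵖ g = ∀ e → coeff f e ≈ coeff g e

  constᵖ : ∀ {m} → Carrier → Poly m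
  constᵖ a = (a , replicate _ 0) ∷ []

  varᵖ : ∀ {m} → Fin m → Poly m
  varᵖ i = (1# , multilinear ⁅ i ⁆) ∷ []

  infixl 6 _+ᵖ_
  _+ᵖ_ : ∀ {m} → Poly m → Poly m → Poly m
  _+ᵖ_ = _++ˡ_

  infixl 7 _*ᵖ_
  _*ᵖ_ : ∀ {m} → Poly m → Poly m → Poly m
  _*ᵖ_ = cartesianProductWith
    (λ t u → proj₁ t * proj₁ u , zipWith _+ⁿ_ (proj₂ t) (proj₂ u))

  eval : ∀ {m} → (Fin m → Carrier) → Poly m → Carrier
  eval S = foldr (λ t a → proj₁ t * ∏ (λ i → S i ^ lookup (proj₂ t) i) + a) 0#

  AtMostMonomials : ∀ {m} → ℕ → Poly m → Set ℓ₁
  AtMostMonomials {m} k f =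
    Σ (List (Monomial m)) λ es → length es ≤ k × (∀ e → ¬ (coeff f e ≈ 0#) → e ∈ es)

  Matrix : Set → Set → Set c → Set c
  Matrix I J A = I → J → A

  LinearlyIndependent : ∀ {J : Set} {r} → (Fin r → J → Carrier) → Set (c ⊔ ℓ₁)
  LinearlyIndependent {r = r} v =
    ∀ (a : Fin r → Carrier) → (∀ j → ∑ (λ i → a i * v i j) ≈ 0#) → ∀ i → a i ≈ 0#

  HasRank : ∀ {I J : Set} → Matrix I J Carrier → ℕ → Set (c ⊔ ℓ₁)
  HasRank {I} M r =
      (Σ (Fin r → I) λ rows → LinearlyIndependent (λ i → M (rows i)))
    × (∀ k (rows : Fin k → I) → LinearlyIndependent (λ i → M (rows i)) → k ≤ r)

  -- A polynomial in F[Y,Z] with |Y| = |Z| = n is a Poly (n + n): the first n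
  -- variables are Y, the last n are Z.
  coefficientMatrix : ∀ n → Poly (n +ⁿ n) → Matrix (Subset n) (Subset n) (Poly (n +ⁿ n))
  coefficientMatrix n f p q =
    map (λ t → proj₁ t , zipWith _∸_ (proj₂ t) (multilinear (p ++ q)))
        (filter (λ t → ≡-dec _≟ᵇ_ (support (proj₂ t)) (p ++ q)) f)

  evalMatrix : ∀ {m} {I J : Set} → (Fin m → Carrier) → Matrix I J (Poly m) → Matrix I J Carrier
  evalMatrix S M i j = eval S (M i j)

  HasMaxRank : ∀ {m} {I J : Set} → Matrix I J (Poly m) → ℕ → Set (c ⊔ ℓ₁)
  HasMaxRank {m} M r =
      (Σ (Fin m → Carrier) λ S → HasRank (evalMatrix S M) r)
    × (∀ S k → HasRank (evalMatrix S M) k → k ≤ r)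

  -- f^A: the exponent of the variable A(x) is that of x in f.
  substitute : ∀ n → Fin (2 *ⁿ n) ↔ (Fin n ⊎ Fin n) → Poly (2 *ⁿ n) → Poly (n +ⁿ n)
  substitute n A =
    map (λ t → proj₁ t , tabulate (λ k → lookup (proj₂ t) (Inverse.from A (splitAt n k))))

  FullMaxRank : ∀ n → Poly (2 *ⁿ n) → Set (c ⊔ ℓ₁)
  FullMaxRank n f = ∀ (A : Fin (2 *ⁿ n) ↔ (Fin n ⊎ Fin n)) →
    HasMaxRank (coefficientMatrix n (substitute n A f)) (2 ^ⁿ n)

  data Op : Set where
    plus times : Op

  -- Fan-in is at most two, so gates with a single child are allowed; they pass its
  -- value on unchanged.
  data Formula (m : ℕ) : Set c where
    var   : Fin m → Formula m
    const : Carrier → Formula m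
    gate₁ : Op → Formula m → Formula m
    gate₂ : Op → Formula m → Formula m → Formula m

  -- Input gates are counted.
  size : ∀ {m} → Formula m → ℕ
  size (var i)       = 1
  size (const a)     = 1
  size (gate₁ _ φ)   = suc (size φ)
  size (gate₂ _ φ ψ) = suc (size φ +ⁿ size ψ)

  ⟦_⟧ : ∀ {m} → Formula m → Poly m
  ⟦ var i ⟧           = varᵖ i
  ⟦ const a ⟧         = constᵖ a
  ⟦ gate₁ _ φ ⟧       = ⟦ φ ⟧
  ⟦ gate₂ plus φ ψ ⟧  = ⟦ φ ⟧ +ᵖ ⟦ ψ ⟧
  ⟦ gate₂ times φ ψ ⟧ = ⟦ φ ⟧ *ᵖ ⟦ ψ ⟧

  Computes : ∀ {m} → Formula m → Poly m → Set ℓ₁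
  Computes φ f = ⟦ φ ⟧ ≈ᵖ f

  vars : ∀ {m} → Formula m → Subset m
  vars (var i)       = ⁅ i ⁆
  vars (const a)     = ∅
  vars (gate₁ _ φ)   = vars φ
  vars (gate₂ _ φ ψ) = vars φ ∪ vars ψ

  Disjoint : ∀ {m} → Formula m → Formula m → Set
  Disjoint φ ψ = Empty (vars φ ∩ vars ψ)

  Sparse : ∀ {m} → ℕ → Formula m → Formula m → Set ℓ₁
  Sparse s φ ψ = AtMostMonomials (2 ^ⁿ s) ⟦ φ ⟧ ⊎ AtMostMonomials (2 ^ⁿ s) ⟦ ψ ⟧

  -- The maximum, over paths from a leaf to the root, of the number of non-disjoint
  -- product gates on the path, the root included.
  productSparseDepth : ∀ {m} → Formula m → ℕ
  productSparseDepth (var i)           = 0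
  productSparseDepth (const a)         = 0
  productSparseDepth (gate₁ _ φ)       = productSparseDepth φ
  productSparseDepth (gate₂ plus φ ψ)  = productSparseDepth φ ⊔ⁿ productSparseDepth ψ
  productSparseDepth (gate₂ times φ ψ) =
    (if does (nonempty? (vars φ ∩ vars ψ)) then 1 else 0)
      +ⁿ (productSparseDepth φ ⊔ⁿ productSparseDepth ψ)

  EveryProductDisjointOrSparse : ∀ {m} → ℕ → Formula m → Set ℓ₁
  EveryProductDisjointOrSparse s (var i)           = ⊤
  EveryProductDisjointOrSparse s (const a)         = ⊤
  EveryProductDisjointOrSparse s (gate₁ _ φ)       = EveryProductDisjointOrSparse s φ
  EveryProductDisjointOrSparse s (gate₂ plus φ ψ)  =
    EveryProductDisjointOrSparse s φ × EveryProductDisjointOrSparse s ψ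
  EveryProductDisjointOrSparse s (gate₂ times φ ψ) =
    (Disjoint φ ψ ⊎ Sparse s φ ψ)
    × EveryProductDisjointOrSparse s φ × EveryProductDisjointOrSparse s ψ

  ProductSparse : ∀ {m} → ℕ → ℕ → Formula m → Set ℓ₁
  ProductSparse s d φ = EveryProductDisjointOrSparse s φ × productSparseDepth φ ≡ d

-- k ≤ n ^ (ε · log₂ n), for n ≥ 1 and ε > 0.  As a / b ranges over the rationals with
-- log₂ n ≤ a / b, the infimum of n ^ (ε · (a / b)) is n ^ (ε · log₂ n); below,
-- log₂ n ≤ a / b and k ≤ n ^ (ε · (a / b)) are cleared of fractions.
infix 4 _≤_^[_·log₂]
_≤_^[_·log₂] : ℕ → ℕ → ℚ → Set
k ≤ n ^[ ε ·log₂] = ∀ a b → .{{_ : NonZero b}} → n ^ⁿ b ≤ 2 ^ⁿ a →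
  k ^ⁿ (↧ₙ ε *ⁿ b) ≤ n ^ⁿ (∣ ↥ ε ∣ *ⁿ a)

-- g(n) = o(n^(1/8)): for every k, eventually k · g(n) ≤ n^(1/8).
IsLittleOEighthRoot : (ℕ → ℕ) → Set
IsLittleOEighthRoot g = ∀ k → ∃ λ N → ∀ n → n ≥ N → (k *ⁿ g n) ^ⁿ 8 ≤ n

{-# OPTIONS --safe #-}

-- Colour the 2n variables with Y and Z independently at random.  A formula loses rank
-- unless, on some path from the root along which the variable set never shrinks below
-- half in one step, every gate has an almost balanced variable set.  Selecting gates whose
-- variable sets shrink by a constant factor, the differences of consecutive sets are
-- disjoint and each is almost balanced with probability n^(-Ω(1)), independently; so a
-- given path is bad with probability n^(-Ω(log n)), and the number of paths is at most the
-- size of the formula.  Conditioning on exactly n variables of each colour costs only a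
-- factor 2n + 1.
--
-- For the rank, work modulo xᵢ² = Sᵢ xᵢ: there f becomes an element of the tensor product
-- of an algebra in the Y-variables and one in the Z-variables, and M_f|_S is its matrix.
-- Tensor rank is subadditive and submultiplicative and a polynomial with r monomials has
-- rank at most r, so sparse factors cost 2^(sd) in total.
module Submission where

open import Defs
open import Algebra.Apartness.Bundles using (HeytingCommutativeRing; HeytingField)
open import Algebra.Bundles using (CommutativeMonoid; CommutativeRing)
open import Data.Bool using (Bool; true; false; _∧_; if_then_else_; not)
open import Data.Fin using (Fin; zero; suc; punchIn; splitAt; _↑ˡ_; _↑ʳ_)
open import Data.Fin.Properties using (splitAt-↑ˡ; splitAt-↑ʳ)
open import Data.Fin.Subset using (Subset; _⊆_; ∣_∣)
open import Data.Fin.Subset.Properties using (drop-∷-⊆)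
open import Data.List using (List; []; _∷_; _++_; map; filter; length; foldr; cartesianProductWith)
open import Data.List.Membership.Propositional using (_∈_)
open import Data.List.Membership.Propositional.Properties using
  (∈-++⁺ˡ; ∈-++⁺ʳ; ∈-map⁺; ∈-map⁻; ∈-filter⁻; ∈-cartesianProductWith⁻)
open import Data.List.Properties using (length-++; length-map)
open import Data.List.Relation.Unary.All as All using (All; []; _∷_)
open import Data.List.Relation.Unary.Any using (here; there)
open import Data.Nat using (ℕ; zero; suc; _+_; _*_; _∸_; _^_; _<_; _≤_; _≥_; _<ᵇ_; z≤n; s≤s; s<s⁻¹)
open import Data.Product using (Σ; ∃; _×_; _,_; proj₁; proj₂)
open import Data.Sum using (_⊎_; inj₁; inj₂)
open import Data.Vec using (Vec; []; _∷_; here; there; zipWith; lookup; tabulate)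
open import Data.Vec.Functional using (insertAt)
open import Data.Vec.Functional.Properties using (insertAt-lookup; insertAt-punchIn)
open import Data.Vec.Properties using
  (≡-dec; lookup-zipWith; lookup-map; lookup∘tabulate; lookup-++ˡ; lookup-++ʳ; zipWith-comm)
open import Function using (_∘_)
open import Function.Bundles using (_↔_; Inverse; mk↔ₛ′)
open import Level using () renaming (_⊔_ to _⊔ˡ_)
open import Relation.Binary.PropositionalEquality as ≡ using (_≡_; _≢_)
open import Relation.Nullary using (¬_; Dec; yes; no; does; contradiction)
open import Relation.Nullary.Decidable using (¬?)
import Algebra.Apartness.Properties.HeytingCommutativeRing as HeytingProperties
import Algebra.Properties.CommutativeMonoid.Sum as CommutativeMonoidSum
import Algebra.Properties.CommutativeSemigroup as CommutativeSemigroupProperties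
import Algebra.Properties.Monoid.Sum as MonoidSum
import Algebra.Properties.Ring as RingProperties
import Algebra.Properties.Semiring.Exp as SemiringExp
import Algebra.Properties.Semiring.Sum as SemiringSum
import Data.Bool as Bool
import Data.List as List
import Data.List.Relation.Unary.All.Properties as All
import Data.Nat.Properties as ℕ
import Data.Vec as Vec
import Relation.Binary.Reasoning.Setoid as SetoidReasoning

-- Why the gain beats the loss: if ∣X∣ ≤ 2e + k and the colour classes in X differ by at least k,
-- the smaller one has at most e variables, so the rank lies 2^(k/2) below the trivial 2^(∣X∣/2).
-- This saving has to absorb both the size of the formula and 2^(sd), which asks for k of order
-- n^(1/8). A difference set of size at least T is 2k-balanced with probability O(k/√T), so T of
-- order n^(1/2) makes each selection unlikely.
--
-- At sums and sparse products the children may overlap arbitrarily. A child with less than half of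
-- the variables of its parent needs no control, since the trivial bound on its rank already
-- suffices; hence paths follow only the other children. At a disjoint product the larger factor is
-- always one of those.
--
-- Equality in the field is not decidable and polynomials are unreduced lists. Polynomials are
-- therefore compared by linear functionals, ranks are only bounded from above, and elimination is
-- run only towards a contradiction. Probabilities are counts of colourings, cleared of
-- denominators.

infixl 6 _∔_
_∔_ : ∀ {m} → Monomial m → Monomial m → Monomial m
_∔_ = zipWith _+_

∔-interchange : ∀ {m} (x y z w : Monomial m) → (x ∔ y) ∔ (z ∔ w) ≡ (x ∔ z) ∔ (y ∔ w)
∔-interchange []       []       []       []       = ≡.refl
∔-interchange (x ∷ xs) (y ∷ ys) (z ∷ zs) (w ∷ ws) =
  ≡.cong₂ _∷_ (ℕ+.interchange x y z w) (∔-interchange xs ys zs ws)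
  where module ℕ+ = CommutativeSemigroupProperties ℕ.+-commutativeSemigroup

length-cartesianProductWith : ∀ {a b c} {A : Set a} {B : Set b} {C : Set c} (f : A → B → C) xs ys →
                              length (cartesianProductWith f xs ys) ≡ length xs * length ys
length-cartesianProductWith f []       ys = ≡.refl
length-cartesianProductWith f (x ∷ xs) ys = ≡.trans (length-++ (map (f x) ys))
  (≡.cong₂ _+_ (length-map (f x) ys) (length-cartesianProductWith f xs ys))

-- A Boolean vector χ colours the variables: true for Y, false for Z.
side : ∀ {N} → Bool → Subset N → Subset N → Subset N
side b = zipWith λ c x → does (c Bool.≟ b) ∧ x

part : ∀ {N} → Bool → Subset N → Monomial N → Monomial N
part b = zipWith λ c x → if does (c Bool.≟ b) then x else 0

lookup-part : ∀ {N} b i (χ : Subset N) e →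
              lookup (part b χ e) i ≡ (if does (lookup χ i Bool.≟ b) then lookup e i else 0)
lookup-part b i χ e = lookup-zipWith _ i χ e

part-∔-part : ∀ {N} (χ : Subset N) e → part true χ e ∔ part false χ e ≡ e
part-∔-part []          []      = ≡.refl
part-∔-part (true ∷ χ)  (x ∷ e) = ≡.cong₂ _∷_ (ℕ.+-identityʳ x) (part-∔-part χ e)
part-∔-part (false ∷ χ) (x ∷ e) = ≡.cong (x ∷_) (part-∔-part χ e)

side-mono : ∀ {N} b (χ : Subset N) {X X′} → X ⊆ X′ → side b χ X ⊆ side b χ X′
side-mono true  (true ∷ χ)  {true ∷ X} {_ ∷ X′} X⊆X′ here with here ← X⊆X′ here = here
side-mono false (false ∷ χ) {true ∷ X} {_ ∷ X′} X⊆X′ here with here ← X⊆X′ here = here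
side-mono b     (c ∷ χ)     {_ ∷ X}    {_ ∷ X′} X⊆X′ (there i∈) =
  there (side-mono b χ (drop-∷-⊆ X⊆X′) i∈)

subsets : ∀ {m} → Subset m → List (Subset m)
subsets []      = [] ∷ []
subsets (b ∷ u) = map (false ∷_) (subsets u) ++ (if b then map (true ∷_) (subsets u) else [])

length-subsets : ∀ {m} (u : Subset m) → length (subsets u) ≡ 2 ^ ∣ u ∣
length-subsets []          = ≡.refl
length-subsets (false ∷ u) = ≡.trans (length-++ (map (false ∷_) (subsets u)))
  (≡.trans (ℕ.+-identityʳ _) (≡.trans (length-map _ (subsets u)) (length-subsets u)))
length-subsets (true ∷ u)  = ≡.trans (length-++ (map (false ∷_) (subsets u)))
  (≡.cong₂ _+_ (≡.trans (length-map _ (subsets u)) (length-subsets u))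
               (≡.trans (≡.trans (length-map _ (subsets u)) (length-subsets u)) (≡.sym (ℕ.+-identityʳ _))))

-- Linear dependence, and linear functionals on formal polynomials.

module OverField {c ℓ₁ ℓ₂} (F : HeytingField c ℓ₁ ℓ₂) where

  open HeytingField F using (_#_; tight; #-irrefl; #⇒invertible; heytingCommutativeRing)
  open CommutativeRing (HeytingCommutativeRing.commutativeRing heytingCommutativeRing)
    renaming (_+_ to _+ᶠ_; _*_ to _*ᶠ_; -_ to -ᶠ_) hiding (_-_; zero; _≉_)
  open HeytingProperties heytingCommutativeRing using (1#0; x-0≈x)
  open SemiringSum semiring
    using (sum-remove; sum-cong-≋; sum-replicate-zero; ∑-comm; ∑-distrib-+; *-distribˡ-sum; *-distribʳ-sum)
    renaming (sum to ∑)
  open MonoidSum *-monoid using () renaming (sum to ∏; sum-cong-≋ to ∏-cong)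
  open CommutativeMonoidSum *-commutativeMonoid using () renaming (∑-distrib-+ to ∏-distrib-*)
  open SemiringExp semiring using () renaming (_^_ to _^ᶠ_)
  open RingProperties ring using (-‿distribˡ-*)
  open CommutativeSemigroupProperties *-commutativeSemigroup
    using () renaming (x∙yz≈y∙xz to x*yz≈y*xz)
  open CommutativeSemigroupProperties (CommutativeMonoid.commutativeSemigroup +-commutativeMonoid)
    using () renaming (x∙yz≈y∙xz to x+yz≈y+xz; interchange to +-interchange)
  open SetoidReasoning setoid

  -- Apartness is tight: equality is a negation, so it may be proved by contradiction.
  ≈-stable : ∀ {x y} → ¬ ¬ x ≈ y → x ≈ y
  ≈-stable {x} {y} ¬¬x≈y = proj₁ (tight x y) λ x#y → ¬¬x≈y λ x≈y → proj₂ (tight x y) x≈y x#y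

  ∑-zero : ∀ {r} (f : Fin r → Carrier) → (∀ i → f i ≈ 0#) → ∑ f ≈ 0#
  ∑-zero {r} f f≈0 = trans (sum-cong-≋ f≈0) (sum-replicate-zero r)

  -- Gaussian elimination.  Whether the first column vanishes is not decidable, but
  -- it may be assumed decided since the goal is negative.
  more-rows-than-columns⇒dependent : ∀ {r l} (U : Fin r → Fin l → Carrier) → l < r →
                                     ¬ LinearlyIndependent F U
  more-rows-than-columns⇒dependent {suc r} {zero} U l<r independent =
    #-irrefl (independent (λ _ → 1#) (λ ()) zero) 1#0
  more-rows-than-columns⇒dependent {suc r} {suc l} U l<r independent =
    ¬dichotomy (inj₁ λ i → proj₁ (tight _ _) λ Ui#0 → ¬dichotomy (inj₂ (i , Ui#0)))
    where
    ¬dichotomy : ¬ ((∀ i → U i zero ≈ 0#) ⊎ ∃ λ i → U i zero # 0#)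
    ¬dichotomy (inj₁ U₀≈0) =
      more-rows-than-columns⇒dependent (λ i k → U i (suc k)) (ℕ.<-trans (ℕ.n<1+n l) l<r)
        λ a aU≈0 → independent a λ
          { zero    → ∑-zero (λ i → a i *ᶠ U i zero) λ i → trans (*-congˡ (U₀≈0 i)) (zeroʳ _)
          ; (suc k) → aU≈0 k }
    ¬dichotomy (inj₂ (p , Up#0)) with #⇒invertible Up#0
    ... | v , v*Up≈1 , _ = more-rows-than-columns⇒dependent U′ (s<s⁻¹ l<r) independent′
      where
      U′ : Fin r → Fin l → Carrier
      U′ j k = U (punchIn p j) (suc k) +ᶠ U (punchIn p j) zero *ᶠ (-ᶠ v *ᶠ U p (suc k))

      independent′ : LinearlyIndependent F U′
      independent′ a aU′≈0 j =
        trans (reflexive (≡.sym (insertAt-punchIn a p x j))) (independent a⁺ a⁺U≈0 (punchIn p j))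
        where
        s x : Carrier
        s = ∑ λ j → a j *ᶠ U (punchIn p j) zero
        x = s *ᶠ -ᶠ v

        a⁺ : Fin (suc r) → Carrier
        a⁺ = insertAt a p x

        expand : ∀ k → ∑ (λ i → a⁺ i *ᶠ U i k) ≈ x *ᶠ U p k +ᶠ ∑ (λ j → a j *ᶠ U (punchIn p j) k)
        expand k = trans (sum-remove {i = p} (λ i → a⁺ i *ᶠ U i k)) (+-cong
          (*-congʳ (reflexive (insertAt-lookup a p x)))
          (sum-cong-≋ λ j → *-congʳ (reflexive (insertAt-punchIn a p x j))))

        a⁺U≈0 : ∀ k → ∑ (λ i → a⁺ i *ᶠ U i k) ≈ 0#
        a⁺U≈0 zero = begin
          ∑ (λ i → a⁺ i *ᶠ U i zero)      ≈⟨ expand zero ⟩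
          s *ᶠ -ᶠ v *ᶠ U p zero +ᶠ s      ≈⟨ +-congʳ (*-assoc _ _ _) ⟩
          s *ᶠ (-ᶠ v *ᶠ U p zero) +ᶠ s    ≈⟨ +-congʳ (*-congˡ (-‿distribˡ-* _ _)) ⟨
          s *ᶠ -ᶠ (v *ᶠ U p zero) +ᶠ s    ≈⟨ +-cong (*-congˡ (-‿cong (trans (*-congˡ (sym (x-0≈x _))) v*Up≈1))) (sym (*-identityʳ s)) ⟩
          s *ᶠ -ᶠ 1# +ᶠ s *ᶠ 1#           ≈⟨ distribˡ _ _ _ ⟨
          s *ᶠ (-ᶠ 1# +ᶠ 1#)              ≈⟨ *-congˡ (-‿inverseˡ 1#) ⟩
          s *ᶠ 0#                         ≈⟨ zeroʳ s ⟩
          0#                              ∎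
        a⁺U≈0 (suc k) = begin
          ∑ (λ i → a⁺ i *ᶠ U i (suc k))
            ≈⟨ expand (suc k) ⟩
          s *ᶠ -ᶠ v *ᶠ U p (suc k) +ᶠ ∑ (λ j → a j *ᶠ U (punchIn p j) (suc k))
            ≈⟨ +-congʳ (*-assoc _ _ _) ⟩
          s *ᶠ w +ᶠ ∑ (λ j → a j *ᶠ U (punchIn p j) (suc k))
            ≈⟨ +-comm _ _ ⟩
          ∑ (λ j → a j *ᶠ U (punchIn p j) (suc k)) +ᶠ s *ᶠ w
            ≈⟨ +-congˡ (*-distribʳ-sum w (λ j → a j *ᶠ U (punchIn p j) zero)) ⟩
          ∑ (λ j → a j *ᶠ U (punchIn p j) (suc k)) +ᶠ ∑ (λ j → a j *ᶠ U (punchIn p j) zero *ᶠ w)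
            ≈⟨ ∑-distrib-+ {r} _ _ ⟨
          ∑ (λ j → a j *ᶠ U (punchIn p j) (suc k) +ᶠ a j *ᶠ U (punchIn p j) zero *ᶠ w)
            ≈⟨ sum-cong-≋ {r} (λ j → trans (+-congˡ (*-assoc _ _ _)) (sym (distribˡ _ _ _))) ⟩
          ∑ (λ j → a j *ᶠ U′ j k)
            ≈⟨ aU′≈0 k ⟩
          0# ∎
          where w = -ᶠ v *ᶠ U p (suc k)

  -- The linear extension of a function on monomials. Entries of the evaluated coefficient matrix
  -- have this form, so polynomial identities are only needed under such functionals and the lists
  -- are never normalised.
  Lin : ∀ {m} → (Monomial m → Carrier) → Poly F m → Carrier
  Lin ψ = foldr (λ t a → proj₁ t *ᶠ ψ (proj₂ t) +ᶠ a) 0#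

  module _ {m : ℕ} where

    Lin-cong : ∀ {ψ ψ′ : Monomial m → Carrier} → (∀ e → ψ e ≈ ψ′ e) → ∀ f → Lin ψ f ≈ Lin ψ′ f
    Lin-cong ψ≈ψ′ []      = refl
    Lin-cong ψ≈ψ′ (t ∷ f) = +-cong (*-congˡ (ψ≈ψ′ _)) (Lin-cong ψ≈ψ′ f)

    Lin-++ : ∀ (ψ : Monomial m → Carrier) f g → Lin ψ (f ++ g) ≈ Lin ψ f +ᶠ Lin ψ g
    Lin-++ ψ []      g = sym (+-identityˡ _)
    Lin-++ ψ (t ∷ f) g = trans (+-congˡ (Lin-++ ψ f g)) (sym (+-assoc _ _ _))

    Lin-0 : ∀ (f : Poly F m) → Lin (λ _ → 0#) f ≈ 0#
    Lin-0 []      = refl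
    Lin-0 (t ∷ f) = trans (+-cong (zeroʳ _) (Lin-0 f)) (+-identityˡ _)

    Lin-+ : ∀ (ψ ψ′ : Monomial m → Carrier) f → Lin (λ e → ψ e +ᶠ ψ′ e) f ≈ Lin ψ f +ᶠ Lin ψ′ f
    Lin-+ ψ ψ′ []      = sym (+-identityˡ _)
    Lin-+ ψ ψ′ (t ∷ f) =
      trans (+-cong (distribˡ _ _ _) (Lin-+ ψ ψ′ f)) (+-interchange _ _ _ _)

    Lin-*ˡ : ∀ a (ψ : Monomial m → Carrier) f → Lin (λ e → a *ᶠ ψ e) f ≈ a *ᶠ Lin ψ f
    Lin-*ˡ a ψ []      = sym (zeroʳ a)
    Lin-*ˡ a ψ (t ∷ f) =
      trans (+-cong (x*yz≈y*xz _ _ _) (Lin-*ˡ a ψ f)) (sym (distribˡ _ _ _))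

    Lin-*ʳ : ∀ (ψ : Monomial m → Carrier) a f → Lin (λ e → ψ e *ᶠ a) f ≈ Lin ψ f *ᶠ a
    Lin-*ʳ ψ a f = trans (Lin-cong (λ e → *-comm _ _) f) (trans (Lin-*ˡ a ψ f) (*-comm _ _))

    Lin-swap : ∀ (Ψ : Monomial m → Monomial m → Carrier) f g →
               Lin (λ e → Lin (Ψ e) g) f ≈ Lin (λ e′ → Lin (λ e → Ψ e e′) f) g
    Lin-swap Ψ []      g = sym (Lin-0 g)
    Lin-swap Ψ (t ∷ f) g = begin
      proj₁ t *ᶠ Lin (Ψ (proj₂ t)) g +ᶠ Lin (λ e → Lin (Ψ e) g) f
        ≈⟨ +-cong (sym (Lin-*ˡ _ _ g)) (Lin-swap Ψ f g) ⟩
      Lin (λ e′ → proj₁ t *ᶠ Ψ (proj₂ t) e′) g +ᶠ Lin (λ e′ → Lin (λ e → Ψ e e′) f) g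
        ≈⟨ Lin-+ _ _ g ⟨
      Lin (λ e′ → Lin (λ e → Ψ e e′) (t ∷ f)) g ∎

    -- Turns a product into an iterated functional; commutativity, distributivity and interchange
    -- below then come from `Lin-swap` and linearity.
    Lin-* : ∀ (ψ : Monomial m → Carrier) f g →
            Lin ψ (_*ᵖ_ F f g) ≈ Lin (λ e → Lin (λ e′ → ψ (e ∔ e′)) g) f
    Lin-* ψ []      g = refl
    Lin-* ψ (t ∷ f) g = trans (Lin-++ ψ (map _ g) (_*ᵖ_ F f g)) (+-cong (row g) (Lin-* ψ f g))
      where
      row : ∀ g → Lin ψ (map (λ u → proj₁ t *ᶠ proj₁ u , zipWith _+_ (proj₂ t) (proj₂ u)) g) ≈
                  proj₁ t *ᶠ Lin (λ e′ → ψ (proj₂ t ∔ e′)) g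
      row []      = sym (zeroʳ _)
      row (u ∷ g) = trans (+-cong (*-assoc _ _ _) (row g)) (sym (distribˡ _ _ _))

    Lin-cong-∈ : ∀ {ψ ψ′ : Monomial m → Carrier} f → (∀ {t} → t ∈ f → ψ (proj₂ t) ≈ ψ′ (proj₂ t)) →
                 Lin ψ f ≈ Lin ψ′ f
    Lin-cong-∈ []      ψ≈ψ′ = refl
    Lin-cong-∈ (t ∷ f) ψ≈ψ′ = +-cong (*-congˡ (ψ≈ψ′ (here ≡.refl))) (Lin-cong-∈ f (ψ≈ψ′ ∘ there))

    Lin-*-comm : ∀ (ψ : Monomial m → Carrier) f g → Lin ψ (_*ᵖ_ F f g) ≈ Lin ψ (_*ᵖ_ F g f)
    Lin-*-comm ψ f g = begin
      Lin ψ (_*ᵖ_ F f g)                        ≈⟨ Lin-* ψ f g ⟩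
      Lin (λ e → Lin (λ e′ → ψ (e ∔ e′)) g) f   ≈⟨ Lin-swap _ f g ⟩
      Lin (λ e′ → Lin (λ e → ψ (e ∔ e′)) f) g
        ≈⟨ Lin-cong (λ e′ → Lin-cong (λ e → reflexive (≡.cong ψ (zipWith-comm ℕ.+-comm e e′))) f) g ⟩
      Lin (λ e′ → Lin (λ e → ψ (e′ ∔ e)) f) g   ≈⟨ Lin-* ψ g f ⟨
      Lin ψ (_*ᵖ_ F g f)                        ∎

    Lin-*-distribˡ : ∀ (ψ : Monomial m → Carrier) f g h →
                     Lin ψ (_*ᵖ_ F f (g ++ h)) ≈ Lin ψ (_*ᵖ_ F f g) +ᶠ Lin ψ (_*ᵖ_ F f h)
    Lin-*-distribˡ ψ f g h = begin
      Lin ψ (_*ᵖ_ F f (g ++ h))                         ≈⟨ Lin-* ψ f (g ++ h) ⟩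
      Lin (λ e → Lin (λ e′ → ψ (e ∔ e′)) (g ++ h)) f    ≈⟨ Lin-cong (λ e → Lin-++ _ g h) f ⟩
      Lin (λ e → Lin (λ e′ → ψ (e ∔ e′)) g +ᶠ Lin (λ e′ → ψ (e ∔ e′)) h) f
        ≈⟨ Lin-+ _ _ f ⟩
      Lin (λ e → Lin (λ e′ → ψ (e ∔ e′)) g) f +ᶠ Lin (λ e → Lin (λ e′ → ψ (e ∔ e′)) h) f
        ≈⟨ +-cong (Lin-* ψ f g) (Lin-* ψ f h) ⟨
      Lin ψ (_*ᵖ_ F f g) +ᶠ Lin ψ (_*ᵖ_ F f h)          ∎

    Lin-*-distribʳ : ∀ (ψ : Monomial m → Carrier) f g h →
                     Lin ψ (_*ᵖ_ F (g ++ h) f) ≈ Lin ψ (_*ᵖ_ F g f) +ᶠ Lin ψ (_*ᵖ_ F h f)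
    Lin-*-distribʳ ψ f g h = begin
      Lin ψ (_*ᵖ_ F (g ++ h) f)                  ≈⟨ Lin-*-comm ψ (g ++ h) f ⟩
      Lin ψ (_*ᵖ_ F f (g ++ h))                  ≈⟨ Lin-*-distribˡ ψ f g h ⟩
      Lin ψ (_*ᵖ_ F f g) +ᶠ Lin ψ (_*ᵖ_ F f h)   ≈⟨ +-cong (Lin-*-comm ψ f g) (Lin-*-comm ψ f h) ⟩
      Lin ψ (_*ᵖ_ F g f) +ᶠ Lin ψ (_*ᵖ_ F h f)   ∎

    Lin-*-* : ∀ (ψ : Monomial m → Carrier) f g h k →
              Lin ψ (_*ᵖ_ F (_*ᵖ_ F f g) (_*ᵖ_ F h k)) ≈
              Lin (λ x → Lin (λ y → Lin (λ z → Lin (λ w → ψ ((x ∔ y) ∔ (z ∔ w))) k) h) g) f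
    Lin-*-* ψ f g h k = begin
      Lin ψ (_*ᵖ_ F (_*ᵖ_ F f g) (_*ᵖ_ F h k))
        ≈⟨ Lin-* ψ (_*ᵖ_ F f g) (_*ᵖ_ F h k) ⟩
      Lin (λ e → Lin (λ e′ → ψ (e ∔ e′)) (_*ᵖ_ F h k)) (_*ᵖ_ F f g)
        ≈⟨ Lin-* _ f g ⟩
      Lin (λ x → Lin (λ y → Lin (λ e′ → ψ ((x ∔ y) ∔ e′)) (_*ᵖ_ F h k)) g) f
        ≈⟨ Lin-cong (λ x → Lin-cong (λ y → Lin-* _ h k) g) f ⟩
      Lin (λ x → Lin (λ y → Lin (λ z → Lin (λ w → ψ ((x ∔ y) ∔ (z ∔ w))) k) h) g) f ∎

    Lin-*-interchange : ∀ (ψ : Monomial m → Carrier) f g h k →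
                        Lin ψ (_*ᵖ_ F (_*ᵖ_ F f g) (_*ᵖ_ F h k)) ≈
                        Lin ψ (_*ᵖ_ F (_*ᵖ_ F f h) (_*ᵖ_ F g k))
    Lin-*-interchange ψ f g h k = begin
      Lin ψ (_*ᵖ_ F (_*ᵖ_ F f g) (_*ᵖ_ F h k))
        ≈⟨ Lin-*-* ψ f g h k ⟩
      Lin (λ x → Lin (λ y → Lin (λ z → Lin (λ w → ψ ((x ∔ y) ∔ (z ∔ w))) k) h) g) f
        ≈⟨ Lin-cong (λ x → Lin-swap _ g h) f ⟩
      Lin (λ x → Lin (λ z → Lin (λ y → Lin (λ w → ψ ((x ∔ y) ∔ (z ∔ w))) k) g) h) f
        ≈⟨ Lin-cong (λ x → Lin-cong (λ z → Lin-cong (λ y → Lin-cong (λ w →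
             reflexive (≡.cong ψ (∔-interchange x y z w))) k) g) h) f ⟩
      Lin (λ x → Lin (λ z → Lin (λ y → Lin (λ w → ψ ((x ∔ z) ∔ (y ∔ w))) k) g) h) f
        ≈⟨ Lin-*-* ψ f h g k ⟨
      Lin ψ (_*ᵖ_ F (_*ᵖ_ F f h) (_*ᵖ_ F g k)) ∎

    strip : Monomial m → Poly F m → Poly F m
    strip e = filter λ t → ¬? (≡-dec ℕ._≟_ (proj₂ t) e)

    -- All occurrences of `e` in the list are gathered into one coefficient. Peeling off a monomial
    -- in this way drives the recursions of `≈ᵖ⇒Lin≈` and `rank-sparse`.
    Lin-strip : ∀ (ψ : Monomial m → Carrier) e f → Lin ψ f ≈ coeff F f e *ᶠ ψ e +ᶠ Lin ψ (strip e f)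
    Lin-strip ψ e []      = sym (trans (+-congʳ (zeroˡ _)) (+-identityˡ _))
    Lin-strip ψ e (t ∷ f) with ≡-dec ℕ._≟_ (proj₂ t) e
    ... | yes ≡.refl = trans (+-congˡ (Lin-strip ψ e f))
                             (trans (sym (+-assoc _ _ _)) (+-congʳ (sym (distribʳ _ _ _))))
    ... | no  _      = trans (+-congˡ (Lin-strip ψ e f)) (x+yz≈y+xz _ _ _)

    coeff-strip-≡ : ∀ e f → coeff F (strip e f) e ≡ 0#
    coeff-strip-≡ e []      = ≡.refl
    coeff-strip-≡ e (t ∷ f) with ≡-dec ℕ._≟_ (proj₂ t) e in eq
    ... | yes _ = coeff-strip-≡ e f
    ... | no  _ rewrite eq = coeff-strip-≡ e f

    coeff-strip-≢ : ∀ {e e′} → e ≢ e′ → ∀ f → coeff F (strip e f) e′ ≡ coeff F f e′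
    coeff-strip-≢ {e} {e′} e≢e′ []      = ≡.refl
    coeff-strip-≢ {e} {e′} e≢e′ (t ∷ f) with ≡-dec ℕ._≟_ (proj₂ t) e
    ... | yes ≡.refl with ≡-dec ℕ._≟_ (proj₂ t) e′
    ...   | yes e≡e′ = contradiction e≡e′ e≢e′
    ...   | no  _    = coeff-strip-≢ e≢e′ f
    coeff-strip-≢ {e} {e′} e≢e′ (t ∷ f) | no _ with ≡-dec ℕ._≟_ (proj₂ t) e′
    ...   | yes _    = ≡.cong (proj₁ t +ᶠ_) (coeff-strip-≢ e≢e′ f)
    ...   | no  _    = coeff-strip-≢ e≢e′ f

    strip-cong : ∀ e {f g} → _≈ᵖ_ F f g → _≈ᵖ_ F (strip e f) (strip e g)
    strip-cong e {f} {g} f≈g e′ with ≡-dec ℕ._≟_ e e′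
    ... | yes ≡.refl = reflexive (≡.trans (coeff-strip-≡ e f) (≡.sym (coeff-strip-≡ e g)))
    ... | no  e≢e′   = trans (reflexive (coeff-strip-≢ e≢e′ f))
                             (trans (f≈g e′) (reflexive (≡.sym (coeff-strip-≢ e≢e′ g))))

    -- Polynomials with equal coefficients may be quite different lists, so the recursion runs over
    -- a list of monomials that covers both: stripping its head leaves polynomials that still agree
    -- and are covered by its tail.
    ≈ᵖ⇒Lin≈ : ∀ {f g} → _≈ᵖ_ F f g → ∀ ψ → Lin ψ f ≈ Lin ψ g
    ≈ᵖ⇒Lin≈ {f} {g} f≈g ψ = go (map proj₂ f ++ map proj₂ g) f g f≈g
      (λ t∈f → ∈-++⁺ˡ (∈-map⁺ proj₂ t∈f)) (λ t∈g → ∈-++⁺ʳ (map proj₂ f) (∈-map⁺ proj₂ t∈g))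
      where
      Covers : List (Monomial m) → Poly F m → Set c
      Covers es f = ∀ {t} → t ∈ f → proj₂ t ∈ es

      strip-covered : ∀ {e es} f → Covers (e ∷ es) f → Covers es (strip e f)
      strip-covered f covers t∈ with ∈-filter⁻ _ {xs = f} t∈
      ... | t∈f , t≢e with covers t∈f
      ...   | here t≡e  = contradiction t≡e t≢e
      ...   | there t∈es = t∈es

      go : ∀ es f g → _≈ᵖ_ F f g → Covers es f → Covers es g → Lin ψ f ≈ Lin ψ g
      go []       []      []      f≈g cf cg = refl
      go []       []      (_ ∷ _) f≈g cf cg = contradiction (cg (here ≡.refl)) λ ()
      go []       (_ ∷ _) g       f≈g cf cg = contradiction (cf (here ≡.refl)) λ ()
      go (e ∷ es) f       g       f≈g cf cg = begin
        Lin ψ f                                   ≈⟨ Lin-strip ψ e f ⟩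
        coeff F f e *ᶠ ψ e +ᶠ Lin ψ (strip e f)   ≈⟨ +-cong (*-congʳ (f≈g e))
          (go es _ _ (strip-cong e {f} {g} f≈g) (strip-covered f cf) (strip-covered g cg)) ⟩
        coeff F g e *ᶠ ψ e +ᶠ Lin ψ (strip e g)   ≈⟨ Lin-strip ψ e g ⟨
        Lin ψ g                                   ∎

  ∑ˡ : {A : Set} → (A → Carrier) → List A → Carrier
  ∑ˡ g = foldr (λ x a → g x +ᶠ a) 0#

  ∑ˡ-cong : ∀ {A : Set} {g h : A → Carrier} → (∀ x → g x ≈ h x) → ∀ xs → ∑ˡ g xs ≈ ∑ˡ h xs
  ∑ˡ-cong g≈h []       = refl
  ∑ˡ-cong g≈h (x ∷ xs) = +-cong (g≈h x) (∑ˡ-cong g≈h xs)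

  ∑ˡ-++ : ∀ {A : Set} (g : A → Carrier) xs ys → ∑ˡ g (xs ++ ys) ≈ ∑ˡ g xs +ᶠ ∑ˡ g ys
  ∑ˡ-++ g []       ys = sym (+-identityˡ _)
  ∑ˡ-++ g (x ∷ xs) ys = trans (+-congˡ (∑ˡ-++ g xs ys)) (sym (+-assoc _ _ _))

  ∑ˡ-map : ∀ {A B : Set} (g : B → Carrier) (h : A → B) xs → ∑ˡ g (map h xs) ≡ ∑ˡ (g ∘ h) xs
  ∑ˡ-map g h []       = ≡.refl
  ∑ˡ-map g h (x ∷ xs) = ≡.cong (g (h x) +ᶠ_) (∑ˡ-map g h xs)

  ∑ˡ-zero : ∀ {A : Set} {g : A → Carrier} → (∀ x → g x ≈ 0#) → ∀ xs → ∑ˡ g xs ≈ 0#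
  ∑ˡ-zero g≈0 []       = refl
  ∑ˡ-zero g≈0 (x ∷ xs) = trans (+-cong (g≈0 x) (∑ˡ-zero g≈0 xs)) (+-identityˡ 0#)

  Lin-∑ˡ : ∀ {m} {A : Set} (φ : A → Monomial m → Carrier) xs f →
           Lin (λ e → ∑ˡ (λ x → φ x e) xs) f ≈ ∑ˡ (λ x → Lin (φ x) f) xs
  Lin-∑ˡ φ []       f = Lin-0 f
  Lin-∑ˡ φ (x ∷ xs) f = trans (Lin-+ _ _ f) (+-congˡ (Lin-∑ˡ φ xs f))

  δ : ∀ {m} → Subset m → Subset m → Carrier
  δ p q = if does (≡-dec Bool._≟_ p q) then 1# else 0#

  ∑ˡ-subsets : ∀ {m} (u p : Subset m) → p ⊆ u → (g : Subset m → Carrier) →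
               ∑ˡ (λ q → δ p q *ᶠ g q) (subsets u) ≈ g p
  ∑ˡ-subsets []          []          p⊆u g = trans (+-identityʳ _) (*-identityˡ _)
  ∑ˡ-subsets (false ∷ u) (true ∷ p)  p⊆u g with () ← p⊆u here
  ∑ˡ-subsets (false ∷ u) (false ∷ p) p⊆u g = begin
    ∑ˡ (λ q → δ (false ∷ p) q *ᶠ g q) (map (false ∷_) (subsets u) ++ [])
      ≈⟨ ∑ˡ-++ _ (map (false ∷_) (subsets u)) [] ⟩
    ∑ˡ (λ q → δ (false ∷ p) q *ᶠ g q) (map (false ∷_) (subsets u)) +ᶠ 0#
      ≈⟨ +-identityʳ _ ⟩
    ∑ˡ (λ q → δ (false ∷ p) q *ᶠ g q) (map (false ∷_) (subsets u))
      ≡⟨ ∑ˡ-map _ (false ∷_) (subsets u) ⟩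
    ∑ˡ (λ q → δ p q *ᶠ g (false ∷ q)) (subsets u)
      ≈⟨ ∑ˡ-subsets u p (drop-∷-⊆ p⊆u) (g ∘ (false ∷_)) ⟩
    g (false ∷ p) ∎
  ∑ˡ-subsets (true ∷ u)  (b ∷ p)     p⊆u g = begin
    ∑ˡ (λ q → δ (b ∷ p) q *ᶠ g q) (map (false ∷_) (subsets u) ++ map (true ∷_) (subsets u))
      ≈⟨ ∑ˡ-++ _ (map (false ∷_) (subsets u)) (map (true ∷_) (subsets u)) ⟩
    ∑ˡ (λ q → δ (b ∷ p) q *ᶠ g q) (map (false ∷_) (subsets u)) +ᶠ
    ∑ˡ (λ q → δ (b ∷ p) q *ᶠ g q) (map (true ∷_) (subsets u))
      ≡⟨ ≡.cong₂ _+ᶠ_ (∑ˡ-map _ (false ∷_) (subsets u)) (∑ˡ-map _ (true ∷_) (subsets u)) ⟩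
    ∑ˡ (λ q → δ (b ∷ p) (false ∷ q) *ᶠ g (false ∷ q)) (subsets u) +ᶠ
    ∑ˡ (λ q → δ (b ∷ p) (true ∷ q) *ᶠ g (true ∷ q)) (subsets u)
      ≈⟨ halves b ⟩
    g (b ∷ p) ∎
    where
    halves : ∀ b → ∑ˡ (λ q → δ (b ∷ p) (false ∷ q) *ᶠ g (false ∷ q)) (subsets u) +ᶠ
                   ∑ˡ (λ q → δ (b ∷ p) (true ∷ q) *ᶠ g (true ∷ q)) (subsets u) ≈ g (b ∷ p)
    halves false = trans (+-cong (∑ˡ-subsets u p (drop-∷-⊆ p⊆u) (g ∘ (false ∷_)))
                                 (∑ˡ-zero (λ _ → zeroˡ _) (subsets u))) (+-identityʳ _)
    halves true  = trans (+-cong (∑ˡ-zero (λ _ → zeroˡ _) (subsets u))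
                                 (∑ˡ-subsets u p (drop-∷-⊆ p⊆u) (g ∘ (true ∷_)))) (+-identityˡ _)

  Pairs : ℕ → Set c
  Pairs N = List (Poly F N × Poly F N)

  sumᵖ : ∀ {m} → Pairs m → Poly F m
  sumᵖ = foldr (λ p f → _*ᵖ_ F (proj₁ p) (proj₂ p) ++ f) []

  Lin-sumᵖ-map : ∀ {m} {A : Set} (ψ : Monomial m → Carrier) (h : A → Poly F m × Poly F m) xs →
                 Lin ψ (sumᵖ (map h xs)) ≈ ∑ˡ (λ x → Lin ψ (_*ᵖ_ F (proj₁ (h x)) (proj₂ (h x)))) xs
  Lin-sumᵖ-map ψ h []       = refl
  Lin-sumᵖ-map ψ h (x ∷ xs) =
    trans (Lin-++ ψ (_*ᵖ_ F (proj₁ (h x)) (proj₂ (h x))) _) (+-congˡ (Lin-sumᵖ-map ψ h xs))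

  Lin-sumᵖ-++ : ∀ {m} (ψ : Monomial m → Carrier) ps qs →
                Lin ψ (sumᵖ (ps ++ qs)) ≈ Lin ψ (sumᵖ ps) +ᶠ Lin ψ (sumᵖ qs)
  Lin-sumᵖ-++ ψ []             qs = sym (+-identityˡ _)
  Lin-sumᵖ-++ ψ ((f , g) ∷ ps) qs = begin
    Lin ψ (_*ᵖ_ F f g ++ sumᵖ (ps ++ qs))                            ≈⟨ Lin-++ ψ (_*ᵖ_ F f g) _ ⟩
    Lin ψ (_*ᵖ_ F f g) +ᶠ Lin ψ (sumᵖ (ps ++ qs))                    ≈⟨ +-congˡ (Lin-sumᵖ-++ ψ ps qs) ⟩
    Lin ψ (_*ᵖ_ F f g) +ᶠ (Lin ψ (sumᵖ ps) +ᶠ Lin ψ (sumᵖ qs))       ≈⟨ +-assoc _ _ _ ⟨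
    Lin ψ (_*ᵖ_ F f g) +ᶠ Lin ψ (sumᵖ ps) +ᶠ Lin ψ (sumᵖ qs)         ≈⟨ +-congʳ (Lin-++ ψ (_*ᵖ_ F f g) _) ⟨
    Lin ψ (sumᵖ ((f , g) ∷ ps)) +ᶠ Lin ψ (sumᵖ qs)                   ∎

  _⊗_ : ∀ {m} → Poly F m × Poly F m → Poly F m × Poly F m → Poly F m × Poly F m
  (f , g) ⊗ (h , k) = _*ᵖ_ F f h , _*ᵖ_ F g k

  Lin-sumᵖ-* : ∀ {m} (ψ : Monomial m → Carrier) ps qs →
               Lin ψ (_*ᵖ_ F (sumᵖ ps) (sumᵖ qs)) ≈ Lin ψ (sumᵖ (cartesianProductWith _⊗_ ps qs))
  Lin-sumᵖ-* ψ []             qs = refl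
  Lin-sumᵖ-* ψ ((f , g) ∷ ps) qs = begin
    Lin ψ (_*ᵖ_ F (_*ᵖ_ F f g ++ sumᵖ ps) (sumᵖ qs))
      ≈⟨ Lin-*-distribʳ ψ (sumᵖ qs) (_*ᵖ_ F f g) (sumᵖ ps) ⟩
    Lin ψ (_*ᵖ_ F (_*ᵖ_ F f g) (sumᵖ qs)) +ᶠ Lin ψ (_*ᵖ_ F (sumᵖ ps) (sumᵖ qs))
      ≈⟨ +-cong (row qs) (Lin-sumᵖ-* ψ ps qs) ⟩
    Lin ψ (sumᵖ (map ((f , g) ⊗_) qs)) +ᶠ Lin ψ (sumᵖ (cartesianProductWith _⊗_ ps qs))
      ≈⟨ Lin-sumᵖ-++ ψ (map ((f , g) ⊗_) qs) _ ⟨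
    Lin ψ (sumᵖ (cartesianProductWith _⊗_ ((f , g) ∷ ps) qs)) ∎
    where
    row : ∀ qs → Lin ψ (_*ᵖ_ F (_*ᵖ_ F f g) (sumᵖ qs)) ≈ Lin ψ (sumᵖ (map ((f , g) ⊗_) qs))
    row []             = trans (Lin-* ψ (_*ᵖ_ F f g) []) (Lin-0 (_*ᵖ_ F f g))
    row ((h , k) ∷ qs) = begin
      Lin ψ (_*ᵖ_ F (_*ᵖ_ F f g) (_*ᵖ_ F h k ++ sumᵖ qs))
        ≈⟨ Lin-*-distribˡ ψ (_*ᵖ_ F f g) (_*ᵖ_ F h k) (sumᵖ qs) ⟩
      Lin ψ (_*ᵖ_ F (_*ᵖ_ F f g) (_*ᵖ_ F h k)) +ᶠ Lin ψ (_*ᵖ_ F (_*ᵖ_ F f g) (sumᵖ qs))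
        ≈⟨ +-cong (Lin-*-interchange ψ f g h k) (row qs) ⟩
      Lin ψ (_*ᵖ_ F (_*ᵖ_ F f h) (_*ᵖ_ F g k)) +ᶠ Lin ψ (sumᵖ (map ((f , g) ⊗_) qs))
        ≈⟨ Lin-++ ψ (_*ᵖ_ F (_*ᵖ_ F f h) (_*ᵖ_ F g k)) _ ⟨
      Lin ψ (sumᵖ (map ((f , g) ⊗_) ((h , k) ∷ qs))) ∎

  SupportedIn : ∀ {m} → Subset m → Poly F m → Set c
  SupportedIn X f = ∀ {t} → t ∈ f → support (proj₂ t) ⊆ X

  -- Tensor rank with respect to a colouring, modulo xᵢ² = Sᵢ xᵢ.

  module Rank {N K} (B : Fin K → Fin N) (S : Fin K → Carrier) (χ : Subset N) where

    -- For fixed p and q the entry M_f(p, q)|_S is a functional Lin (val θ) of f with θ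
    -- reduced (see kernel below), and this class of functionals is closed under
    -- composition with multiplication by a monomial.
    Weight : Set c
    Weight = Fin K → ℕ → Carrier

    -- In each variable, the functional that sends x^e to `θ k e` vanishes on the multiples of x² -
    -- Sx.
    Reduced : Weight → Set ℓ₁
    Reduced θ = ∀ k e → θ k (2 + e) ≈ S k *ᶠ θ k (1 + e)

    val : Weight → Monomial N → Carrier
    val θ e = ∏ λ k → θ k (lookup e (B k))

    shift : Monomial N → Weight → Weight
    shift e θ k x = θ k (x + lookup e (B k))

    val-∔ : ∀ θ e e′ → val θ (e ∔ e′) ≈ val (shift e′ θ) e
    val-∔ θ e e′ = ∏-cong {K} λ k → reflexive (≡.cong (θ k) (lookup-zipWith _+_ (B k) e e′))

    -- Plays the role of equality in the quotient algebra, which is not constructed: two polynomials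
    -- are identified when all reduced product functionals agree on them.
    infix 4 _≃_
    _≃_ : Poly F N → Poly F N → Set (c ⊔ˡ ℓ₁)
    f ≃ g = ∀ θ → Reduced θ → Lin (val θ) f ≈ Lin (val θ) g

    -- For each monomial e′ of `g`, multiplying by e′ and then testing with θ is testing with the
    -- shifted weight. The shift only raises exponents, so it keeps the weight reduced.
    *ᵖ-congʳ : ∀ {f f′} g → f ≃ f′ → _*ᵖ_ F f g ≃ _*ᵖ_ F f′ g
    *ᵖ-congʳ {f} {f′} g f≃f′ θ red = begin
      Lin (val θ) (_*ᵖ_ F f g)                            ≈⟨ Lin-* _ f g ⟩
      Lin (λ e → Lin (λ e′ → val θ (e ∔ e′)) g) f       ≈⟨ Lin-swap _ f g ⟩
      Lin (λ e′ → Lin (λ e → val θ (e ∔ e′)) f) g       ≈⟨ Lin-cong (λ e′ → trans (Lin-cong (λ e → val-∔ θ e e′) f)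
                                                            (trans (f≃f′ (shift e′ θ) (λ k x → red k _))
                                                                   (Lin-cong (λ e → sym (val-∔ θ e e′)) f′))) g ⟩
      Lin (λ e′ → Lin (λ e → val θ (e ∔ e′)) f′) g      ≈⟨ Lin-swap _ f′ g ⟨
      Lin (λ e → Lin (λ e′ → val θ (e ∔ e′)) g) f′      ≈⟨ Lin-* _ f′ g ⟨
      Lin (val θ) (_*ᵖ_ F f′ g)                           ∎

    *ᵖ-cong : ∀ {f f′ g g′} → f ≃ f′ → g ≃ g′ → _*ᵖ_ F f g ≃ _*ᵖ_ F f′ g′
    *ᵖ-cong {f} {f′} {g} {g′} f≃f′ g≃g′ θ red = begin
      Lin (val θ) (_*ᵖ_ F f g)     ≈⟨ *ᵖ-congʳ {f} {f′} g f≃f′ θ red ⟩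
      Lin (val θ) (_*ᵖ_ F f′ g)    ≈⟨ Lin-*-comm _ f′ g ⟩
      Lin (val θ) (_*ᵖ_ F g f′)    ≈⟨ *ᵖ-congʳ {g} {g′} f′ g≃g′ θ red ⟩
      Lin (val θ) (_*ᵖ_ F g′ f′)   ≈⟨ Lin-*-comm _ g′ f′ ⟩
      Lin (val θ) (_*ᵖ_ F f′ g′)   ∎

    Only : Bool → Poly F N → Set c
    Only b f = ∀ {t} → t ∈ f → ∀ i → lookup χ i ≡ not b → lookup (proj₂ t) i ≡ 0

    Only-* : ∀ {b f g} → Only b f → Only b g → Only b (_*ᵖ_ F f g)
    Only-* {f = f} {g} only-f only-g t∈ i χi with ∈-cartesianProductWith⁻ _ f g t∈
    ... | u , v , u∈f , v∈g , ≡.refl =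
      ≡.trans (lookup-zipWith _+_ i (proj₂ u) (proj₂ v)) (≡.cong₂ _+_ (only-f u∈f i χi) (only-g v∈g i χi))

    Split : Poly F N × Poly F N → Set c
    Split (f , g) = Only true f × Only false g

    record RankAtMost (r : ℕ) (f : Poly F N) : Set (c ⊔ˡ ℓ₁) where
      constructor decomposition
      field
        pairs    : Pairs N
        length≤r : length pairs ≤ r
        split    : All Split pairs
        sum≃     : f ≃ sumᵖ pairs

    rank-mono : ∀ {r r′ f} → r ≤ r′ → RankAtMost r f → RankAtMost r′ f
    rank-mono r≤r′ (decomposition ps l s f≃) = decomposition ps (ℕ.≤-trans l r≤r′) s f≃

    rank-+ : ∀ {r r′ f g} → RankAtMost r f → RankAtMost r′ g → RankAtMost (r + r′) (f ++ g)
    rank-+ {f = f} {g} (decomposition ps l s f≃) (decomposition qs l′ s′ g≃) = decomposition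
      (ps ++ qs)
      (ℕ.≤-trans (ℕ.≤-reflexive (length-++ ps)) (ℕ.+-mono-≤ l l′))
      (All.++⁺ s s′)
      λ θ red → trans (Lin-++ _ f g)
        (trans (+-cong (f≃ θ red) (g≃ θ red)) (sym (Lin-sumᵖ-++ _ ps qs)))

    -- This is submultiplicativity of tensor rank, so f and g may share variables.
    rank-* : ∀ {r r′ f g} → RankAtMost r f → RankAtMost r′ g → RankAtMost (r * r′) (_*ᵖ_ F f g)
    rank-* {f = f} {g} (decomposition ps l s f≃) (decomposition qs l′ s′ g≃) = decomposition
      (cartesianProductWith _⊗_ ps qs)
      (ℕ.≤-trans (ℕ.≤-reflexive (length-cartesianProductWith _⊗_ ps qs)) (ℕ.*-mono-≤ l l′))
      (All.cartesianProductWith⁺ (≡.setoid _) (≡.setoid _) _⊗_ ps qs λ {p} {q} p∈ q∈ →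
        Only-* {f = proj₁ p} {proj₁ q} (proj₁ (All.lookup s p∈)) (proj₁ (All.lookup s′ q∈)) ,
        Only-* {f = proj₂ p} {proj₂ q} (proj₂ (All.lookup s p∈)) (proj₂ (All.lookup s′ q∈)))
      λ θ red → trans (*ᵖ-cong {f} {sumᵖ ps} {g} {sumᵖ qs} f≃ g≃ θ red) (Lin-sumᵖ-* _ ps qs)

    Only-part : ∀ b a e → Only b ((a , part b χ e) ∷ [])
    Only-part b a e (here ≡.refl) i χi = ≡.trans (lookup-part b i χ e) (outside-part b χi)
      where
      outside-part : ∀ b {c x} → c ≡ not b → (if does (c Bool.≟ b) then x else 0) ≡ 0
      outside-part true  ≡.refl = ≡.refl
      outside-part false ≡.refl = ≡.refl

    -- A monomial is the product of its Y-part and its Z-part, so each listed monomial costs one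
    -- pair.
    rank-sparse : ∀ {r f} → AtMostMonomials F r f → RankAtMost r f
    rank-sparse {f = f} (es , l , covers) = rank-mono l (go es f covers)
      where
      go : ∀ es f → (∀ e → ¬ coeff F f e ≈ 0# → e ∈ es) → RankAtMost (length es) f
      go []       f covers = decomposition [] z≤n [] λ θ red →
        -- With no monomial left, the covering only says that no coefficient is nonzero; stability
        -- of equality turns this into vanishing.
        ≈ᵖ⇒Lin≈ {f = f} {[]} (λ e → ≈-stable λ ce≉0 → contradiction (covers e ce≉0) λ ()) (val θ)
      go (e ∷ es) f covers with go es (strip e f) covers′
        where
        covers′ : ∀ e′ → ¬ coeff F (strip e f) e′ ≈ 0# → e′ ∈ es
        covers′ e′ c≉0 with ≡-dec ℕ._≟_ e e′
        ... | yes ≡.refl = contradiction (reflexive (coeff-strip-≡ e f)) c≉0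
        ... | no  e≢e′ with covers e′ (λ c≈0 → c≉0 (trans (reflexive (coeff-strip-≢ e≢e′ f)) c≈0))
        ...   | here e′≡e   = contradiction (≡.sym e′≡e) e≢e′
        ...   | there e′∈es = e′∈es
      ... | decomposition ps l s f≃ = decomposition
        (((coeff F f e , part true χ e) ∷ [] , (1# , part false χ e) ∷ []) ∷ ps)
        (s≤s l)
        ((Only-part true _ e , Only-part false _ e) ∷ s)
        λ θ red → trans (Lin-strip (val θ) e f)
          (+-cong (*-cong (sym (*-identityʳ _)) (reflexive (≡.cong (val θ) (≡.sym (part-∔-part χ e)))))
                  (f≃ θ red))

    private module _ (b : Bool) where

      -- Reducing x^e to x by means of x² = Sx produces S^(e - 1); at e = 0 the truncated
      -- subtraction gives 1, as it should.
      weight : Monomial N → Carrier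
      weight e = ∏ λ k → if does (lookup χ (B k) Bool.≟ b) then S k ^ᶠ (lookup e (B k) ∸ 1) else 1#

      key : Monomial N → Subset N
      key e = side b χ (support e)

      squarefree : Monomial N → Subset N → Monomial N
      squarefree e p = part b χ (multilinear p) ∔ part (not b) χ e

      reduce : ∀ θ → Reduced θ → ∀ e → weight e *ᶠ val θ (squarefree e (key e)) ≈ (val θ) e
      reduce θ red e = trans (sym (∏-distrib-* {K} _ _)) (∏-cong {K} λ k →
        trans (*-congˡ (reflexive (≡.cong (θ k) (lookup-squarefree (B k)))))
              (pointwise k (lookup χ (B k)) b (lookup e (B k))))
        where
        exponent : Bool → Bool → ℕ → ℕ
        exponent c b x =
          (if does (c Bool.≟ b) then (if does (c Bool.≟ b) ∧ (0 <ᵇ x) then 1 else 0) else 0)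
          + (if does (c Bool.≟ not b) then x else 0)

        lookup-squarefree : ∀ i → lookup (squarefree e (key e)) i ≡ exponent (lookup χ i) b (lookup e i)
        lookup-squarefree i
          rewrite lookup-zipWith _+_ i (part b χ (multilinear (key e))) (part (not b) χ e)
                | lookup-part b i χ (multilinear (key e))
                | lookup-part (not b) i χ e
                | lookup-map i (λ b → if b then 1 else 0) (key e)
                | lookup-zipWith (λ c x → does (c Bool.≟ b) ∧ x) i χ (support e)
                | lookup-map i (0 <ᵇ_) e = ≡.refl

        power : ∀ k x → S k ^ᶠ (x ∸ 1) *ᶠ θ k (if 0 <ᵇ x then 1 else 0) ≈ θ k x
        power k zero          = *-identityˡ _
        power k (suc zero)    = *-identityˡ _
        power k (suc (suc x)) = trans (*-assoc _ _ _) (trans (*-congˡ (power k (suc x))) (sym (red k x)))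

        pointwise : ∀ k c b x → (if does (c Bool.≟ b) then S k ^ᶠ (x ∸ 1) else 1#) *ᶠ θ k (exponent c b x)
                                ≈ θ k x
        pointwise k true  true  x =
          trans (*-congˡ (reflexive (≡.cong (θ k) (ℕ.+-identityʳ _)))) (power k x)
        pointwise k false false x =
          trans (*-congˡ (reflexive (≡.cong (θ k) (ℕ.+-identityʳ _)))) (power k x)
        pointwise k true  false x = *-identityˡ _
        pointwise k false true  x = *-identityˡ _

      -- The two factors of the group with key `p`. The factor δ annihilates the terms with another
      -- key instead of filtering them out, so that the sum over `p` can be exchanged with the sum
      -- over terms.
      left right : Poly F N → Subset N → Poly F N
      left  f p = (1# , part b χ (multilinear p)) ∷ []
      right f p = map (λ t → proj₁ t *ᶠ (δ (key (proj₂ t)) p *ᶠ weight (proj₂ t)) ,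
                             part (not b) χ (proj₂ t)) f

      Lin-left-right : ∀ ψ f p → Lin ψ (_*ᵖ_ F (left f p) (right f p)) ≈
                       Lin (λ e → δ (key e) p *ᶠ (weight e *ᶠ ψ (squarefree e p))) f
      Lin-left-right ψ f p = begin
        Lin ψ (_*ᵖ_ F (left f p) (right f p))
          ≈⟨ Lin-* ψ (left f p) (right f p) ⟩
        1# *ᶠ Lin (λ e → ψ (part b χ (multilinear p) ∔ e)) (right f p) +ᶠ 0#
          ≈⟨ trans (+-identityʳ _) (*-identityˡ _) ⟩
        Lin (λ e → ψ (part b χ (multilinear p) ∔ e)) (right f p)
          ≈⟨ Lin-right f ⟩
        Lin (λ e → δ (key e) p *ᶠ (weight e *ᶠ ψ (squarefree e p))) f ∎
        where
        Lin-right : ∀ f → Lin (λ e → ψ (part b χ (multilinear p) ∔ e)) (right f p) ≈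
                          Lin (λ e → δ (key e) p *ᶠ (weight e *ᶠ ψ (squarefree e p))) f
        Lin-right []      = refl
        Lin-right (t ∷ f) = +-cong (trans (*-assoc _ _ _) (*-congˡ (*-assoc _ _ _))) (Lin-right f)

      -- Grouping the terms of f by the variables of one side that occur in them.
      group : ∀ {X f} → SupportedIn X f → ∀ θ → Reduced θ →
              ∑ˡ (λ p → Lin (val θ) (_*ᵖ_ F (left f p) (right f p))) (subsets (side b χ X)) ≈ Lin (val θ) f
      group {X} {f} f⊆X θ red = begin
        ∑ˡ (λ p → Lin (val θ) (_*ᵖ_ F (left f p) (right f p))) ps
          ≈⟨ ∑ˡ-cong (Lin-left-right (val θ) f) ps ⟩
        ∑ˡ (λ p → Lin (λ e → δ (key e) p *ᶠ (weight e *ᶠ val θ (squarefree e p))) f) ps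
          ≈⟨ Lin-∑ˡ (λ p e → δ (key e) p *ᶠ (weight e *ᶠ val θ (squarefree e p))) ps f ⟨
        Lin (λ e → ∑ˡ (λ p → δ (key e) p *ᶠ (weight e *ᶠ val θ (squarefree e p))) ps) f
          ≈⟨ Lin-cong-∈ f (λ {t} t∈f → trans
               (∑ˡ-subsets (side b χ X) _ (side-mono b χ (f⊆X t∈f)) (λ p → weight (proj₂ t) *ᶠ val θ (squarefree (proj₂ t) p)))
               (reduce θ red (proj₂ t))) ⟩
        Lin (val θ) f ∎
        where ps = subsets (side b χ X)

      Only-left : ∀ f p → Only b (left f p)
      Only-left f p = Only-part b 1# (multilinear p)

      Only-right : ∀ f p → Only (not b) (right f p)
      Only-right f p u∈ with ∈-map⁻ _ u∈
      ... | t , _ , ≡.refl = Only-part (not b) (proj₁ t) (proj₂ t) (here ≡.refl)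

    -- After reduction the side `b` of a monomial is determined by the set of its variables there,
    -- so the number of groups does not depend on the exponents.
    rank-side : ∀ {X f} b → SupportedIn X f → RankAtMost (2 ^ ∣ side b χ X ∣) f
    rank-side {X} {f} true  f⊆X = decomposition
      (map (λ p → left true f p , right true f p) (subsets (side true χ X)))
      (ℕ.≤-reflexive (≡.trans (length-map _ (subsets (side true χ X))) (length-subsets (side true χ X))))
      (All.map⁺ (All.universal (λ p → (λ {_} → Only-left true f p) , λ {_} → Only-right true f p) _))
      λ θ red → trans (sym (group true {X} {f} f⊆X θ red))
                      (sym (Lin-sumᵖ-map (val θ) (λ p → left true f p , right true f p) (subsets (side true χ X))))
    rank-side {X} {f} false f⊆X = decomposition
      (map (λ p → right false f p , left false f p) (subsets (side false χ X)))
      (ℕ.≤-reflexive (≡.trans (length-map _ (subsets (side false χ X))) (length-subsets (side false χ X))))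
      (All.map⁺ (All.universal (λ p → (λ {_} → Only-right false f p) , λ {_} → Only-left false f p) _))
      λ θ red → begin
        Lin (val θ) f
          ≈⟨ group false {X} {f} f⊆X θ red ⟨
        ∑ˡ (λ p → Lin (val θ) (_*ᵖ_ F (left false f p) (right false f p))) (subsets (side false χ X))
          ≈⟨ ∑ˡ-cong (λ p → Lin-*-comm (val θ) (left false f p) (right false f p)) (subsets (side false χ X)) ⟩
        ∑ˡ (λ p → Lin (val θ) (_*ᵖ_ F (right false f p) (left false f p))) (subsets (side false χ X))
          ≈⟨ Lin-sumᵖ-map (val θ) (λ p → right false f p , left false f p) (subsets (side false χ X)) ⟨
        Lin (val θ) (sumᵖ (map (λ p → right false f p , left false f p) (subsets (side false χ X)))) ∎

  -- From tensor rank to the rank of the coefficient matrix.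

  ∏-split : ∀ m {n} (g : Fin (m + n) → Carrier) → ∏ g ≈ ∏ (λ i → g (i ↑ˡ n)) *ᶠ ∏ (λ j → g (m ↑ʳ j))
  ∏-split zero    g = sym (*-identityˡ _)
  ∏-split (suc m) g = trans (*-congˡ (∏-split m (g ∘ suc))) (sym (*-assoc _ _ _))

  -- The contribution of one variable, occurring with exponent x, to the entry at a
  -- monomial pq that contains the variable iff w.
  kernel : Carrier → Bool → ℕ → Carrier
  kernel s w x = if does ((0 <ᵇ x) Bool.≟ w) then s ^ᶠ (x ∸ (if w then 1 else 0)) else 0#

  kernel-reduced : ∀ s w x → kernel s w (2 + x) ≈ s *ᶠ kernel s w (1 + x)
  kernel-reduced s true  x = refl
  kernel-reduced s false x = sym (zeroʳ s)

  ∏-kernel : ∀ {K} (S : Fin K → Carrier) (w : Subset K) (e : Monomial K) →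
             ∏ (λ k → kernel (S k) (lookup w k) (lookup e k)) ≈
             (if does (≡-dec Bool._≟_ (support e) w)
              then ∏ (λ k → S k ^ᶠ lookup (zipWith _∸_ e (multilinear w)) k) else 0#)
  ∏-kernel S []      []      = refl
  ∏-kernel S (b ∷ w) (x ∷ e) with does ((0 <ᵇ x) Bool.≟ b)
  ... | false = zeroˡ _
  ... | true with does (≡-dec Bool._≟_ (support e) w) | ∏-kernel (S ∘ suc) w e
  ...   | true  | ih = *-congˡ ih
  ...   | false | ih = trans (*-congˡ ih) (zeroʳ _)

  module _ (n : ℕ) (A : Fin (2 * n) ↔ (Fin n ⊎ Fin n)) (χ : Subset (2 * n))
           (A-true : ∀ i → lookup χ (Inverse.from A (inj₁ i)) ≡ true)
           (A-false : ∀ j → lookup χ (Inverse.from A (inj₂ j)) ≡ false) where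

    private
      position : Fin (n + n) → Fin (2 * n)
      position k = Inverse.from A (splitAt n k)

    module _ (S : Fin (n + n) → Carrier) where

      open Rank position S χ

      private
        θ : Subset n → Subset n → Weight
        θ p q k = kernel (S k) (lookup (p Vec.++ q) k)

        pulled : Monomial (2 * n) → Monomial (n + n)
        pulled e = tabulate λ k → lookup e (position k)

        val-θ : ∀ p q e → val (θ p q) e ≈
                (if does (≡-dec Bool._≟_ (support (pulled e)) (p Vec.++ q))
                 then ∏ (λ k → S k ^ᶠ lookup (zipWith _∸_ (pulled e) (multilinear (p Vec.++ q))) k) else 0#)
        val-θ p q e = trans
          (∏-cong {n + n} λ k → reflexive (≡.cong (kernel (S k) _) (≡.sym (lookup∘tabulate _ k))))
          (∏-kernel S (p Vec.++ q) (pulled e))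

      -- Selecting the terms of support pq and dividing them by pq is done by `kernel`: a variable
      -- whose occurrence disagrees with pq contributes a zero factor.
      entry : ∀ f p q → eval F S (coefficientMatrix F n (substitute F n A f) p q) ≈ Lin (val (θ p q)) f
      entry []      p q = refl
      entry (t ∷ f) p q
        with does (≡-dec Bool._≟_ (support (pulled (proj₂ t))) (p Vec.++ q)) | val-θ p q (proj₂ t)
      ... | true  | val≈ = +-cong (*-congˡ (sym val≈)) (entry f p q)
      ... | false | val≈ = trans (entry f p q)
        (sym (trans (+-congʳ (trans (*-congˡ val≈) (zeroʳ _))) (+-identityˡ _)))

      private
        -- The Y-half and the Z-half of `val (θ p q)`. On a product of a Y-only and a Z-only
        -- polynomial they separate, giving a row factor times a column factor.
        α β : Subset n → Monomial (2 * n) → Carrier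
        α p e = ∏ λ i → kernel (S (i ↑ˡ n)) (lookup p i) (lookup e (Inverse.from A (inj₁ i)))
        β q e = ∏ λ j → kernel (S (n ↑ʳ j)) (lookup q j) (lookup e (Inverse.from A (inj₂ j)))

        val-θ-∔ : ∀ p q {f g t u} → Only true f → Only false g → t ∈ f → u ∈ g →
                val (θ p q) (proj₂ t ∔ proj₂ u) ≈ α p (proj₂ t) *ᶠ β q (proj₂ u)
        val-θ-∔ p q {t = t} {u} only-f only-g t∈ u∈ =
          trans (∏-split n (λ k → θ p q k (lookup (proj₂ t ∔ proj₂ u) (position k))))
                (*-cong (∏-cong {n} λ i → reflexive (≡.cong₂ (kernel _) (lookup-++ˡ p q i) (left i)))
                        (∏-cong {n} λ j → reflexive (≡.cong₂ (kernel _) (lookup-++ʳ p q j) (right j))))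
          where
          left : ∀ i → lookup (proj₂ t ∔ proj₂ u) (position (i ↑ˡ n)) ≡ lookup (proj₂ t) (Inverse.from A (inj₁ i))
          left i rewrite splitAt-↑ˡ n i n
                       | lookup-zipWith _+_ (Inverse.from A (inj₁ i)) (proj₂ t) (proj₂ u)
                       | only-g u∈ (Inverse.from A (inj₁ i)) (A-true i) = ℕ.+-identityʳ _
          right : ∀ j → lookup (proj₂ t ∔ proj₂ u) (position (n ↑ʳ j)) ≡ lookup (proj₂ u) (Inverse.from A (inj₂ j))
          right j rewrite splitAt-↑ʳ n n j
                        | lookup-zipWith _+_ (Inverse.from A (inj₂ j)) (proj₂ t) (proj₂ u)
                        | only-f t∈ (Inverse.from A (inj₂ j)) (A-false j) = ≡.refl

        Lin-pair : ∀ p q f g → Only true f → Only false g →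
                   Lin (val (θ p q)) (_*ᵖ_ F f g) ≈ Lin (α p) f *ᶠ Lin (β q) g
        Lin-pair p q f g only-f only-g = begin
          Lin (val (θ p q)) (_*ᵖ_ F f g)                       ≈⟨ Lin-* _ f g ⟩
          Lin (λ e → Lin (λ e′ → val (θ p q) (e ∔ e′)) g) f    ≈⟨ Lin-cong-∈ f (λ {t} t∈ → Lin-cong-∈ g λ {u} u∈ →
                                                                   val-θ-∔ p q {f} {g} {t} {u} only-f only-g t∈ u∈) ⟩
          Lin (λ e → Lin (λ e′ → α p e *ᶠ β q e′) g) f         ≈⟨ Lin-cong (λ e → Lin-*ˡ (α p e) (β q) g) f ⟩
          Lin (λ e → α p e *ᶠ Lin (β q) g) f                   ≈⟨ Lin-*ʳ (α p) (Lin (β q) g) f ⟩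
          Lin (α p) f *ᶠ Lin (β q) g                           ∎

        Lin-pairs : ∀ p q ps → All Split ps → Lin (val (θ p q)) (sumᵖ ps) ≈
                    ∑ λ k → Lin (α p) (proj₁ (List.lookup ps k)) *ᶠ Lin (β q) (proj₂ (List.lookup ps k))
        Lin-pairs p q []             []                       = refl
        Lin-pairs p q ((f , g) ∷ ps) ((only-f , only-g) ∷ ss) =
          trans (Lin-++ _ (_*ᵖ_ F f g) (sumᵖ ps)) (+-cong (Lin-pair p q f g only-f only-g) (Lin-pairs p q ps ss))

      -- A decomposition factors the evaluated matrix as UV with one inner index per pair. U then
      -- has more rows than columns, and a dependency among its rows is one among the chosen rows of
      -- the matrix.
      rank<⇒dependent-rows : ∀ {r f} → RankAtMost r f → ∀ {l} → r < l → (rows : Fin l → Subset n) →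
        ¬ LinearlyIndependent F λ i → evalMatrix F S (coefficientMatrix F n (substitute F n A f)) (rows i)
      rank<⇒dependent-rows {f = f} (decomposition ps length≤ split f≃) {l} r<l rows independent =
        more-rows-than-columns⇒dependent U (ℕ.≤-<-trans length≤ r<l) λ a aU≈0 → independent a λ q → begin
          ∑ (λ i → a i *ᶠ evalMatrix F S (coefficientMatrix F n (substitute F n A f)) (rows i) q)
            ≈⟨ sum-cong-≋ {l} (λ i → *-congˡ (row i q)) ⟩
          ∑ (λ i → a i *ᶠ ∑ (λ k → U i k *ᶠ V k q))
            ≈⟨ sum-cong-≋ {l} (λ i → *-distribˡ-sum (a i) (λ k → U i k *ᶠ V k q)) ⟩
          ∑ (λ i → ∑ (λ k → a i *ᶠ (U i k *ᶠ V k q)))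
            ≈⟨ ∑-comm (λ i k → a i *ᶠ (U i k *ᶠ V k q)) ⟩
          ∑ (λ k → ∑ (λ i → a i *ᶠ (U i k *ᶠ V k q)))
            ≈⟨ ∑-zero (λ k → ∑ (λ i → a i *ᶠ (U i k *ᶠ V k q))) (λ k → begin
                 ∑ (λ i → a i *ᶠ (U i k *ᶠ V k q))   ≈⟨ sum-cong-≋ {l} (λ i → sym (*-assoc _ _ _)) ⟩
                 ∑ (λ i → a i *ᶠ U i k *ᶠ V k q)     ≈⟨ *-distribʳ-sum (V k q) (λ i → a i *ᶠ U i k) ⟨
                 ∑ (λ i → a i *ᶠ U i k) *ᶠ V k q     ≈⟨ *-congʳ (aU≈0 k) ⟩
                 0# *ᶠ V k q                         ≈⟨ zeroˡ _ ⟩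
                 0#                                  ∎) ⟩
          0# ∎
        where
        U : Fin l → Fin (length ps) → Carrier
        U i k = Lin (α (rows i)) (proj₁ (List.lookup ps k))

        V : Fin (length ps) → Subset n → Carrier
        V k q = Lin (β q) (proj₂ (List.lookup ps k))

        row : ∀ i q → evalMatrix F S (coefficientMatrix F n (substitute F n A f)) (rows i) q ≈
                      ∑ (λ k → U i k *ᶠ V k q)
        row i q = trans (entry f (rows i) q)
          (trans (f≃ (θ (rows i) q) (λ k x → kernel-reduced (S k) (lookup (rows i Vec.++ q) k) x))
                 (Lin-pairs (rows i) q ps split))

    rank<⇒¬HasMaxRank : ∀ {r f g} → (∀ S → Rank.RankAtMost position S χ r g) → _≈ᵖ_ F g f →
                        ∀ {l} → r < l → ¬ HasMaxRank F (coefficientMatrix F n (substitute F n A f)) l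
    rank<⇒¬HasMaxRank {f = f} {g} rank g≈f r<l ((S , (rows , independent) , _) , _) =
      rank<⇒dependent-rows S rank-f r<l rows independent
      where
      open Rank position S χ
      rank-f : RankAtMost _ f
      rank-f with rank S
      ... | decomposition ps length≤ split g≃ = decomposition ps length≤ split λ θ red →
        trans (sym (≈ᵖ⇒Lin≈ {f = g} {f} g≈f (val θ))) (g≃ θ red)

open import Data.Bool using (_∨_)
open import Data.Bool.Properties using
  (∨-conicalˡ; ∨-conicalʳ; ∧-conicalˡ; ∧-conicalʳ; ∧-zeroʳ; ∧-distribˡ-∨)
open import Data.Fin.Subset using (_∪_; _∩_; ∁; Empty; Nonempty; ⁅_⁆) renaming (_∈_ to _∈ˢ_)
open import Data.Fin.Subset.Properties using
  (nonempty?; x∈p∪q⁻; p⊆p∪q; q⊆p∪q; ∣p∣≤∣p∪q∣; ∣q∣≤∣p∪q∣; ∣∁p∣≡n∸∣p∣; ∣p∣≤n)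
open import Data.List.Membership.Propositional.Properties using (∈-++⁻)
open import Data.Nat 
open import Data.Nat.Combinatorics using (_C_; nCk+nC[k+1]≡[n+1]C[k+1])
open import Data.Nat.Properties
open import Data.Nat.Tactic.RingSolver using (solve-∀)
open import Data.Rational using (ℚ; 0ℚ) renaming (_<_ to _<ℚ_; _/_ to _/ℚ_)
open import Data.Vec using (replicate)
open import Relation.Binary.PropositionalEquality
open import Relation.Nullary.Decidable using (dec-true; toWitness)
import Data.Integer as ℤ
import Data.Rational.Properties as ℚ
import Data.Sum as Sum

-- Balanced sets, and the rank of a formula under a fixed colouring.

∣side∣+∣side∣ : ∀ {N} (χ X : Subset N) → ∣ side true χ X ∣ + ∣ side false χ X ∣ ≡ ∣ X ∣
∣side∣+∣side∣ []          []          = refl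
∣side∣+∣side∣ (true ∷ χ)  (true ∷ X)  = cong suc (∣side∣+∣side∣ χ X)
∣side∣+∣side∣ (true ∷ χ)  (false ∷ X) = ∣side∣+∣side∣ χ X
∣side∣+∣side∣ (false ∷ χ) (true ∷ X)  = trans (+-suc _ _) (cong suc (∣side∣+∣side∣ χ X))
∣side∣+∣side∣ (false ∷ χ) (false ∷ X) = ∣side∣+∣side∣ χ X

∣p∪q∣≡∣p∣+∣q∣ : ∀ {N} (p q : Subset N) → Empty (p ∩ q) → ∣ p ∪ q ∣ ≡ ∣ p ∣ + ∣ q ∣
∣p∪q∣≡∣p∣+∣q∣ []          []          _ = refl
∣p∪q∣≡∣p∣+∣q∣ (true ∷ p)  (true ∷ q)  e = contradiction (zero , here) e
∣p∪q∣≡∣p∣+∣q∣ (true ∷ p)  (false ∷ q) e = cong suc (∣p∪q∣≡∣p∣+∣q∣ p q λ { (i , i∈) → e (suc i , there i∈) })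
∣p∪q∣≡∣p∣+∣q∣ (false ∷ p) (true ∷ q)  e =
  trans (cong suc (∣p∪q∣≡∣p∣+∣q∣ p q λ { (i , i∈) → e (suc i , there i∈) })) (sym (+-suc _ _))
∣p∪q∣≡∣p∣+∣q∣ (false ∷ p) (false ∷ q) e = ∣p∪q∣≡∣p∣+∣q∣ p q λ { (i , i∈) → e (suc i , there i∈) }

support-zero : ∀ {m} → support (replicate m 0) ≡ replicate m false
support-zero {zero}  = refl
support-zero {suc m} = cong (false ∷_) support-zero

support-multilinear : ∀ {m} (p : Subset m) → support (multilinear p) ≡ p
support-multilinear []          = refl
support-multilinear (false ∷ p) = cong (false ∷_) (support-multilinear p)
support-multilinear (true ∷ p)  = cong (true ∷_) (support-multilinear p)

support-∔ : ∀ {m} (e e′ : Monomial m) → support (e ∔ e′) ≡ support e ∪ support e′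
support-∔ []          []       = refl
support-∔ (zero ∷ e)  (y ∷ e′) = cong (_ ∷_) (support-∔ e e′)
support-∔ (suc x ∷ e) (y ∷ e′) = cong (true ∷_) (support-∔ e e′)

2⌊n/2⌋≤n : ∀ n → ⌊ n /2⌋ + ⌊ n /2⌋ ≤ n
2⌊n/2⌋≤n zero          = z≤n
2⌊n/2⌋≤n (suc zero)    = z≤n
2⌊n/2⌋≤n (suc (suc n)) = s≤s (≤-trans (≤-reflexive (+-suc _ _)) (s≤s (2⌊n/2⌋≤n n)))

n≤1+2⌊n/2⌋ : ∀ n → n ≤ suc (⌊ n /2⌋ + ⌊ n /2⌋)
n≤1+2⌊n/2⌋ zero          = z≤n
n≤1+2⌊n/2⌋ (suc zero)    = s≤s z≤n
n≤1+2⌊n/2⌋ (suc (suc n)) = s≤s (s≤s (≤-trans (n≤1+2⌊n/2⌋ n) (≤-reflexive (sym (+-suc _ _)))))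

∪-mono : ∀ {m} {p p′ q q′ : Subset m} → p ⊆ p′ → q ⊆ q′ → p ∪ q ⊆ p′ ∪ q′
∪-mono {p = p} {p′} {q} {q′} p⊆p′ q⊆q′ i∈ with x∈p∪q⁻ p q i∈
... | inj₁ i∈p = p⊆p∪q q′ (p⊆p′ i∈p)
... | inj₂ i∈q = q⊆p∪q p′ q′ (q⊆q′ i∈q)

balanced : ∀ {N} → ℕ → Subset N → Subset N → Bool
balanced k χ X = (y <ᵇ z + k) ∧ (z <ᵇ y + k)
  where
  y = ∣ side true χ X ∣
  z = ∣ side false χ X ∣

<ᵇ-false⇒≥ : ∀ {m n} → (m <ᵇ n) ≡ false → n ≤ m
<ᵇ-false⇒≥ {m} {n} eq = ≮⇒≥ λ m<n → subst Bool.T eq (<⇒<ᵇ m<n)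

-- Twice the smaller side plus k is at most ∣X∣: the imbalance itself is what is saved.
unbalanced : ∀ {N} k (χ X : Subset N) → balanced k χ X ≡ false → ∀ e → ∣ X ∣ ≤ e + e + k →
             ∣ side true χ X ∣ ≤ e ⊎ ∣ side false χ X ∣ ≤ e
unbalanced k χ X eq e X≤ with ∣ side true χ X ∣ <ᵇ ∣ side false χ X ∣ + k in y<z+k
... | true  = inj₁ (halve (∣ side true χ X ∣) (∣ side false χ X ∣) (<ᵇ-false⇒≥ eq)
                         (subst (_≤ e + e + k) (sym (∣side∣+∣side∣ χ X)) X≤))
  where
  halve : ∀ a b → a + k ≤ b → a + b ≤ e + e + k → a ≤ e
  halve a b a+k≤b a+b≤ = ≮⇒≥ λ e<a → <⇒≱ (+-mono-< e<a e<a) (+-cancelʳ-≤ k (a + a) (e + e)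
    (≤-trans (≤-reflexive (+-assoc a a k)) (≤-trans (+-monoʳ-≤ a a+k≤b) a+b≤)))
... | false = inj₂ (halve (∣ side true χ X ∣) (∣ side false χ X ∣) (<ᵇ-false⇒≥ y<z+k)
                         (subst (_≤ e + e + k) (sym (∣side∣+∣side∣ χ X)) X≤))
  where
  halve : ∀ a b → b + k ≤ a → a + b ≤ e + e + k → b ≤ e
  halve a b b+k≤a a+b≤ = ≮⇒≥ λ e<b → <⇒≱ (+-mono-< e<b e<b) (+-cancelʳ-≤ k (b + b) (e + e)
    (≤-trans (≤-reflexive (trans (+-assoc b b k) (+-comm b (b + k)))) (≤-trans (+-monoˡ-≤ b b+k≤a) a+b≤)))

small-side : ∀ {N} (χ X : Subset N) e → ∣ X ∣ ≤ suc (e + e) → ∣ side true χ X ∣ ≤ e ⊎ ∣ side false χ X ∣ ≤ e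
small-side χ X e X≤ with ∣ side true χ X ∣ ≤? e
... | yes y≤e = inj₁ y≤e
... | no  y≰e = inj₂ (s≤s⁻¹ (+-cancelˡ-≤ e _ _ (begin
  e + suc ∣ side false χ X ∣            ≡⟨ +-suc e _ ⟩
  suc e + ∣ side false χ X ∣            ≤⟨ +-monoˡ-≤ _ (≰⇒> y≰e) ⟩
  ∣ side true χ X ∣ + ∣ side false χ X ∣ ≡⟨ ∣side∣+∣side∣ χ X ⟩
  ∣ X ∣                                 ≤⟨ X≤ ⟩
  suc (e + e)                           ≡⟨ +-suc e e ⟨
  e + suc e                             ∎)))
  where open ≤-Reasoning

-- Bad φ χ says that on some path down from the root of φ that never leaves more
-- than half of the variables behind in one step, all subformulas down to one with
-- fewer than T variables are k-balanced.
module Paths {c ℓ₁ ℓ₂} (F : HeytingField c ℓ₁ ℓ₂) {N : ℕ} (k T : ℕ) where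

  Bad below : Formula F N → Subset N → Bool
  child : ℕ → Formula F N → Subset N → Bool

  Bad φ χ = balanced k χ (vars F φ) ∧ ((∣ vars F φ ∣ <ᵇ T) ∨ below φ χ)

  below (var i)         χ = false
  below (const a)       χ = false
  below (gate₁ o φ)     χ = child (∣ vars F φ ∣) φ χ
  below (gate₂ o φ ψ)   χ = child (∣ vars F φ ∪ vars F ψ ∣) φ χ ∨ child (∣ vars F φ ∪ vars F ψ ∣) ψ χ

  child m φ χ = (m ≤ᵇ ∣ vars F φ ∣ + ∣ vars F φ ∣) ∧ Bad φ χ

  1≤size : ∀ (φ : Formula F N) → 1 ≤ size F φ
  1≤size (var i)       = ≤-refl
  1≤size (const a)     = ≤-refl
  1≤size (gate₁ o φ)   = s≤s z≤n
  1≤size (gate₂ o φ ψ) = s≤s z≤n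

  module _ {K} (B : Fin K → Fin N) (S : Fin K → HeytingField.Carrier F) (χ : Subset N) where

    open OverField F using (SupportedIn; module Rank)
    open Rank B S χ

    supported : ∀ (φ : Formula F N) → SupportedIn (vars F φ) (⟦_⟧ F φ)
    supported (var i) (here refl) = subst (_⊆ ⁅ i ⁆) (sym (support-multilinear ⁅ i ⁆)) (λ i∈ → i∈)
    supported (const a) (here refl) i∈ = subst (_ Data.Fin.Subset.∈_) (support-zero {N}) i∈
    supported (gate₁ o φ) = supported φ
    supported (gate₂ plus φ ψ) t∈ with ∈-++⁻ (⟦_⟧ F φ) t∈
    ... | inj₁ t∈φ = p⊆p∪q (vars F ψ) ∘ supported φ t∈φ
    ... | inj₂ t∈ψ = q⊆p∪q (vars F φ) (vars F ψ) ∘ supported ψ t∈ψ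
    supported (gate₂ times φ ψ) t∈ with ∈-cartesianProductWith⁻ _ (⟦_⟧ F φ) (⟦_⟧ F ψ) t∈
    ... | u , v , u∈ , v∈ , refl rewrite support-∔ (proj₂ u) (proj₂ v) =
      ∪-mono (supported φ u∈) (supported ψ v∈)

    rank-min : ∀ φ e → ∣ side true χ (vars F φ) ∣ ≤ e ⊎ ∣ side false χ (vars F φ) ∣ ≤ e →
               RankAtMost (2 ^ e) (⟦_⟧ F φ)
    rank-min φ e (inj₁ y≤e) = rank-mono (^-monoʳ-≤ 2 y≤e) (rank-side true (supported φ))
    rank-min φ e (inj₂ z≤e) = rank-mono (^-monoʳ-≤ 2 z≤e) (rank-side false (supported φ))

    rank-term : ∀ a e → RankAtMost 1 ((a , e) ∷ [])
    rank-term a e = rank-sparse (e ∷ [] , ≤-refl , covers)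
      where
      covers : ∀ e′ → ¬ HeytingField._≈_ F (coeff F ((a , e) ∷ []) e′) (HeytingField.0# F) → e′ ∈ (e ∷ [])
      covers e′ c≉0 with ≡-dec _≟_ e e′
      ... | yes refl = here refl
      ... | no  _    = contradiction (HeytingField.refl F) c≉0

    module _ (s : ℕ) (k+k≤T : k + k ≤ T) where

      -- The number `e` is a budget, always used with ∣X∣ ≤ 2e + k. The size pays for sums of ranks,
      -- the power of 2^s for the sparse factors met on a path, and 2^e for the variables.
      bound : Formula F N → ℕ → ℕ
      bound φ e = size F φ * 2 ^ (s * productSparseDepth F φ) * 2 ^ e

      2^e≤bound : ∀ φ e → 2 ^ e ≤ bound φ e
      2^e≤bound φ e = begin
        2 ^ e            ≡⟨ *-identityˡ _ ⟨
        1 * 1 * 2 ^ e    ≤⟨ *-monoˡ-≤ (2 ^ e) (*-mono-≤ (1≤size φ) (^-monoʳ-≤ 2 (z≤n {s * productSparseDepth F φ}))) ⟩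
        bound φ e        ∎
        where open ≤-Reasoning

      ⊔-depth : ∀ (φ ψ : Formula F N) → productSparseDepth F φ ⊔ productSparseDepth F ψ ≤
                        productSparseDepth F (gate₂ times φ ψ)
      ⊔-depth φ ψ = m≤n+m _ (if does (nonempty? (vars F φ ∩ vars F ψ)) then 1 else 0)

      suc-⊔-depth : ∀ (φ ψ : Formula F N) → Nonempty (vars F φ ∩ vars F ψ) →
                    suc (productSparseDepth F φ ⊔ productSparseDepth F ψ) ≤
                    productSparseDepth F (gate₂ times φ ψ)
      suc-⊔-depth φ ψ meets
        rewrite dec-true (nonempty? (vars F φ ∩ vars F ψ)) meets = ≤-refl

      sparse-bound : ∀ (φ : Formula F N) {n d} → size F φ ≤ n → suc (productSparseDepth F φ) ≤ d → ∀ e →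
                     2 ^ s * bound φ e ≤ n * 2 ^ (s * d) * 2 ^ e
      sparse-bound φ {n} {d} size≤n δ<d e = begin
        2 ^ s * (size F φ * 2 ^ (s * δ) * 2 ^ e)
          ≡⟨ rearrange (2 ^ s) (size F φ) (2 ^ (s * δ)) (2 ^ e) ⟩
        size F φ * (2 ^ s * 2 ^ (s * δ)) * 2 ^ e
          ≡⟨ cong (λ x → size F φ * x * 2 ^ e) (trans (sym (^-distribˡ-+-* 2 s (s * δ))) (cong (2 ^_) (sym (*-suc s δ)))) ⟩
        size F φ * 2 ^ (s * suc δ) * 2 ^ e
          ≤⟨ *-monoˡ-≤ (2 ^ e) (*-mono-≤ size≤n (^-monoʳ-≤ 2 (*-monoʳ-≤ s δ<d))) ⟩
        n * 2 ^ (s * d) * 2 ^ e ∎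
        where
        open ≤-Reasoning
        δ = productSparseDepth F φ
        rearrange : ∀ a b c d → a * (b * c * d) ≡ b * (a * c) * d
        rearrange = solve-∀

      product-bound : ∀ (φ ψ : Formula F N) {n d} → size F φ ≤ n → productSparseDepth F φ ≤ d →
                      ∀ e → ⌊ ∣ vars F ψ ∣ /2⌋ ≤ e →
                      2 ^ ⌊ ∣ vars F ψ ∣ /2⌋ * bound φ (e ∸ ⌊ ∣ vars F ψ ∣ /2⌋) ≤ n * 2 ^ (s * d) * 2 ^ e
      product-bound φ ψ {n} {d} size≤n δ≤d e μ≤e = begin
        2 ^ μ * (size F φ * 2 ^ (s * δ) * 2 ^ (e ∸ μ))
          ≡⟨ rearrange (2 ^ μ) (size F φ * 2 ^ (s * δ)) (2 ^ (e ∸ μ)) ⟩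
        size F φ * 2 ^ (s * δ) * (2 ^ μ * 2 ^ (e ∸ μ))
          ≡⟨ cong (size F φ * 2 ^ (s * δ) *_) (trans (sym (^-distribˡ-+-* 2 μ (e ∸ μ))) (cong (2 ^_) (m+[n∸m]≡n μ≤e))) ⟩
        size F φ * 2 ^ (s * δ) * 2 ^ e
          ≤⟨ *-monoˡ-≤ (2 ^ e) (*-mono-≤ size≤n (^-monoʳ-≤ 2 (*-monoʳ-≤ s δ≤d))) ⟩
        n * 2 ^ (s * d) * 2 ^ e ∎
        where
        open ≤-Reasoning
        δ = productSparseDepth F φ
        μ = ⌊ ∣ vars F ψ ∣ /2⌋
        rearrange : ∀ a b c → a * (b * c) ≡ b * (a * c)
        rearrange = solve-∀

      k≤larger : ∀ (φ ψ : Formula F N) → ∣ vars F ψ ∣ ≤ ∣ vars F φ ∣ → T ≤ ∣ vars F φ ∣ + ∣ vars F ψ ∣ → k ≤ ∣ vars F φ ∣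
      k≤larger φ ψ ψ≤φ T≤ = ≮⇒≥ λ φ<k → <⇒≱ (+-mono-< φ<k φ<k)
        (≤-trans k+k≤T (≤-trans T≤ (+-monoʳ-≤ _ ψ≤φ)))

      -- The slack k in the budget is covered by the larger factor, which has at least k variables
      -- because 2k ≤ T. Hence the smaller factor fits into 2e.
      half≤ : ∀ (φ ψ : Formula F N) {e} → ∣ vars F ψ ∣ ≤ ∣ vars F φ ∣ → ∣ vars F φ ∣ + ∣ vars F ψ ∣ ≤ e + e + k →
              T ≤ ∣ vars F φ ∣ + ∣ vars F ψ ∣ → ⌊ ∣ vars F ψ ∣ /2⌋ ≤ e
      half≤ φ ψ {e} ψ≤φ X≤ T≤ = ≮⇒≥ λ e<μ → <⇒≱ (+-mono-< e<μ e<μ)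
        (≤-trans (2⌊n/2⌋≤n (∣ vars F ψ ∣)) (+-cancelˡ-≤ k _ _ (begin
          k + ∣ vars F ψ ∣              ≤⟨ +-monoˡ-≤ _ (k≤larger φ ψ ψ≤φ T≤) ⟩
          ∣ vars F φ ∣ + ∣ vars F ψ ∣   ≤⟨ X≤ ⟩
          e + e + k                     ≡⟨ +-comm (e + e) k ⟩
          k + (e + e)                   ∎)))
        where open ≤-Reasoning

      -- Charging the smaller factor only half of its variables leaves the larger one a budget with
      -- the same slack k, so the saving survives the product.
      remaining : ∀ (φ ψ : Formula F N) {e} → ∣ vars F ψ ∣ ≤ ∣ vars F φ ∣ → ∣ vars F φ ∣ + ∣ vars F ψ ∣ ≤ e + e + k →
                  T ≤ ∣ vars F φ ∣ + ∣ vars F ψ ∣ →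
                  ∣ vars F φ ∣ ≤ (e ∸ ⌊ ∣ vars F ψ ∣ /2⌋) + (e ∸ ⌊ ∣ vars F ψ ∣ /2⌋) + k
      remaining φ ψ {e} ψ≤φ X≤ T≤ = +-cancelʳ-≤ (μ + μ) _ _ (begin
        ∣ vars F φ ∣ + (μ + μ)             ≤⟨ +-monoʳ-≤ _ (2⌊n/2⌋≤n (∣ vars F ψ ∣)) ⟩
        ∣ vars F φ ∣ + ∣ vars F ψ ∣        ≤⟨ X≤ ⟩
        e + e + k                          ≡⟨ cong (λ x → x + x + k) (m∸n+n≡m (half≤ φ ψ ψ≤φ X≤ T≤)) ⟨
        (e ∸ μ + μ) + (e ∸ μ + μ) + k      ≡⟨ rearrange (e ∸ μ) μ k ⟩
        (e ∸ μ) + (e ∸ μ) + k + (μ + μ)    ∎)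
        where
        open ≤-Reasoning
        μ = ⌊ ∣ vars F ψ ∣ /2⌋
        rearrange : ∀ a b c → a + b + (a + b) + c ≡ a + a + c + (b + b)
        rearrange = solve-∀

      child-good : ∀ m φ → child m φ χ ≡ false → m ≤ ∣ vars F φ ∣ + ∣ vars F φ ∣ → Bad φ χ ≡ false
      child-good m φ good m≤ with m ≤ᵇ ∣ vars F φ ∣ + ∣ vars F φ ∣ in eq
      ... | true  = good
      ... | false = contradiction (subst Bool.T eq (≤⇒≤ᵇ m≤)) λ ()

      -- An unbalanced gate yields the saving outright; at a balanced one it has to come from the
      -- children, to which the budget is handed down.
      rank-good : ∀ φ → EveryProductDisjointOrSparse F s φ → Bad φ χ ≡ false →
                  ∀ e → ∣ vars F φ ∣ ≤ e + e + k → RankAtMost (bound φ e) (⟦_⟧ F φ)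
      rank-below : ∀ φ → EveryProductDisjointOrSparse F s φ → below φ χ ≡ false → T ≤ ∣ vars F φ ∣ →
                   ∀ e → ∣ vars F φ ∣ ≤ e + e + k → RankAtMost (bound φ e) (⟦_⟧ F φ)
      rank-child : ∀ φ → EveryProductDisjointOrSparse F s φ → ∀ m → child m φ χ ≡ false →
                   T ≤ m → ∣ vars F φ ∣ ≤ m →
                   ∀ e → m ≤ e + e + k → RankAtMost (bound φ e) (⟦_⟧ F φ)

      rank-good φ ok good e X≤ with balanced k χ (vars F φ) in bal
      ... | false = rank-mono (2^e≤bound φ e) (rank-min φ e (unbalanced k χ (vars F φ) bal e X≤))
      -- A balanced set with fewer than T variables would make `Bad` true, so only the large case
      -- remains.
      ... | true with ∣ vars F φ ∣ <ᵇ T in X<T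
      ...   | false = rank-below φ ok good (<ᵇ-false⇒≥ X<T) e X≤

      rank-child φ ok m good T≤m X≤m e m≤ with m ≤ᵇ ∣ vars F φ ∣ + ∣ vars F φ ∣ in eq
      ... | true  = rank-good φ ok good e (≤-trans X≤m m≤)
      -- The path does not enter this child, and nothing is known of its balance. But 2X < m and 2k
      -- ≤ T ≤ m give X + k ≤ m, hence X ≤ 2e, and the smaller side alone fits the budget.
      ... | false = rank-mono (2^e≤bound φ e) (rank-min φ e (small-side χ (vars F φ) e
          (m≤n⇒m≤1+n X≤e+e)))
        where
        X = ∣ vars F φ ∣
        X+X<m : X + X < m
        X+X<m = ≰⇒> λ m≤X+X → subst Bool.T eq (≤⇒≤ᵇ m≤X+X)
        X+k≤m : X + k ≤ m
        X+k≤m = ≮⇒≥ λ m<X+k → <⇒≱ (+-mono-< m<X+k m<X+k)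
          (≤-trans (≤-reflexive (twice X k)) (+-mono-≤ (<⇒≤ X+X<m) (≤-trans k+k≤T T≤m)))
          where
          twice : ∀ X k → X + k + (X + k) ≡ X + X + (k + k)
          twice = solve-∀
        X≤e+e : X ≤ e + e
        X≤e+e = +-cancelʳ-≤ k X (e + e) (≤-trans X+k≤m m≤)

      rank-below (var i)   ok good T≤ e X≤ =
        rank-mono (≤-trans (^-monoʳ-≤ 2 (z≤n {e})) (2^e≤bound (var i) e)) (rank-term _ _)
      rank-below (const a) ok good T≤ e X≤ =
        rank-mono (≤-trans (^-monoʳ-≤ 2 (z≤n {e})) (2^e≤bound (const a) e)) (rank-term _ _)
      rank-below (gate₁ o φ) ok good T≤ e X≤ = rank-mono
        (*-monoˡ-≤ (2 ^ e) (*-monoˡ-≤ (2 ^ (s * productSparseDepth F φ)) (n≤1+n (size F φ))))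
        (rank-child φ ok _ good T≤ ≤-refl e X≤)
      rank-below (gate₂ plus φ ψ) (okφ , okψ) good T≤ e X≤ = rank-mono
        (begin
          bound φ e + bound ψ e
            ≤⟨ +-mono-≤ (*-monoˡ-≤ (2 ^ e) (*-monoʳ-≤ (size F φ) (^-monoʳ-≤ 2 (*-monoʳ-≤ s (m≤m⊔n δφ δψ)))))
                        (*-monoˡ-≤ (2 ^ e) (*-monoʳ-≤ (size F ψ) (^-monoʳ-≤ 2 (*-monoʳ-≤ s (m≤n⊔m δφ δψ))))) ⟩
          size F φ * 2 ^ (s * (δφ ⊔ δψ)) * 2 ^ e + size F ψ * 2 ^ (s * (δφ ⊔ δψ)) * 2 ^ e
            ≡⟨ factor (size F φ) (size F ψ) _ _ ⟩
          (size F φ + size F ψ) * 2 ^ (s * (δφ ⊔ δψ)) * 2 ^ e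
            ≤⟨ *-monoˡ-≤ (2 ^ e) (*-monoˡ-≤ (2 ^ (s * (δφ ⊔ δψ))) (n≤1+n (size F φ + size F ψ))) ⟩
          bound (gate₂ plus φ ψ) e ∎)
        (rank-+ {f = ⟦_⟧ F φ} {⟦_⟧ F ψ}
          (rank-child φ okφ _ (∨-conicalˡ (child ∣φ∪ψ∣ φ χ) _ good) T≤ (∣p∣≤∣p∪q∣ (vars F φ) (vars F ψ)) e X≤)
          (rank-child ψ okψ _ (∨-conicalʳ (child ∣φ∪ψ∣ φ χ) _ good) T≤ (∣q∣≤∣p∪q∣ (vars F φ) (vars F ψ)) e X≤))
        where
        open ≤-Reasoning
        δφ = productSparseDepth F φ
        δψ = productSparseDepth F ψ
        ∣φ∪ψ∣ = ∣ vars F φ ∪ vars F ψ ∣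
        factor : ∀ a b p q → a * p * q + b * p * q ≡ (a + b) * p * q
        factor = solve-∀
      rank-below (gate₂ times φ ψ) (ok , okφ , okψ) good T≤ e X≤ = by-cases (nonempty? (vars F φ ∩ vars F ψ)) ok
        where
        δφ = productSparseDepth F φ
        δψ = productSparseDepth F ψ
        ∣φ∣ = ∣ vars F φ ∣
        ∣ψ∣ = ∣ vars F ψ ∣
        ∣φ∪ψ∣ = ∣ vars F φ ∪ vars F ψ ∣

        size-φ≤ : size F φ ≤ size F (gate₂ times φ ψ)
        size-φ≤ = m≤n⇒m≤1+n (m≤m+n (size F φ) (size F ψ))

        size-ψ≤ : size F ψ ≤ size F (gate₂ times φ ψ)
        size-ψ≤ = m≤n⇒m≤1+n (m≤n+m (size F ψ) (size F φ))

        Goal = RankAtMost (bound (gate₂ times φ ψ) e) (⟦_⟧ F (gate₂ times φ ψ))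

        -- The larger factor has at least half of the variables, so the path enters it and it is
        -- good; the smaller one gets the trivial bound.
        disjoint-case : ∣ vars F φ ∪ vars F ψ ∣ ≡ ∣φ∣ + ∣ψ∣ → ∣φ∣ ≤ ∣ψ∣ ⊎ ∣ψ∣ ≤ ∣φ∣ → Goal
        disjoint-case X≡ (inj₁ φ≤ψ) = rank-mono
          (product-bound ψ φ size-ψ≤ (≤-trans (m≤n⊔m δφ δψ) (⊔-depth φ ψ)) e (half≤ ψ φ φ≤ψ ψ+φ≤ T≤ψ+φ))
          (rank-* {f = ⟦_⟧ F φ} {⟦_⟧ F ψ}
            (rank-min φ ⌊ ∣φ∣ /2⌋ (small-side χ (vars F φ) ⌊ ∣φ∣ /2⌋ (n≤1+2⌊n/2⌋ ∣φ∣)))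
            (rank-good ψ okψ
              (child-good ∣φ∪ψ∣ ψ (∨-conicalʳ (child ∣φ∪ψ∣ φ χ) _ good)
                (≤-trans (≤-reflexive X≡) (+-monoˡ-≤ _ φ≤ψ))) (e ∸ ⌊ ∣φ∣ /2⌋)
              (remaining ψ φ {e} φ≤ψ ψ+φ≤ T≤ψ+φ)))
          where
          ψ+φ≡ = trans (+-comm ∣ψ∣ ∣φ∣) (sym X≡)
          ψ+φ≤ = ≤-trans (≤-reflexive ψ+φ≡) X≤
          T≤ψ+φ = ≤-trans T≤ (≤-reflexive (sym ψ+φ≡))
        disjoint-case X≡ (inj₂ ψ≤φ) = rank-mono
          (≤-trans (≤-reflexive (*-comm (bound φ (e ∸ ⌊ ∣ψ∣ /2⌋)) (2 ^ ⌊ ∣ψ∣ /2⌋)))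
            (product-bound φ ψ size-φ≤ (≤-trans (m≤m⊔n δφ δψ) (⊔-depth φ ψ)) e (half≤ φ ψ ψ≤φ φ+ψ≤ T≤φ+ψ)))
          (rank-* {f = ⟦_⟧ F φ} {⟦_⟧ F ψ}
            (rank-good φ okφ
              (child-good ∣φ∪ψ∣ φ (∨-conicalˡ (child ∣φ∪ψ∣ φ χ) _ good)
                (≤-trans (≤-reflexive X≡) (+-monoʳ-≤ _ ψ≤φ))) (e ∸ ⌊ ∣ψ∣ /2⌋)
              (remaining φ ψ {e} ψ≤φ φ+ψ≤ T≤φ+ψ))
            (rank-min ψ ⌊ ∣ψ∣ /2⌋ (small-side χ (vars F ψ) ⌊ ∣ψ∣ /2⌋ (n≤1+2⌊n/2⌋ ∣ψ∣))))
          where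
          φ+ψ≤ = ≤-trans (≤-reflexive (sym X≡)) X≤
          T≤φ+ψ = ≤-trans T≤ (≤-reflexive X≡)

        by-cases : Dec (Nonempty (vars F φ ∩ vars F ψ)) → Disjoint F φ ψ ⊎ Sparse F s φ ψ → Goal
        -- Disjointness is decided here rather than read off `ok`: the depth grows only at gates
        -- whose children meet, so a factor 2^s may be charged only there.
        by-cases (no disjoint) _               =
          disjoint-case (∣p∪q∣≡∣p∣+∣q∣ (vars F φ) (vars F ψ) disjoint) (≤-total ∣φ∣ ∣ψ∣)
        by-cases (yes meets)   (inj₁ disjoint) = contradiction meets disjoint
        by-cases (yes meets)   (inj₂ (inj₁ sparse)) = rank-mono
          (sparse-bound ψ size-ψ≤ (≤-trans (s≤s (m≤n⊔m δφ δψ)) (suc-⊔-depth φ ψ meets)) e)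
          (rank-* {f = ⟦_⟧ F φ} {⟦_⟧ F ψ}
            (rank-sparse sparse)
            (rank-child ψ okψ _ (∨-conicalʳ (child ∣φ∪ψ∣ φ χ) _ good) T≤ (∣q∣≤∣p∪q∣ (vars F φ) (vars F ψ)) e X≤))
        by-cases (yes meets)   (inj₂ (inj₂ sparse)) = rank-mono
          (≤-trans (≤-reflexive (*-comm (bound φ e) (2 ^ s)))
            (sparse-bound φ size-φ≤ (≤-trans (s≤s (m≤m⊔n δφ δψ)) (suc-⊔-depth φ ψ meets)) e))
          (rank-* {f = ⟦_⟧ F φ} {⟦_⟧ F ψ}
            (rank-child φ okφ _ (∨-conicalˡ (child ∣φ∪ψ∣ φ χ) _ good) T≤ (∣p∣≤∣p∪q∣ (vars F φ) (vars F ψ)) e X≤)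
            (rank-sparse sparse))

-- Estimates for binomial coefficients.

^-distribʳ-* : ∀ n a b → (a * b) ^ n ≡ a ^ n * b ^ n
^-distribʳ-* zero    a b = refl
^-distribʳ-* (suc n) a b =
  trans (cong (a * b *_) (^-distribʳ-* n a b)) ([m*n]*[o*p]≡[m*o]*[n*p] a b (a ^ n) (b ^ n))

-- This is (j + 1) C(m, j + 1) = (m - j) C(m, j) with the subtraction moved across, so that it holds
-- for j > m as well.
C-absorb : ∀ m j → suc j * (m C suc j) + j * (m C j) ≡ m * (m C j)
C-absorb zero    zero    = refl
C-absorb zero    (suc j) = cong₂ _+_ (*-zeroʳ (suc (suc j))) (*-zeroʳ (suc j))
C-absorb (suc m) zero    = begin
  1 * (suc m C 1) + 0       ≡⟨ cong (λ x → 1 * x + 0) (nCk+nC[k+1]≡[n+1]C[k+1] m 0) ⟨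
  1 * (1 + (m C 1)) + 0     ≡⟨ rearrange (m C 1) ⟩
  1 + (1 * (m C 1) + 0 * 1) ≡⟨ cong (1 +_) (C-absorb m 0) ⟩
  suc m * 1                 ∎
  where
  open ≡-Reasoning
  rearrange : ∀ x → 1 * (1 + x) + 0 ≡ 1 + (1 * x + 0 * 1)
  rearrange = solve-∀
C-absorb (suc m) (suc j) = begin
  suc (suc j) * (suc m C suc (suc j)) + suc j * (suc m C suc j)
    ≡⟨ cong₂ (λ x y → suc (suc j) * x + suc j * y) (nCk+nC[k+1]≡[n+1]C[k+1] m (suc j)) (nCk+nC[k+1]≡[n+1]C[k+1] m j) ⟨
  suc (suc j) * ((m C suc j) + (m C suc (suc j))) + suc j * ((m C j) + (m C suc j))
    ≡⟨ rearrange j (m C j) (m C suc j) (m C suc (suc j)) ⟩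
  (suc (suc j) * (m C suc (suc j)) + suc j * (m C suc j)) + (suc j * (m C suc j) + j * (m C j)) + ((m C suc j) + (m C j))
    ≡⟨ cong₂ (λ x y → x + y + ((m C suc j) + (m C j))) (C-absorb m (suc j)) (C-absorb m j) ⟩
  m * (m C suc j) + m * (m C j) + ((m C suc j) + (m C j))
    ≡⟨ factor m (m C suc j) (m C j) ⟩
  suc m * ((m C j) + (m C suc j))
    ≡⟨ cong (suc m *_) (nCk+nC[k+1]≡[n+1]C[k+1] m j) ⟩
  suc m * (suc m C suc j) ∎
  where
  open ≡-Reasoning
  rearrange : ∀ j x y z → suc (suc j) * (y + z) + suc j * (x + y) ≡
                          (suc (suc j) * z + suc j * y) + (suc j * y + j * x) + (y + x)
  rearrange = solve-∀
  factor : ∀ m y x → m * y + m * x + (y + x) ≡ suc m * (x + y)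
  factor = solve-∀

C-increasing : ∀ a j → j < a → (a + a) C j ≤ (a + a) C suc j
C-increasing a j j<a = *-cancelˡ-≤ (suc j) (+-cancelʳ-≤ (j * x) _ _ (begin
  suc j * x + j * x     ≡⟨ *-distribʳ-+ x (suc j) j ⟨
  (suc j + j) * x       ≤⟨ *-monoˡ-≤ x (+-mono-≤ j<a (<⇒≤ j<a)) ⟩
  (a + a) * x           ≡⟨ C-absorb (a + a) j ⟨
  suc j * y + j * x     ∎))
  where
  open ≤-Reasoning
  x = (a + a) C j
  y = (a + a) C suc j

C-decreasing : ∀ a j → a ≤ j → (a + a) C suc j ≤ (a + a) C j
C-decreasing a j a≤j = *-cancelˡ-≤ (suc j) (+-cancelʳ-≤ (j * x) _ _ (begin
  suc j * y + j * x     ≡⟨ C-absorb (a + a) j ⟩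
  (a + a) * x           ≤⟨ *-monoˡ-≤ x (+-mono-≤ (m≤n⇒m≤1+n a≤j) a≤j) ⟩
  (suc j + j) * x       ≡⟨ *-distribʳ-+ x (suc j) j ⟩
  suc j * x + j * x     ∎))
  where
  open ≤-Reasoning
  x = (a + a) C j
  y = (a + a) C suc j

C≤central : ∀ a j → (a + a) C j ≤ (a + a) C a
C≤central a j with ≤-total j a
... | inj₁ j≤a = go (a ∸ j) j (m∸n+n≡m j≤a)
  where
  go : ∀ d j → d + j ≡ a → (a + a) C j ≤ (a + a) C a
  go zero    j refl = ≤-refl
  go (suc d) j eq   = ≤-trans (C-increasing a j (≤-trans (s≤s (m≤n+m j d)) (≤-reflexive eq)))
                              (go d (suc j) (trans (+-suc d j) eq))
... | inj₂ a≤j = subst (λ j → (a + a) C j ≤ (a + a) C a) (m∸n+n≡m a≤j) (go (j ∸ a))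
  where
  go : ∀ d → (a + a) C (d + a) ≤ (a + a) C a
  go zero    = ≤-refl
  go (suc d) = ≤-trans (C-decreasing a (d + a) (m≤n+m a d)) (go d)

central : ℕ → ℕ
central a = (a + a) C a

central-suc : ∀ a → suc a * central (suc a) ≡ 2 * suc (a + a) * central a
central-suc a = begin
  suc a * ((suc a + suc a) C suc a)
    ≡⟨ cong (λ m → suc a * (m C suc a)) (+-suc (suc a) a) ⟩
  suc a * (suc (suc (a + a)) C suc a)
    ≡⟨ cong (suc a *_) (nCk+nC[k+1]≡[n+1]C[k+1] (suc (a + a)) a) ⟨
  suc a * ((suc (a + a) C a) + (suc (a + a) C suc a))
    ≡⟨ cong (λ x → suc a * (x + (suc (a + a) C suc a))) symmetric ⟨
  suc a * ((suc (a + a) C suc a) + (suc (a + a) C suc a))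
    ≡⟨ cong (λ x → suc a * (x + x)) (nCk+nC[k+1]≡[n+1]C[k+1] (a + a) a) ⟨
  suc a * ((central a + z) + (central a + z))
    ≡⟨ expand a (central a) z ⟩
  2 * (suc a * central a + suc a * z)
    ≡⟨ cong (λ x → 2 * (suc a * central a + x)) absorbed ⟩
  2 * (suc a * central a + a * central a)
    ≡⟨ collect a (central a) ⟩
  2 * suc (a + a) * central a ∎
  where
  open ≡-Reasoning
  z = (a + a) C suc a
  expand : ∀ a x z → suc a * ((x + z) + (x + z)) ≡ 2 * (suc a * x + suc a * z)
  expand = solve-∀
  collect : ∀ a x → 2 * (suc a * x + a * x) ≡ 2 * suc (a + a) * x
  collect = solve-∀
  absorbed : suc a * z ≡ a * central a
  absorbed = +-cancelʳ-≡ (a * central a) _ _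
    (trans (C-absorb (a + a) a) (*-distribʳ-+ (central a) a a))
  symmetric : suc (a + a) C suc a ≡ suc (a + a) C a
  symmetric = *-cancelˡ-≡ _ _ (suc a) (+-cancelʳ-≡ (a * (suc (a + a) C a)) _ _
    (trans (C-absorb (suc (a + a)) a) (*-distribʳ-+ (suc (a + a) C a) (suc a) a)))

central-lower : ∀ a → 4 ^ a ≤ central a * suc (a + a)
central-lower zero    = ≤-refl
central-lower (suc a) = *-cancelˡ-≤ (suc a) (begin
  suc a * (4 * 4 ^ a)                             ≤⟨ *-monoʳ-≤ (suc a) (*-monoʳ-≤ 4 (central-lower a)) ⟩
  suc a * (4 * (central a * suc (a + a)))         ≡⟨ rearrange a (central a) ⟩
  2 * suc (a + a) * central a * (suc a + suc a)   ≡⟨ cong (_* (suc a + suc a)) (central-suc a) ⟨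
  suc a * central (suc a) * (suc a + suc a)       ≤⟨ *-monoʳ-≤ (suc a * central (suc a)) (n≤1+n (suc a + suc a)) ⟩
  suc a * central (suc a) * suc (suc a + suc a)   ≡⟨ *-assoc (suc a) (central (suc a)) (suc (suc a + suc a)) ⟩
  suc a * (central (suc a) * suc (suc a + suc a)) ∎)
  where
  open ≤-Reasoning
  rearrange : ∀ a x → suc a * (4 * (x * suc (a + a))) ≡ 2 * suc (a + a) * x * (suc a + suc a)
  rearrange = solve-∀

-- The squared form of C(2a, a) ≤ 4^a / √(2a + 1). The induction step comes down to (2a + 1)(2a + 3)
-- ≤ (2a + 2)².
central-upper : ∀ a → central a * central a * suc (a + a) ≤ 16 ^ a
central-upper zero    = ≤-refl
central-upper (suc a) = *-cancelˡ-≤ (suc a * suc a) (begin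
  suc a * suc a * (central (suc a) * central (suc a) * suc (suc a + suc a))
    ≡⟨ square (suc a) (central (suc a)) (suc (suc a + suc a)) ⟩
  (suc a * central (suc a)) * (suc a * central (suc a)) * suc (suc a + suc a)
    ≡⟨ cong (λ x → x * x * suc (suc a + suc a)) (central-suc a) ⟩
  (2 * suc (a + a) * central a) * (2 * suc (a + a) * central a) * suc (suc a + suc a)
    ≡⟨ regroup a (central a) ⟩
  4 * (suc (a + a) * suc (suc a + suc a)) * (central a * central a * suc (a + a))
    ≤⟨ *-mono-≤ (≤-trans (n≤1+n _) (≤-trans (m≤m+n _ 3) (≤-reflexive (almost-square a)))) (central-upper a) ⟩
  16 * (suc a * suc a) * 16 ^ a
    ≡⟨ shuffle (suc a * suc a) (16 ^ a) ⟩
  suc a * suc a * (16 * 16 ^ a) ∎)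
  where
  open ≤-Reasoning
  square : ∀ s x t → s * s * (x * x * t) ≡ (s * x) * (s * x) * t
  square = solve-∀
  regroup : ∀ a x → (2 * suc (a + a) * x) * (2 * suc (a + a) * x) * suc (suc a + suc a) ≡
                    4 * (suc (a + a) * suc (suc a + suc a)) * (x * x * suc (a + a))
  regroup = solve-∀
  almost-square : ∀ a → suc (4 * (suc (a + a) * suc (suc a + suc a))) + 3 ≡ 16 * (suc a * suc a)
  almost-square = solve-∀
  shuffle : ∀ x y → 16 * x * y ≡ x * (16 * y)
  shuffle = solve-∀

central-concentration : ∀ h a → 4 ^ h ≤ suc (a + a) → central a * 2 ^ h ≤ 2 ^ (a + a)
central-concentration h a 4^h≤ = ≮⇒≥ λ lt → <⇒≱ (*-mono-< lt lt) (begin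
  central a * 2 ^ h * (central a * 2 ^ h)       ≡⟨ rearrange (central a) (2 ^ h) ⟩
  central a * central a * (2 ^ h * 2 ^ h)       ≡⟨ cong (central a * central a *_) (sym (^-distribʳ-* h 2 2)) ⟩
  central a * central a * 4 ^ h                 ≤⟨ *-monoʳ-≤ (central a * central a) 4^h≤ ⟩
  central a * central a * suc (a + a)           ≤⟨ central-upper a ⟩
  16 ^ a                                        ≡⟨ ^-distribʳ-* a 4 4 ⟩
  4 ^ a * 4 ^ a                                 ≡⟨ cong (λ x → x * x) (trans (^-distribʳ-* a 2 2) (sym (^-distribˡ-+-* 2 a a))) ⟩
  2 ^ (a + a) * 2 ^ (a + a)                     ∎)
  where
  open ≤-Reasoning
  rearrange : ∀ x y → x * y * (x * y) ≡ x * x * (y * y)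
  rearrange = solve-∀

even-or-odd : ∀ m → (∃ λ a → m ≡ a + a) ⊎ (∃ λ a → m ≡ suc (a + a))
even-or-odd zero = inj₁ (0 , refl)
even-or-odd (suc m) with even-or-odd m
... | inj₁ (a , refl) = inj₂ (a , refl)
... | inj₂ (a , refl) = inj₁ (suc a , cong suc (sym (+-suc a a)))

-- An odd row is compared by Pascal's rule with the even row after it; this costs the extra factor 2
-- on the right.
C-concentration : ∀ h m v → 4 ^ h ≤ m → (m C v) * 2 ^ h ≤ 2 ^ suc m
C-concentration h m v 4^h≤m with even-or-odd m
... | inj₁ (a , refl) = ≤-trans (*-monoˡ-≤ (2 ^ h) (C≤central a v))
  (≤-trans (central-concentration h a (m≤n⇒m≤1+n 4^h≤m)) (^-monoʳ-≤ 2 (n≤1+n (a + a))))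
... | inj₂ (a , refl) = begin
  (suc (a + a) C v) * 2 ^ h              ≤⟨ *-monoˡ-≤ (2 ^ h) (≤-trans (m≤m+n (suc (a + a) C v) _) (≤-reflexive (nCk+nC[k+1]≡[n+1]C[k+1] (suc (a + a)) v))) ⟩
  (suc (suc (a + a)) C suc v) * 2 ^ h    ≡⟨ cong (λ m → (m C suc v) * 2 ^ h) (cong suc (sym (+-suc a a))) ⟩
  ((suc a + suc a) C suc v) * 2 ^ h      ≤⟨ *-monoˡ-≤ (2 ^ h) (C≤central (suc a) (suc v)) ⟩
  central (suc a) * 2 ^ h                ≤⟨ central-concentration h (suc a) (≤-trans 4^h≤m (m≤n⇒m≤1+n (+-mono-≤ (≤-refl {suc a}) (n≤1+n a)))) ⟩
  2 ^ (suc a + suc a)                    ≡⟨ cong (2 ^_) (cong suc (+-suc a a)) ⟩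
  2 ^ suc (suc (a + a))                  ∎
  where open ≤-Reasoning

-- Counting colourings: independence and the probability of balance.

count : ∀ {N} → (Subset N → Bool) → ℕ
count {zero}  P = if P [] then 1 else 0
count {suc N} P = count (P ∘ (false ∷_)) + count (P ∘ (true ∷_))

count-mono : ∀ {N} {P Q : Subset N → Bool} → (∀ χ → P χ ≡ true → Q χ ≡ true) → count P ≤ count Q
count-mono {zero} {P} {Q} P⇒Q with P [] | P⇒Q []
... | false | _   = z≤n
... | true  | imp rewrite imp refl = ≤-refl
count-mono {suc N} P⇒Q = +-mono-≤ (count-mono (P⇒Q ∘ (false ∷_))) (count-mono (P⇒Q ∘ (true ∷_)))

count-cong : ∀ {N} {P Q : Subset N → Bool} → (∀ χ → P χ ≡ Q χ) → count P ≡ count Q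
count-cong {zero}  P≗Q = cong (if_then 1 else 0) (P≗Q [])
count-cong {suc N} P≗Q = cong₂ _+_ (count-cong (P≗Q ∘ (false ∷_))) (count-cong (P≗Q ∘ (true ∷_)))

count-none : ∀ {N} {P : Subset N → Bool} → (∀ χ → P χ ≡ false) → count P ≡ 0
count-none {zero}  P≗false rewrite P≗false [] = refl
count-none {suc N} P≗false =
  cong₂ _+_ (count-none (P≗false ∘ (false ∷_))) (count-none (P≗false ∘ (true ∷_)))

count-∨ : ∀ {N} (P Q : Subset N → Bool) → count (λ χ → P χ ∨ Q χ) ≤ count P + count Q
count-∨ {zero} P Q with P [] | Q []
... | true  | _     = s≤s z≤n
... | false | true  = ≤-refl
... | false | false = ≤-refl
count-∨ {suc N} P Q = ≤-trans
  (+-mono-≤ (count-∨ (P ∘ (false ∷_)) (Q ∘ (false ∷_))) (count-∨ (P ∘ (true ∷_)) (Q ∘ (true ∷_))))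
  (≤-reflexive (+-interchange (count (P ∘ (false ∷_))) _ _ _))
  where
  +-interchange : ∀ a b c d → a + b + (c + d) ≡ a + c + (b + d)
  +-interchange = solve-∀

count≤2^N : ∀ {N} (P : Subset N → Bool) → count P ≤ 2 ^ N
count≤2^N {zero} P with P []
... | true  = ≤-refl
... | false = z≤n
count≤2^N {suc N} P = +-mono-≤ (count≤2^N (P ∘ (false ∷_))) (≤-trans (count≤2^N (P ∘ (true ∷_))) (m≤m+n (2 ^ N) 0))

-- The pigeonhole step that will produce a colouring with n variables of each colour that is not
-- bad.
count<⇒∃ : ∀ {N} {P Q : Subset N → Bool} → count P < count Q → ∃ λ χ → Q χ ≡ true × P χ ≡ false
count<⇒∃ {zero} {P} {Q} lt with P [] in p | Q [] in q
count<⇒∃ {zero} lt | false | true = [] , q , p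
count<⇒∃ {zero} (s≤s ()) | true | true
count<⇒∃ {suc N} {P} {Q} lt
  with count (P ∘ (false ∷_)) <? count (Q ∘ (false ∷_)) | count (P ∘ (true ∷_)) <? count (Q ∘ (true ∷_))
... | yes lt₀ | _       = let χ , q , p = count<⇒∃ lt₀ in false ∷ χ , q , p
... | no  _   | yes lt₁ = let χ , q , p = count<⇒∃ lt₁ in true ∷ χ , q , p
... | no  ge₀ | no  ge₁ = contradiction lt (≤⇒≯ (+-mono-≤ (≮⇒≥ ge₀) (≮⇒≥ ge₁)))

Agree : ∀ {N} → Subset N → Subset N → Subset N → Set
Agree U χ χ′ = ∀ {i} → i ∈ˢ U → lookup χ i ≡ lookup χ′ i

DependsOn : ∀ {N} → Subset N → (Subset N → Bool) → Set
DependsOn U P = ∀ χ χ′ → Agree U χ χ′ → P χ ≡ P χ′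

DependsOn-tail : ∀ {N u} {U : Subset N} {P} → DependsOn (u ∷ U) P → ∀ b → DependsOn U (P ∘ (b ∷_))
DependsOn-tail dep b χ χ′ agree = dep (b ∷ χ) (b ∷ χ′) λ { here → refl ; (there i∈) → agree i∈ }

DependsOn-head : ∀ {N} {U : Subset N} {P} → DependsOn (false ∷ U) P → ∀ χ → P (false ∷ χ) ≡ P (true ∷ χ)
DependsOn-head dep χ = dep (false ∷ χ) (true ∷ χ) λ { (there i∈) → refl }

-- A count is 2^N times a probability, so this is the product rule for independent events. Each
-- coordinate lies in at most one of `U` and `V`, and the other predicate is blind to it.
count-independent : ∀ {N} {U V : Subset N} {P Q} → DependsOn U P → DependsOn V Q → Empty (U ∩ V) →
                    count (λ χ → P χ ∧ Q χ) * 2 ^ N ≡ count P * count Q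
count-independent {zero} {[]} {[]} {P} {Q} _ _ _ with P [] | Q []
... | true  | true  = refl
... | true  | false = refl
... | false | _     = refl
count-independent {suc N} {u ∷ U} {v ∷ V} {P} {Q} depP depQ disjoint = begin
  (count (λ χ → P₀ χ ∧ Q₀ χ) + count (λ χ → P₁ χ ∧ Q₁ χ)) * (2 * 2 ^ N)
    ≡⟨ expand (count (λ χ → P₀ χ ∧ Q₀ χ)) (count (λ χ → P₁ χ ∧ Q₁ χ)) (2 ^ N) ⟩
  2 * (count (λ χ → P₀ χ ∧ Q₀ χ) * 2 ^ N + count (λ χ → P₁ χ ∧ Q₁ χ) * 2 ^ N)
    ≡⟨ cong₂ (λ x y → 2 * (x + y)) (ih false) (ih true) ⟩
  2 * (count P₀ * count Q₀ + count P₁ * count Q₁)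
    ≡⟨ heads u v depP depQ disjoint ⟩
  (count P₀ + count P₁) * (count Q₀ + count Q₁) ∎
  where
  open ≡-Reasoning
  P₀ = P ∘ (false ∷_)
  P₁ = P ∘ (true ∷_)
  Q₀ = Q ∘ (false ∷_)
  Q₁ = Q ∘ (true ∷_)
  expand : ∀ a b x → (a + b) * (2 * x) ≡ 2 * (a * x + b * x)
  expand = solve-∀
  ih : ∀ b → count (λ χ → P (b ∷ χ) ∧ Q (b ∷ χ)) * 2 ^ N ≡ count (P ∘ (b ∷_)) * count (Q ∘ (b ∷_))
  ih b = count-independent {U = U} {V} (DependsOn-tail depP b) (DependsOn-tail depQ b)
    λ { (i , i∈) → disjoint (suc i , there i∈) }
  constantˡ : ∀ p q r → 2 * (p * q + p * r) ≡ (p + p) * (q + r)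
  constantˡ = solve-∀
  constantʳ : ∀ p q r → 2 * (q * p + r * p) ≡ (q + r) * (p + p)
  constantʳ = solve-∀
  heads : ∀ u v → DependsOn (u ∷ U) P → DependsOn (v ∷ V) Q → Empty ((u ∷ U) ∩ (v ∷ V)) →
          2 * (count P₀ * count Q₀ + count P₁ * count Q₁) ≡ (count P₀ + count P₁) * (count Q₀ + count Q₁)
  heads false v     depP depQ disjoint rewrite sym (count-cong (DependsOn-head depP)) =
    constantˡ (count P₀) (count Q₀) (count Q₁)
  heads true  false depP depQ disjoint rewrite sym (count-cong (DependsOn-head depQ)) =
    constantʳ (count Q₀) (count P₀) (count P₁)
  heads true  true  depP depQ disjoint = contradiction (zero , here) disjoint

count-∣χ∣ : ∀ N v → count {N} (λ χ → ∣ χ ∣ ≡ᵇ v) ≡ N C v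
count-∣χ∣ zero    zero    = refl
count-∣χ∣ zero    (suc v) = refl
count-∣χ∣ (suc N) zero    = cong₂ _+_ (count-∣χ∣ N zero) (count-none {N} λ _ → refl)
count-∣χ∣ (suc N) (suc v) = trans (cong₂ _+_ (count-∣χ∣ N (suc v)) (count-∣χ∣ N v))
  (trans (+-comm (N C suc v) (N C v)) (nCk+nC[k+1]≡[n+1]C[k+1] N v))

-- The colours outside `X` are free and those inside follow a binomial law; multiplying by 2^∣X∣
-- avoids the exponent N - ∣X∣.
count-side : ∀ {N} (X : Subset N) v →
             count (λ χ → ∣ side true χ X ∣ ≡ᵇ v) * 2 ^ ∣ X ∣ ≡ (∣ X ∣ C v) * 2 ^ N
count-side []          zero    = refl
count-side []          (suc v) = refl
count-side {suc N} (false ∷ X) v = begin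
  (c + c) * 2 ^ ∣ X ∣         ≡⟨ double c (2 ^ ∣ X ∣) ⟩
  2 * (c * 2 ^ ∣ X ∣)         ≡⟨ cong (2 *_) (count-side X v) ⟩
  2 * ((∣ X ∣ C v) * 2 ^ N)   ≡⟨ swap (∣ X ∣ C v) (2 ^ N) ⟩
  (∣ X ∣ C v) * (2 * 2 ^ N)   ∎
  where
  open ≡-Reasoning
  c = count (λ χ → ∣ side true χ X ∣ ≡ᵇ v)
  double : ∀ c x → (c + c) * x ≡ 2 * (c * x)
  double = solve-∀
  swap : ∀ c x → 2 * (c * x) ≡ c * (2 * x)
  swap = solve-∀
count-side {suc N} (true ∷ X) zero = begin
  (c + count {N} (λ _ → false)) * (2 * 2 ^ ∣ X ∣) ≡⟨ cong (λ z → (c + z) * (2 * 2 ^ ∣ X ∣)) (count-none {N} λ _ → refl) ⟩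
  (c + 0) * (2 * 2 ^ ∣ X ∣)   ≡⟨ double c (2 ^ ∣ X ∣) ⟩
  2 * (c * 2 ^ ∣ X ∣)         ≡⟨ cong (2 *_) (count-side X 0) ⟩
  2 * (1 * 2 ^ N)             ≡⟨ cong (2 *_) (*-identityˡ (2 ^ N)) ⟩
  2 * 2 ^ N                   ≡⟨ *-identityˡ (2 * 2 ^ N) ⟨
  1 * (2 * 2 ^ N)             ∎
  where
  open ≡-Reasoning
  c = count (λ χ → ∣ side true χ X ∣ ≡ᵇ 0)
  double : ∀ c x → (c + 0) * (2 * x) ≡ 2 * (c * x)
  double = solve-∀
count-side {suc N} (true ∷ X) (suc v) = begin
  (c₁ + c₀) * (2 * 2 ^ ∣ X ∣)                              ≡⟨ expand c₁ c₀ (2 ^ ∣ X ∣) ⟩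
  2 * (c₀ * 2 ^ ∣ X ∣ + c₁ * 2 ^ ∣ X ∣)                    ≡⟨ cong₂ (λ x y → 2 * (x + y)) (count-side X v) (count-side X (suc v)) ⟩
  2 * ((∣ X ∣ C v) * 2 ^ N + (∣ X ∣ C suc v) * 2 ^ N)      ≡⟨ collect (∣ X ∣ C v) (∣ X ∣ C suc v) (2 ^ N) ⟩
  ((∣ X ∣ C v) + (∣ X ∣ C suc v)) * (2 * 2 ^ N)            ≡⟨ cong (_* (2 * 2 ^ N)) (nCk+nC[k+1]≡[n+1]C[k+1] ∣ X ∣ v) ⟩
  (suc ∣ X ∣ C suc v) * (2 * 2 ^ N)                        ∎
  where
  open ≡-Reasoning
  c₀ = count (λ χ → ∣ side true χ X ∣ ≡ᵇ v)
  c₁ = count (λ χ → ∣ side true χ X ∣ ≡ᵇ suc v)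
  expand : ∀ a b x → (a + b) * (2 * x) ≡ 2 * (b * x + a * x)
  expand = solve-∀
  collect : ∀ a b x → 2 * (a * x + b * x) ≡ (a + b) * (2 * x)
  collect = solve-∀

within : ℕ → ℕ → ℕ → Bool
within zero    lo y = false
within (suc w) lo y = (y ≡ᵇ w + lo) ∨ within w lo y

within-intro : ∀ {w lo y} → lo ≤ y → y < w + lo → within w lo y ≡ true
within-intro {zero}           lo≤y y<  = contradiction y< (≤⇒≯ lo≤y)
within-intro {suc w} {lo} {y} lo≤y y<w with y ≡ᵇ w + lo in eq
... | true  = refl
... | false = within-intro lo≤y (≤∧≢⇒< (s≤s⁻¹ y<w) λ y≡ → subst Bool.T eq (≡⇒≡ᵇ y _ y≡))

-- Union bound over the w values of the window, each taken with probability at most 2 / 2^h.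
count-within : ∀ {N} h (X : Subset N) → 4 ^ h ≤ ∣ X ∣ → ∀ w lo →
               count (λ χ → within w lo ∣ side true χ X ∣) * 2 ^ h ≤ w * (2 * 2 ^ N)
count-within {N} h X 4^h≤ zero    lo rewrite count-none {N} {λ χ → within zero lo ∣ side true χ X ∣} (λ _ → refl) = z≤n
count-within {N} h X 4^h≤ (suc w) lo = begin
  count (λ χ → (∣ side true χ X ∣ ≡ᵇ w + lo) ∨ within w lo ∣ side true χ X ∣) * 2 ^ h
    ≤⟨ *-monoˡ-≤ (2 ^ h) (count-∨ (λ χ → ∣ side true χ X ∣ ≡ᵇ w + lo) (λ χ → within w lo ∣ side true χ X ∣)) ⟩
  (c + count (λ χ → within w lo ∣ side true χ X ∣)) * 2 ^ h
    ≡⟨ *-distribʳ-+ (2 ^ h) c _ ⟩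
  c * 2 ^ h + count (λ χ → within w lo ∣ side true χ X ∣) * 2 ^ h
    ≤⟨ +-mono-≤ point (count-within h X 4^h≤ w lo) ⟩
  2 * 2 ^ N + w * (2 * 2 ^ N) ∎
  where
  open ≤-Reasoning
  c = count (λ χ → ∣ side true χ X ∣ ≡ᵇ w + lo)
  swap : ∀ a b c → a * b * c ≡ a * c * b
  swap = solve-∀
  point : c * 2 ^ h ≤ 2 * 2 ^ N
  point = *-cancelʳ-≤ _ _ (2 ^ ∣ X ∣) {{m^n≢0 2 ∣ X ∣}} (begin
    c * 2 ^ h * 2 ^ ∣ X ∣                  ≡⟨ swap c (2 ^ h) (2 ^ ∣ X ∣) ⟩
    c * 2 ^ ∣ X ∣ * 2 ^ h                  ≡⟨ cong (_* 2 ^ h) (count-side X (w + lo)) ⟩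
    (∣ X ∣ C (w + lo)) * 2 ^ N * 2 ^ h     ≡⟨ swap (∣ X ∣ C (w + lo)) (2 ^ N) (2 ^ h) ⟩
    (∣ X ∣ C (w + lo)) * 2 ^ h * 2 ^ N     ≤⟨ *-monoˡ-≤ (2 ^ N) (C-concentration h ∣ X ∣ (w + lo) 4^h≤) ⟩
    2 * 2 ^ ∣ X ∣ * 2 ^ N                  ≡⟨ swap 2 (2 ^ ∣ X ∣) (2 ^ N) ⟩
    2 * 2 ^ N * 2 ^ ∣ X ∣                  ∎)

balanced⁻ : ∀ {N} k (χ X : Subset N) → balanced k χ X ≡ true →
            ∣ side true χ X ∣ < ∣ side false χ X ∣ + k × ∣ side false χ X ∣ < ∣ side true χ X ∣ + k
balanced⁻ k χ X eq = <ᵇ⇒< _ _ (≡true⇒T (∧-conicalˡ _ _ eq)) , <ᵇ⇒< _ _ (≡true⇒T (∧-conicalʳ (y <ᵇ z + k) _ eq))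
  where
  y = ∣ side true χ X ∣
  z = ∣ side false χ X ∣
  ≡true⇒T : ∀ {b} → b ≡ true → Bool.T b
  ≡true⇒T refl = _

balanced⁺ : ∀ {N} k (χ X : Subset N) → ∣ side true χ X ∣ < ∣ side false χ X ∣ + k →
            ∣ side false χ X ∣ < ∣ side true χ X ∣ + k → balanced k χ X ≡ true
balanced⁺ k χ X y<z+k z<y+k = cong₂ _∧_ (T⇒≡true (<⇒<ᵇ y<z+k)) (T⇒≡true (<⇒<ᵇ z<y+k))
  where
  T⇒≡true : ∀ {b} → Bool.T b → b ≡ true
  T⇒≡true {true} _ = refl

-- The sides add up to ∣X∣ and differ by less than K, which confines the Y-side to K + 1 consecutive
-- values around ∣X∣/2. If K exceeds ∣X∣ the window simply starts at 0.
count-balanced : ∀ {N} h K (X : Subset N) → 4 ^ h ≤ ∣ X ∣ →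
                 count (λ χ → balanced K χ X) * 2 ^ h ≤ suc K * (2 * 2 ^ N)
count-balanced {N} h K X 4^h≤ = ≤-trans
  (*-monoˡ-≤ (2 ^ h) (count-mono {P = λ χ → balanced K χ X} λ χ bal → in-window χ (balanced⁻ K χ X bal)))
  (count-within h X 4^h≤ (suc K) lo)
  where
  lo = ⌊ ∣ X ∣ ∸ K /2⌋
  in-window : ∀ χ → ∣ side true χ X ∣ < ∣ side false χ X ∣ + K × ∣ side false χ X ∣ < ∣ side true χ X ∣ + K →
              within (suc K) lo ∣ side true χ X ∣ ≡ true
  in-window χ (y<z+K , z<y+K) = within-intro lo≤y y<
    where
    open ≤-Reasoning
    y = ∣ side true χ X ∣
    z = ∣ side false χ X ∣
    lo≤y : lo ≤ y
    lo≤y = ≮⇒≥ λ y<lo → <⇒≱ (+-mono-< y<lo y<lo) (begin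
      lo + lo                ≤⟨ 2⌊n/2⌋≤n (∣ X ∣ ∸ K) ⟩
      ∣ X ∣ ∸ K              ≡⟨ cong (_∸ K) (∣side∣+∣side∣ χ X) ⟨
      y + z ∸ K              ≤⟨ ∸-monoˡ-≤ K (+-monoʳ-≤ y (<⇒≤ z<y+K)) ⟩
      y + (y + K) ∸ K        ≡⟨ cong (_∸ K) (+-assoc y y K) ⟨
      y + y + K ∸ K          ≡⟨ m+n∸n≡m (y + y) K ⟩
      y + y                  ∎)
    y< : y < suc K + lo
    y< = ≰⇒> λ ge → <⇒≱ (+-mono-≤ ge ge) (begin
      y + y                                ≤⟨ +-monoʳ-≤ y (<⇒≤ y<z+K) ⟩
      y + (z + K)                          ≡⟨ +-assoc y z K ⟨
      y + z + K                            ≡⟨ cong (_+ K) (∣side∣+∣side∣ χ X) ⟩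
      ∣ X ∣ + K                            ≤⟨ +-monoˡ-≤ K (m≤n+m∸n ∣ X ∣ K) ⟩
      K + (∣ X ∣ ∸ K) + K                  ≤⟨ +-monoˡ-≤ K (+-monoʳ-≤ K (n≤1+2⌊n/2⌋ (∣ X ∣ ∸ K))) ⟩
      K + suc (lo + lo) + K                ≡⟨ rearrange K lo ⟩
      K + lo + suc (K + lo)                ∎)
      where
      rearrange : ∀ K l → K + suc (l + l) + K ≡ K + l + suc (K + l)
      rearrange = solve-∀

side-agree : ∀ {N} b {X χ χ′ : Subset N} → Agree X χ χ′ → side b χ X ≡ side b χ′ X
side-agree b {[]}        {[]}    {[]}      agree = refl
side-agree b {false ∷ X} {c ∷ χ} {c′ ∷ χ′} agree =
  cong₂ _∷_ (trans (∧-zeroʳ (does (c Bool.≟ b))) (sym (∧-zeroʳ (does (c′ Bool.≟ b))))) (side-agree b (agree ∘ there))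
side-agree b {true ∷ X}  {c ∷ χ} {c′ ∷ χ′} agree =
  cong₂ _∷_ (cong (λ c → does (c Bool.≟ b) ∧ true) (agree here)) (side-agree b (agree ∘ there))

balanced-depends : ∀ {N} k (X : Subset N) → DependsOn X (λ χ → balanced k χ X)
balanced-depends k X χ χ′ agree = cong₂ (λ y z → (y <ᵇ z + k) ∧ (z <ᵇ y + k))
  (cong ∣_∣ (side-agree true {X} {χ} {χ′} agree)) (cong ∣_∣ (side-agree false {X} {χ} {χ′} agree))

∣side∣-difference : ∀ {N} b (χ U X : Subset N) → X ⊆ U →
                    ∣ side b χ U ∣ ≡ ∣ side b χ (U ∩ ∁ X) ∣ + ∣ side b χ X ∣
∣side∣-difference b []      []          []          X⊆U = refl
∣side∣-difference b (c ∷ χ) (false ∷ U) (true ∷ X)  X⊆U with () ← X⊆U here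
∣side∣-difference b (c ∷ χ) (false ∷ U) (false ∷ X) X⊆U with does (c Bool.≟ b)
... | true  = ∣side∣-difference b χ U X (drop-∷-⊆ X⊆U)
... | false = ∣side∣-difference b χ U X (drop-∷-⊆ X⊆U)
∣side∣-difference b (c ∷ χ) (true ∷ U)  (true ∷ X)  X⊆U with does (c Bool.≟ b)
... | true  = trans (cong suc (∣side∣-difference b χ U X (drop-∷-⊆ X⊆U))) (sym (+-suc _ _))
... | false = ∣side∣-difference b χ U X (drop-∷-⊆ X⊆U)
∣side∣-difference b (c ∷ χ) (true ∷ U)  (false ∷ X) X⊆U with does (c Bool.≟ b)
... | true  = cong suc (∣side∣-difference b χ U X (drop-∷-⊆ X⊆U))
... | false = ∣side∣-difference b χ U X (drop-∷-⊆ X⊆U)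

∣difference∣ : ∀ {N} (U X : Subset N) → X ⊆ U → ∣ U ∣ ≡ ∣ U ∩ ∁ X ∣ + ∣ X ∣
∣difference∣ []          []          X⊆U = refl
∣difference∣ (false ∷ U) (true ∷ X)  X⊆U with () ← X⊆U here
∣difference∣ (false ∷ U) (false ∷ X) X⊆U = ∣difference∣ U X (drop-∷-⊆ X⊆U)
∣difference∣ (true ∷ U)  (true ∷ X)  X⊆U = trans (cong suc (∣difference∣ U X (drop-∷-⊆ X⊆U))) (sym (+-suc _ _))
∣difference∣ (true ∷ U)  (false ∷ X) X⊆U = cong suc (∣difference∣ U X (drop-∷-⊆ X⊆U))

difference-disjoint : ∀ {N} (U X : Subset N) → Empty ((U ∩ ∁ X) ∩ X)
difference-disjoint (true ∷ U)  (true ∷ X)  (zero , ())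
difference-disjoint (true ∷ U)  (false ∷ X) (zero , ())
difference-disjoint (false ∷ U) (true ∷ X)  (zero , ())
difference-disjoint (false ∷ U) (false ∷ X) (zero , ())
difference-disjoint (u ∷ U)     (x ∷ X)     (suc i , there i∈) = difference-disjoint U X (i , i∈)

-- The signed imbalance of the difference is that of `U` minus that of `X`, each below k in absolute
-- value.
balanced-difference : ∀ {N} k (χ U X : Subset N) → X ⊆ U → balanced k χ U ≡ true → balanced k χ X ≡ true →
                      balanced (k + k) χ (U ∩ ∁ X) ≡ true
balanced-difference k χ U X X⊆U balU balX with balanced⁻ k χ U balU | balanced⁻ k χ X balX
... | yU< , zU< | yX< , zX< = balanced⁺ (k + k) χ (U ∩ ∁ X)
  (cancel (∣ side true χ (U ∩ ∁ X) ∣) (∣ side false χ (U ∩ ∁ X) ∣) (∣ side true χ X ∣) (∣ side false χ X ∣)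
    (subst₂ (λ y z → y < z + k) (∣side∣-difference true χ U X X⊆U) (∣side∣-difference false χ U X X⊆U) yU<) zX<)
  (cancel (∣ side false χ (U ∩ ∁ X) ∣) (∣ side true χ (U ∩ ∁ X) ∣) (∣ side false χ X ∣) (∣ side true χ X ∣)
    (subst₂ (λ y z → y < z + k) (∣side∣-difference false χ U X X⊆U) (∣side∣-difference true χ U X X⊆U) zU<) yX<)
  where
  cancel : ∀ a b c d → a + c < b + d + k → d < c + k → a < b + (k + k)
  cancel a b c d a+c< d< = +-cancelʳ-< c a (b + (k + k)) (begin-strict
    a + c               <⟨ a+c< ⟩
    b + d + k           ≤⟨ +-monoˡ-≤ k (+-monoʳ-≤ b (<⇒≤ d<)) ⟩
    b + (c + k) + k     ≡⟨ rearrange b c k ⟩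
    b + (k + k) + c     ∎)
    where
    open ≤-Reasoning
    rearrange : ∀ b c k → b + (c + k) + k ≡ b + (k + k) + c
    rearrange = solve-∀

-- The probability that a formula has a bad path.

module PathCount {c ℓ₁ ℓ₂} (F : HeytingField c ℓ₁ ℓ₂) {N : ℕ} (k T : ℕ) where

  open Paths F {N} k T

  Bad-depends   : ∀ φ → DependsOn (vars F φ) (Bad φ)
  below-depends : ∀ φ → DependsOn (vars F φ) (below φ)
  child-depends : ∀ m φ → DependsOn (vars F φ) (child m φ)

  Bad-depends φ χ χ′ agree = cong₂ (λ b b′ → b ∧ ((∣ vars F φ ∣ <ᵇ T) ∨ b′))
    (balanced-depends k (vars F φ) χ χ′ agree) (below-depends φ χ χ′ agree)

  below-depends (var i)       χ χ′ agree = refl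
  below-depends (const a)     χ χ′ agree = refl
  below-depends (gate₁ o φ)   χ χ′ agree = child-depends (∣ vars F φ ∣) φ χ χ′ agree
  below-depends (gate₂ o φ ψ) χ χ′ agree = cong₂ _∨_
    (child-depends (∣ vars F φ ∪ vars F ψ ∣) φ χ χ′ (agree ∘ p⊆p∪q (vars F ψ)))
    (child-depends (∣ vars F φ ∪ vars F ψ ∣) ψ χ χ′ (agree ∘ q⊆p∪q (vars F φ) (vars F ψ)))

  child-depends m φ χ χ′ agree =
    cong ((m ≤ᵇ ∣ vars F φ ∣ + ∣ vars F φ ∣) ∧_) (Bad-depends φ χ χ′ agree)

  module _ (h P : ℕ) (4^h≤T : 4 ^ h ≤ T) (1≤T : 1 ≤ T) (small : suc (k + k) * (2 * P) ≤ 2 ^ h) where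

    count-2k-balanced : ∀ (X : Subset N) → T ≤ ∣ X ∣ → count (λ χ → balanced (k + k) χ X) * P ≤ 2 ^ N
    count-2k-balanced X T≤ = *-cancelˡ-≤ (suc (k + k) * 2) (begin
      suc (k + k) * 2 * (b * P)     ≡⟨ rearrange (suc (k + k)) b P ⟩
      b * (suc (k + k) * (2 * P))   ≤⟨ *-monoʳ-≤ b small ⟩
      b * 2 ^ h                     ≤⟨ count-balanced h (k + k) X (≤-trans 4^h≤T T≤) ⟩
      suc (k + k) * (2 * 2 ^ N)     ≡⟨ *-assoc (suc (k + k)) 2 (2 ^ N) ⟨
      suc (k + k) * 2 * 2 ^ N       ∎)
      where
      open ≤-Reasoning
      b = count (λ χ → balanced (k + k) χ X)
      rearrange : ∀ s b p → s * 2 * (b * p) ≡ b * (s * (2 * p))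
      rearrange = solve-∀

    -- Here `U` is the set selected last. The current set is still more than half of it, and 4^j T ≤
    -- ∣U∣ leaves room for j further selections, each gaining a factor P.
    PathBound : Formula F N → ℕ → Set
    PathBound φ j = ∀ U → vars F φ ⊆ U → ∣ U ∣ < ∣ vars F φ ∣ + ∣ vars F φ ∣ → 4 ^ j * T ≤ ∣ U ∣ →
                    count (λ χ → balanced k χ U ∧ Bad φ χ) * P ^ j ≤ size F φ * 2 ^ N

    -- X = vars φ is the next set of the chain: if U and X are k-balanced then U ∖ X
    -- is 2k-balanced, independently of the colouring of X.
    select : ∀ φ j → PathBound φ j → ∀ U → vars F φ ⊆ U → ∣ vars F φ ∣ + ∣ vars F φ ∣ ≤ ∣ U ∣ →
             4 ^ j * T ≤ ∣ vars F φ ∣ →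
             count (λ χ → balanced k χ U ∧ Bad φ χ) * P ^ suc j ≤ size F φ * 2 ^ N
    select φ j ih U X⊆U 2X≤U 4^jT≤ = *-cancelʳ-≤ _ _ (2 ^ N) {{m^n≢0 2 N}} (begin
      count (λ χ → balanced k χ U ∧ Bad φ χ) * P ^ suc j * 2 ^ N
        ≤⟨ *-monoˡ-≤ (2 ^ N) (*-monoˡ-≤ (P ^ suc j) (count-mono {P = λ χ → balanced k χ U ∧ Bad φ χ} split)) ⟩
      count (λ χ → balanced (k + k) χ D ∧ (balanced k χ X ∧ Bad φ χ)) * P ^ suc j * 2 ^ N
        ≡⟨ swap (count λ χ → balanced (k + k) χ D ∧ (balanced k χ X ∧ Bad φ χ)) (P ^ suc j) (2 ^ N) ⟩
      count (λ χ → balanced (k + k) χ D ∧ (balanced k χ X ∧ Bad φ χ)) * 2 ^ N * P ^ suc j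
        ≡⟨ cong (_* P ^ suc j) (count-independent {U = D} {X} (balanced-depends (k + k) D)
             (λ χ χ′ agree → cong₂ _∧_ (balanced-depends k X χ χ′ agree) (Bad-depends φ χ χ′ agree))
             (difference-disjoint U X)) ⟩
      count (λ χ → balanced (k + k) χ D) * c′ * (P * P ^ j)
        ≡⟨ [m*n]*[o*p]≡[m*o]*[n*p] (count (λ χ → balanced (k + k) χ D)) c′ P (P ^ j) ⟩
      count (λ χ → balanced (k + k) χ D) * P * (c′ * P ^ j)
        ≤⟨ *-mono-≤ (count-2k-balanced D T≤D) (ih X (λ i∈ → i∈) X<2X 4^jT≤) ⟩
      2 ^ N * (size F φ * 2 ^ N)
        ≡⟨ *-comm (2 ^ N) _ ⟩
      size F φ * 2 ^ N * 2 ^ N ∎)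
      where
      open ≤-Reasoning
      X = vars F φ
      D = U ∩ ∁ X
      c′ = count (λ χ → balanced k χ X ∧ Bad φ χ)
      swap : ∀ a b c → a * b * c ≡ a * c * b
      swap = solve-∀
      split : ∀ χ → balanced k χ U ∧ Bad φ χ ≡ true →
              balanced (k + k) χ D ∧ (balanced k χ X ∧ Bad φ χ) ≡ true
      split χ eq = cong₂ _∧_ (balanced-difference k χ U X X⊆U balU balX) (cong₂ _∧_ balX bad)
        where
        balU = ∧-conicalˡ (balanced k χ U) _ eq
        bad = ∧-conicalʳ (balanced k χ U) _ eq
        balX = ∧-conicalˡ (balanced k χ X) _ bad
      T≤X : T ≤ ∣ X ∣
      T≤X = ≤-trans (m≤n*m T (4 ^ j) {{m^n≢0 4 j}}) 4^jT≤
      X<2X : ∣ X ∣ < ∣ X ∣ + ∣ X ∣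
      X<2X = m<m+n ∣ X ∣ (≤-trans 1≤T T≤X)
      T≤D : T ≤ ∣ D ∣
      T≤D = ≤-trans T≤X (+-cancelʳ-≤ ∣ X ∣ _ _ (≤-trans 2X≤U (≤-reflexive (∣difference∣ U X X⊆U))))

    -- As long as the child keeps more than half of `U`, nothing is selected. Otherwise the child
    -- is: its parent has more than half of `U` and it has at least half of the parent, so a quarter
    -- of `U` remains. This is the 4 in 4^j.
    child-bound : ∀ φ m → (∀ j → PathBound φ j) → ∀ j U → vars F φ ⊆ U → ∣ U ∣ < m + m → 4 ^ suc j * T ≤ ∣ U ∣ →
                  count (λ χ → balanced k χ U ∧ child m φ χ) * P ^ suc j ≤ size F φ * 2 ^ N
    child-bound φ m ih j U X⊆U U<2m 4^jT≤ with m ≤ᵇ ∣ vars F φ ∣ + ∣ vars F φ ∣ in eq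
    ... | false rewrite count-none {N} {λ χ → balanced k χ U ∧ false} (λ χ → ∧-zeroʳ (balanced k χ U)) = z≤n
    ... | true with ∣ U ∣ <? ∣ vars F φ ∣ + ∣ vars F φ ∣
    ...   | yes U<2X = ih (suc j) U X⊆U U<2X 4^jT≤
    ...   | no  U≮2X = select φ j (ih j) U X⊆U (≮⇒≥ U≮2X) (*-cancelˡ-≤ 4 (begin
      4 * (4 ^ j * T)     ≡⟨ *-assoc 4 (4 ^ j) T ⟨
      4 ^ suc j * T       ≤⟨ 4^jT≤ ⟩
      ∣ U ∣               ≤⟨ <⇒≤ U<2m ⟩
      m + m               ≤⟨ +-mono-≤ m≤2X m≤2X ⟩
      X + X + (X + X)     ≡⟨ four X ⟩
      4 * X               ∎))
      where
      open ≤-Reasoning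
      X = ∣ vars F φ ∣
      m≤2X : m ≤ X + X
      m≤2X = ≤ᵇ⇒≤ m _ (subst Bool.T (sym eq) _)
      four : ∀ x → x + x + (x + x) ≡ 4 * x
      four = solve-∀

    -- Room for one more selection forces ∣X∣ ≥ T, so a bad path cannot end here and must enter a
    -- child. The union bound over the children is matched by the additivity of `size`; leaves have
    -- no continuation and contribute nothing.
    path-bound : ∀ φ j → PathBound φ j
    path-bound φ zero U X⊆U U<2X T≤U = begin
      count (λ χ → balanced k χ U ∧ Bad φ χ) * 1   ≡⟨ *-identityʳ _ ⟩
      count (λ χ → balanced k χ U ∧ Bad φ χ)       ≤⟨ count≤2^N (λ χ → balanced k χ U ∧ Bad φ χ) ⟩
      2 ^ N                                        ≡⟨ *-identityˡ _ ⟨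
      1 * 2 ^ N                                    ≤⟨ *-monoˡ-≤ (2 ^ N) (1≤size φ) ⟩
      size F φ * 2 ^ N                             ∎
      where open ≤-Reasoning
    path-bound φ (suc j) U X⊆U U<2X 4^jT≤ = ≤-trans
      (*-monoˡ-≤ (P ^ suc j) (count-mono {P = λ χ → balanced k χ U ∧ Bad φ χ} λ χ eq →
        cong₂ _∧_ (∧-conicalˡ (balanced k χ U) _ eq) (Bad⇒below χ (∧-conicalʳ (balanced k χ U) _ eq))))
      (below-bound φ X⊆U U<2X)
      where
      T≤X : T ≤ ∣ vars F φ ∣
      T≤X = ≮⇒≥ λ X<T → <⇒≱ U<2X (begin
        ∣ vars F φ ∣ + ∣ vars F φ ∣  ≤⟨ +-mono-≤ (<⇒≤ X<T) (<⇒≤ X<T) ⟩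
        T + T                        ≤⟨ m≤m+n (T + T) (T + T) ⟩
        T + T + (T + T)              ≡⟨ four T ⟩
        4 * T                        ≤⟨ *-monoʳ-≤ 4 (m≤n*m T (4 ^ j) {{m^n≢0 4 j}}) ⟩
        4 * (4 ^ j * T)              ≡⟨ *-assoc 4 (4 ^ j) T ⟨
        4 ^ suc j * T                ≤⟨ 4^jT≤ ⟩
        ∣ U ∣                        ∎)
        where
        open ≤-Reasoning
        four : ∀ x → x + x + (x + x) ≡ 4 * x
        four = solve-∀

      Bad⇒below : ∀ χ → Bad φ χ ≡ true → below φ χ ≡ true
      Bad⇒below χ bad with ∣ vars F φ ∣ <ᵇ T in eq
      ... | true  = contradiction T≤X (<⇒≱ (<ᵇ⇒< _ _ (subst Bool.T (sym eq) _)))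
      ... | false = ∧-conicalʳ (balanced k χ (vars F φ)) _ bad

      below-bound : ∀ φ → vars F φ ⊆ U → ∣ U ∣ < ∣ vars F φ ∣ + ∣ vars F φ ∣ →
                    count (λ χ → balanced k χ U ∧ below φ χ) * P ^ suc j ≤ size F φ * 2 ^ N
      below-bound (var i) X⊆U U<2X
        rewrite count-none {N} {λ χ → balanced k χ U ∧ false} (λ χ → ∧-zeroʳ (balanced k χ U)) = z≤n
      below-bound (const a) X⊆U U<2X
        rewrite count-none {N} {λ χ → balanced k χ U ∧ false} (λ χ → ∧-zeroʳ (balanced k χ U)) = z≤n
      below-bound (gate₁ o φ) X⊆U U<2X = ≤-trans
        (child-bound φ (∣ vars F φ ∣) (path-bound φ) j U X⊆U U<2X 4^jT≤)
        (*-monoˡ-≤ (2 ^ N) (n≤1+n (size F φ)))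
      below-bound (gate₂ o φ ψ) X⊆U U<2X = begin
        count (λ χ → balanced k χ U ∧ (Cφ χ ∨ Cψ χ)) * P ^ suc j
          ≡⟨ cong (_* P ^ suc j) (count-cong λ χ → ∧-distribˡ-∨ (balanced k χ U) (Cφ χ) (Cψ χ)) ⟩
        count (λ χ → balanced k χ U ∧ Cφ χ ∨ balanced k χ U ∧ Cψ χ) * P ^ suc j
          ≤⟨ *-monoˡ-≤ (P ^ suc j) (count-∨ (λ χ → balanced k χ U ∧ Cφ χ) (λ χ → balanced k χ U ∧ Cψ χ)) ⟩
        (count (λ χ → balanced k χ U ∧ Cφ χ) + count (λ χ → balanced k χ U ∧ Cψ χ)) * P ^ suc j
          ≡⟨ *-distribʳ-+ (P ^ suc j) (count (λ χ → balanced k χ U ∧ Cφ χ)) _ ⟩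
        count (λ χ → balanced k χ U ∧ Cφ χ) * P ^ suc j + count (λ χ → balanced k χ U ∧ Cψ χ) * P ^ suc j
          ≤⟨ +-mono-≤ (child-bound φ m (path-bound φ) j U (X⊆U ∘ p⊆p∪q (vars F ψ)) U<2X 4^jT≤)
                      (child-bound ψ m (path-bound ψ) j U (X⊆U ∘ q⊆p∪q (vars F φ) (vars F ψ)) U<2X 4^jT≤) ⟩
        size F φ * 2 ^ N + size F ψ * 2 ^ N
          ≡⟨ *-distribʳ-+ (2 ^ N) (size F φ) (size F ψ) ⟨
        (size F φ + size F ψ) * 2 ^ N
          ≤⟨ *-monoˡ-≤ (2 ^ N) (n≤1+n (size F φ + size F ψ)) ⟩
        size F (gate₂ o φ ψ) * 2 ^ N ∎
        where
        open ≤-Reasoning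
        m = ∣ vars F φ ∪ vars F ψ ∣
        Cφ = child m φ
        Cψ = child m ψ

    Bad-bound : ∀ φ j → 4 ^ j * T ≤ ∣ vars F φ ∣ → count (Bad φ) * P ^ j ≤ size F φ * 2 ^ N
    Bad-bound φ j 4^jT≤ = ≤-trans
      (*-monoˡ-≤ (P ^ j) (count-mono {P = Bad φ} λ χ bad → cong₂ _∧_ (∧-conicalˡ (balanced k χ (vars F φ)) _ bad) bad))
      (path-bound φ j (vars F φ) (λ i∈ → i∈) (m<m+n _ (≤-trans 1≤T (≤-trans (m≤n*m T (4 ^ j) {{m^n≢0 4 j}}) 4^jT≤))) 4^jT≤)

-- From a colouring to a partition of the variables.

split : ∀ {m} (χ : Subset m) → Fin m → Fin ∣ χ ∣ ⊎ Fin ∣ ∁ χ ∣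
split (true ∷ χ)  zero    = inj₁ zero
split (true ∷ χ)  (suc i) = Sum.map₁ suc (split χ i)
split (false ∷ χ) zero    = inj₂ zero
split (false ∷ χ) (suc i) = Sum.map₂ suc (split χ i)

unsplit : ∀ {m} (χ : Subset m) → Fin ∣ χ ∣ ⊎ Fin ∣ ∁ χ ∣ → Fin m
unsplit (true ∷ χ)  (inj₁ zero)    = zero
unsplit (true ∷ χ)  (inj₁ (suc i)) = suc (unsplit χ (inj₁ i))
unsplit (true ∷ χ)  (inj₂ j)       = suc (unsplit χ (inj₂ j))
unsplit (false ∷ χ) (inj₁ i)       = suc (unsplit χ (inj₁ i))
unsplit (false ∷ χ) (inj₂ zero)    = zero
unsplit (false ∷ χ) (inj₂ (suc j)) = suc (unsplit χ (inj₂ j))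

unsplit-split : ∀ {m} (χ : Subset m) i → unsplit χ (split χ i) ≡ i
unsplit-split (true ∷ χ)  zero    = refl
unsplit-split (true ∷ χ)  (suc i) with split χ i | unsplit-split χ i
... | inj₁ _ | eq = cong suc eq
... | inj₂ _ | eq = cong suc eq
unsplit-split (false ∷ χ) zero    = refl
unsplit-split (false ∷ χ) (suc i) with split χ i | unsplit-split χ i
... | inj₁ _ | eq = cong suc eq
... | inj₂ _ | eq = cong suc eq

split-unsplit : ∀ {m} (χ : Subset m) x → split χ (unsplit χ x) ≡ x
split-unsplit (true ∷ χ)  (inj₁ zero)    = refl
split-unsplit (true ∷ χ)  (inj₁ (suc i)) = cong (Sum.map₁ suc) (split-unsplit χ (inj₁ i))
split-unsplit (true ∷ χ)  (inj₂ j)       = cong (Sum.map₁ suc) (split-unsplit χ (inj₂ j))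
split-unsplit (false ∷ χ) (inj₁ i)       = cong (Sum.map₂ suc) (split-unsplit χ (inj₁ i))
split-unsplit (false ∷ χ) (inj₂ zero)    = refl
split-unsplit (false ∷ χ) (inj₂ (suc j)) = cong (Sum.map₂ suc) (split-unsplit χ (inj₂ j))

lookup-unsplit₁ : ∀ {m} (χ : Subset m) i → lookup χ (unsplit χ (inj₁ i)) ≡ true
lookup-unsplit₁ (true ∷ χ)  zero    = refl
lookup-unsplit₁ (true ∷ χ)  (suc i) = lookup-unsplit₁ χ i
lookup-unsplit₁ (false ∷ χ) i       = lookup-unsplit₁ χ i

lookup-unsplit₂ : ∀ {m} (χ : Subset m) j → lookup χ (unsplit χ (inj₂ j)) ≡ false
lookup-unsplit₂ (true ∷ χ)  j       = lookup-unsplit₂ χ j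
lookup-unsplit₂ (false ∷ χ) zero    = refl
lookup-unsplit₂ (false ∷ χ) (suc j) = lookup-unsplit₂ χ j

bijection : ∀ {m y z} (χ : Subset m) → ∣ χ ∣ ≡ y → ∣ ∁ χ ∣ ≡ z → Σ (Fin m ↔ (Fin y ⊎ Fin z)) λ A →
            (∀ i → lookup χ (Inverse.from A (inj₁ i)) ≡ true) ×
            (∀ j → lookup χ (Inverse.from A (inj₂ j)) ≡ false)
bijection χ refl refl =
  mk↔ₛ′ (split χ) (unsplit χ) (split-unsplit χ) (unsplit-split χ) , lookup-unsplit₁ χ , lookup-unsplit₂ χ

-- The numerical parameters.

^-cancelˡ-< : ∀ o .{{_ : NonZero o}} {m n} → m ^ o < n ^ o → m < n
^-cancelˡ-< o m^o<n^o = ≰⇒> λ n≤m → <⇒≱ m^o<n^o (^-monoˡ-≤ o n≤m)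

^-cancelˡ-≤ : ∀ o .{{_ : NonZero o}} {m n} → m ^ o ≤ n ^ o → m ≤ n
^-cancelˡ-≤ o m^o≤n^o = ≮⇒≥ λ n<m → <⇒≱ (^-monoˡ-< o n<m) m^o≤n^o

n<2^n : ∀ n → n < 2 ^ n
n<2^n zero    = ≤-refl
n<2^n (suc n) = +-mono-≤ (m^n>0 2 n) (≤-trans (n<2^n n) (m≤m+n (2 ^ n) 0))

-- Base 256 = 2^8 makes 2^q an integer substitute for n^(1/8).
log₂₅₆ : ∀ n → 1 ≤ n → ∃ λ q → 2 ^ (8 * q) ≤ n × n < 2 ^ (8 * suc q)
log₂₅₆ n 1≤n = go n (<-≤-trans (n<2^n n) (^-monoʳ-≤ 2 (m≤n*m n 8)))
  where
  go : ∀ q → n < 2 ^ (8 * q) → ∃ λ q → 2 ^ (8 * q) ≤ n × n < 2 ^ (8 * suc q)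
  go zero    n<1 = contradiction 1≤n (<⇒≱ n<1)
  go (suc q) n<  with 2 ^ (8 * q) ≤? n
  ... | yes ≤n = q , ≤n , n<
  ... | no  ≰n = go q (≰⇒> ≰n)

-- With 4 + r = q + 1, the logarithm of the size takes at most half of the exponent 2^(2 + r) saved
-- in `rank-bound`.
square≤2^ : ∀ {r} → 17 ≤′ r → (4 + r) * (4 + r) ≤ 2 ^ suc r
-- The case r = 17: 441 = 21² and 262144 = 2^18.
square≤2^ ≤′-refl             = ≤ᵇ⇒≤ 441 262144 _
square≤2^ (≤′-step {r} 17≤′r) = begin
  (5 + r) * (5 + r)                            ≤⟨ m≤m+n _ (7 + r * r + 6 * r) ⟩
  (5 + r) * (5 + r) + (7 + r * r + 6 * r)      ≡⟨ double r ⟩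
  2 * ((4 + r) * (4 + r))                      ≤⟨ *-monoʳ-≤ 2 (square≤2^ 17≤′r) ⟩
  2 * 2 ^ suc r                                ∎
  where
  open ≤-Reasoning
  double : ∀ r → (5 + r) * (5 + r) + (7 + r * r + 6 * r) ≡ 2 * ((4 + r) * (4 + r))
  double = solve-∀

-- With q = 3 + r this compares the logarithm of size times 2n + 1 with that of P^j. From 17 ≤ r
-- follow 49 < 7r and 17r ≤ r², hence 16r + 49 < 6r + 17r ≤ 6r + r².
quadratic< : ∀ {r} → 17 ≤ r → (4 + r) * (4 + r) + suc (8 * (4 + r)) < r * ((3 + r) + (3 + r))
quadratic< {r} 17≤r = begin-strict
  (4 + r) * (4 + r) + suc (8 * (4 + r))    ≡⟨ expand r ⟩
  r * r + 16 * r + 49                      <⟨ +-monoʳ-< (r * r + 16 * r) (<-≤-trans (≤ᵇ⇒≤ 50 119 _) (*-monoʳ-≤ 7 17≤r)) ⟩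
  r * r + 16 * r + 7 * r                   ≡⟨ collect r ⟩
  r * r + 6 * r + 17 * r                   ≤⟨ +-monoʳ-≤ (r * r + 6 * r) (*-monoˡ-≤ r 17≤r) ⟩
  r * r + 6 * r + r * r                    ≡⟨ factor r ⟩
  r * ((3 + r) + (3 + r))                  ∎
  where
  open ≤-Reasoning
  expand : ∀ r → (4 + r) * (4 + r) + suc (8 * (4 + r)) ≡ r * r + 16 * r + 49
  expand = solve-∀
  collect : ∀ r → r * r + 16 * r + 7 * r ≡ r * r + 6 * r + 17 * r
  collect = solve-∀
  factor : ∀ r → r * r + 6 * r + r * r ≡ r * ((3 + r) + (3 + r))
  factor = solve-∀

quadratic-root : ∀ D .{{_ : NonZero D}} {S n a e} → a * a ≡ e * D → S ^ D ≤ n ^ a → n ≤ 2 ^ a → S ≤ 2 ^ e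
quadratic-root D {S} {n} {a} {e} a²≡eD S^D≤n^a n≤2^a = ^-cancelˡ-≤ D (begin
  S ^ D          ≤⟨ S^D≤n^a ⟩
  n ^ a          ≤⟨ ^-monoˡ-≤ a n≤2^a ⟩
  (2 ^ a) ^ a    ≡⟨ ^-*-assoc 2 a a ⟩
  2 ^ (a * a)    ≡⟨ cong (2 ^_) a²≡eD ⟩
  2 ^ (e * D)    ≡⟨ ^-*-assoc 2 e D ⟨
  (2 ^ e) ^ D    ∎)
  where open ≤-Reasoning

-- The 64 is 8 · 8: log n is below 8(q + 1) and enters n^(ε log n) twice, so that the size is at
-- most 2^((q + 1)²).
ε : ℚ
ε = ℤ.+ 1 /ℚ 64

-- k is about n^(1/8) and T about n^(1/2), so that j = 2q selections, each losing at most a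
-- factor 4 in size, fit between T and n; a selection is balanced with probability at most
-- 1/P, which is about n^(-1/8).
module Parameters (n q r : ℕ) (q≡3+r : q ≡ 3 + r) (17≤r : 17 ≤ r)
                  (≤n : 2 ^ (8 * q) ≤ n) (n< : n < 2 ^ (8 * suc q)) where

  k h T P j half : ℕ
  k = 2 ^ q
  h = q + q
  T = 4 ^ h
  P = 2 ^ r
  j = q + q
  half = 2 ^ (2 + r)

  k≡8P : k ≡ 2 * (2 * (2 * P))
  k≡8P = cong (2 ^_) q≡3+r

  k≡half+half : k ≡ half + half
  k≡half+half = trans k≡8P (cong (half +_) (+-identityʳ half))

  1≤T : 1 ≤ T
  1≤T = m^n>0 4 h

  4^jT≤n : 4 ^ j * T ≤ n
  4^jT≤n = begin
    4 ^ (q + q) * 4 ^ (q + q)            ≡⟨ cong₂ _*_ (^-*-assoc 2 2 (q + q)) (^-*-assoc 2 2 (q + q)) ⟩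
    2 ^ (2 * (q + q)) * 2 ^ (2 * (q + q)) ≡⟨ ^-distribˡ-+-* 2 (2 * (q + q)) (2 * (q + q)) ⟨
    2 ^ (2 * (q + q) + 2 * (q + q))      ≡⟨ cong (2 ^_) (eight q) ⟩
    2 ^ (8 * q)                          ≤⟨ ≤n ⟩
    n                                    ∎
    where
    open ≤-Reasoning
    eight : ∀ q → 2 * (q + q) + 2 * (q + q) ≡ 8 * q
    eight = solve-∀

  k+k≤T : k + k ≤ T
  k+k≤T = begin
    k + k                ≡⟨ cong (k +_) (+-identityʳ k) ⟨
    2 ^ suc q            ≤⟨ ^-monoʳ-≤ 2 (+-monoˡ-≤ q (≤-trans (s≤s z≤n) (≤-reflexive (sym q≡3+r)))) ⟩
    2 ^ (q + q)          ≤⟨ ^-monoˡ-≤ (q + q) (s≤s (s≤s z≤n)) ⟩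
    4 ^ (q + q)          ∎
    where open ≤-Reasoning

  -- This is where q = 3 + r comes from: 2k + 1 ≤ 4k together with the factor 2 costs 8 = 2^3, and k
  -- · 8P = k².
  small : suc (k + k) * (2 * P) ≤ 2 ^ h
  small = begin
    suc (k + k) * (2 * P)          ≤⟨ *-monoˡ-≤ (2 * P) (≤-trans (+-monoˡ-≤ (k + k) (≤-trans (m^n>0 2 q) (m≤m+n k k))) (≤-reflexive (four k))) ⟩
    4 * k * (2 * P)                ≡⟨ regroup k P ⟩
    k * (2 * (2 * (2 * P)))        ≡⟨ cong (k *_) k≡8P ⟨
    k * k                          ≡⟨ ^-distribˡ-+-* 2 q q ⟨
    2 ^ h                          ∎
    where
    open ≤-Reasoning
    four : ∀ k → k + k + (k + k) ≡ 4 * k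
    four = solve-∀
    regroup : ∀ k p → 4 * k * (2 * p) ≡ k * (2 * (2 * (2 * p)))
    regroup = solve-∀

  half≤n : half ≤ n
  half≤n = ≤-trans (^-monoʳ-≤ 2 (≤-trans (n≤1+n (2 + r)) (≤-trans (≤-reflexive (sym q≡3+r)) (m≤n*m q 8)))) ≤n

  size-bound : ∀ {S} → S ≤ n ^[ ε ·log₂] → S ≤ 2 ^ (suc q * suc q)
  size-bound {S} S≤ = quadratic-root 64 {S} {n} {8 * suc q} {suc q * suc q}
    (trans ([m*n]*[o*p]≡[m*o]*[n*p] 8 (suc q) 8 (suc q)) (*-comm 64 (suc q * suc q)))
    (subst (λ x → S ^ 64 ≤ n ^ x) (*-identityˡ (8 * suc q))
      (S≤ (8 * suc q) 1 (≤-trans (≤-reflexive (^-identityʳ n)) (<⇒≤ n<))))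
    (<⇒≤ n<)

  -- Taking eighth roots gives 8x < 2^(q + 1) = 8 · 2^(r + 1); the factor 8 in the hypothesis
  -- cancels the loss in q = 3 + r.
  sd-bound : ∀ {x} → (8 * x) ^ 8 ≤ n → x < 2 ^ suc r
  sd-bound {x} le = *-cancelˡ-< 8 _ _ (begin-strict
    8 * x               <⟨ ^-cancelˡ-< 8 (≤-<-trans le (<-≤-trans n< (≤-reflexive power))) ⟩
    2 ^ suc q           ≡⟨ cong (2 *_) k≡8P ⟩
    2 * (2 * (2 * (2 * P))) ≡⟨ eight P ⟩
    8 * 2 ^ suc r       ∎)
    where
    open ≤-Reasoning
    power : 2 ^ (8 * suc q) ≡ (2 ^ suc q) ^ 8
    power = trans (cong (2 ^_) (*-comm 8 (suc q))) (sym (^-*-assoc 2 (suc q) 8))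
    eight : ∀ x → 2 * (2 * (2 * (2 * x))) ≡ 8 * (2 * x)
    eight = solve-∀

  -- The size and the sparse factors have exponents at most 2^(r + 1), one of them strictly, so
  -- together they stay below `half` = k/2, the exponent saved.
  rank-bound : ∀ {S x} → S ≤ 2 ^ (suc q * suc q) → x < 2 ^ suc r → S * 2 ^ x * 2 ^ (n ∸ half) < 2 ^ n
  rank-bound {S} {x} S≤ x< = begin-strict
    S * 2 ^ x * 2 ^ (n ∸ half)                        ≤⟨ *-monoˡ-≤ (2 ^ (n ∸ half)) (*-monoˡ-≤ (2 ^ x) S≤) ⟩
    2 ^ (suc q * suc q) * 2 ^ x * 2 ^ (n ∸ half)      ≡⟨ cong (_* 2 ^ (n ∸ half)) (^-distribˡ-+-* 2 (suc q * suc q) x) ⟨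
    2 ^ (suc q * suc q + x) * 2 ^ (n ∸ half)          <⟨ *-monoˡ-< (2 ^ (n ∸ half)) {{m^n≢0 2 (n ∸ half)}} (^-monoʳ-< 2 (s≤s (s≤s z≤n)) exponent) ⟩
    2 ^ half * 2 ^ (n ∸ half)                         ≡⟨ ^-distribˡ-+-* 2 half (n ∸ half) ⟨
    2 ^ (half + (n ∸ half))                           ≡⟨ cong (2 ^_) (m+[n∸m]≡n half≤n) ⟩
    2 ^ n                                             ∎
    where
    open ≤-Reasoning
    square : suc q * suc q ≤ 2 ^ suc r
    square = ≤-trans (≤-reflexive (cong (λ q → suc q * suc q) q≡3+r)) (square≤2^ (≤⇒≤′ 17≤r))
    exponent : suc q * suc q + x < half
    exponent = <-≤-trans (+-mono-≤-< square x<) (≤-reflexive (cong (2 ^ suc r +_) (sym (+-identityʳ (2 ^ suc r)))))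

  full-rank-exponent : n + n ≤ (n ∸ half) + (n ∸ half) + k
  full-rank-exponent = ≤-reflexive (sym (begin
    (n ∸ half) + (n ∸ half) + k                  ≡⟨ cong ((n ∸ half) + (n ∸ half) +_) k≡half+half ⟩
    (n ∸ half) + (n ∸ half) + (half + half)      ≡⟨ regroup (n ∸ half) half ⟩
    (n ∸ half + half) + (n ∸ half + half)        ≡⟨ cong (λ x → x + x) (m∸n+n≡m half≤n) ⟩
    n + n                                        ∎))
    where
    open ≡-Reasoning
    regroup : ∀ a b → a + a + (b + b) ≡ (a + b) + (a + b)
    regroup = solve-∀

  -- The bad colourings are compared with those having n variables of each colour, which are a
  -- fraction of at least 1 / (2n + 1) of all; P^j outweighs that factor and the size.
  few-bad : ∀ {S c} → S ≤ 2 ^ (suc q * suc q) → c * P ^ j ≤ S * 2 ^ (n + n) → c < central n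
  few-bad {S} {c} S≤ cP≤ = ≰⇒> λ central≤c → <⇒≱ enough (*-cancelʳ-≤ _ _ (4 ^ n) {{m^n≢0 4 n}} (begin
    P ^ j * 4 ^ n                             ≤⟨ *-monoʳ-≤ (P ^ j) (central-lower n) ⟩
    P ^ j * (central n * suc (n + n))         ≤⟨ *-monoʳ-≤ (P ^ j) (*-monoˡ-≤ (suc (n + n)) central≤c) ⟩
    P ^ j * (c * suc (n + n))                 ≡⟨ regroup (P ^ j) c (suc (n + n)) ⟩
    c * P ^ j * suc (n + n)                   ≤⟨ *-monoˡ-≤ (suc (n + n)) cP≤ ⟩
    S * 2 ^ (n + n) * suc (n + n)             ≡⟨ cong (λ x → S * x * suc (n + n)) 4^n≡ ⟨
    S * 4 ^ n * suc (n + n)                   ≡⟨ swap S (4 ^ n) (suc (n + n)) ⟩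
    S * suc (n + n) * 4 ^ n                   ∎))
    where
    open ≤-Reasoning
    4^n≡ : 4 ^ n ≡ 2 ^ (n + n)
    4^n≡ = trans (^-distribʳ-* n 2 2) (sym (^-distribˡ-+-* 2 n n))
    regroup : ∀ p c m → p * (c * m) ≡ c * p * m
    regroup = solve-∀
    swap : ∀ a b c → a * b * c ≡ a * c * b
    swap = solve-∀
    1+2n≤ : suc (n + n) ≤ 2 ^ suc (8 * suc q)
    1+2n≤ = +-mono-≤ n< (≤-trans (<⇒≤ n<) (m≤m+n _ 0))
    exponent : suc q * suc q + suc (8 * suc q) < r * (q + q)
    exponent = subst (λ q → suc q * suc q + suc (8 * suc q) < r * (q + q)) (sym q≡3+r) (quadratic< 17≤r)
    enough : S * suc (n + n) < P ^ j
    enough = begin-strict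
      S * suc (n + n)                                   ≤⟨ *-mono-≤ S≤ 1+2n≤ ⟩
      2 ^ (suc q * suc q) * 2 ^ suc (8 * suc q)         ≡⟨ ^-distribˡ-+-* 2 (suc q * suc q) (suc (8 * suc q)) ⟨
      2 ^ (suc q * suc q + suc (8 * suc q))             <⟨ ^-monoʳ-< 2 (s≤s (s≤s z≤n)) exponent ⟩
      2 ^ (r * (q + q))                                 ≡⟨ ^-*-assoc 2 r (q + q) ⟨
      P ^ j                                             ∎

-- The lower bound for formulas.

central>0 : ∀ n → 0 < central n
central>0 n = ≮⇒≥ λ C<1 → <⇒≱ (m^n>0 4 n)
  (≤-trans (central-lower n) (≤-reflexive (cong (_* suc (n + n)) (n<1⇒n≡0 C<1))))

module _ {c ℓ₁ ℓ₂} (F : HeytingField c ℓ₁ ℓ₂) (n : ℕ) where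

  open OverField F using (module Rank; rank<⇒¬HasMaxRank)

  count-equal : count {2 * n} (λ χ → ∣ χ ∣ ≡ᵇ n) ≡ central n
  count-equal = trans (count-∣χ∣ (2 * n) n) (cong (λ m → (n + m) C n) (+-identityʳ n))

  low-rank⇒¬FullMaxRank :
    ∀ {r f g} (χ : Subset (2 * n)) → ∣ χ ∣ ≡ n → r < 2 ^ n → _≈ᵖ_ F g f →
    (∀ {K} (B : Fin K → Fin (2 * n)) S → Rank.RankAtMost B S χ r g) → ¬ FullMaxRank F n f
  low-rank⇒¬FullMaxRank {f = f} {g} χ ∣χ∣≡n r<2^n g≈f rank full =
    rank<⇒¬HasMaxRank n A χ A-true A-false {f = f} {g} (rank _) g≈f r<2^n (full A)
    where
    ∣∁χ∣≡n : ∣ ∁ χ ∣ ≡ n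
    ∣∁χ∣≡n = trans (∣∁p∣≡n∸∣p∣ χ) (trans (cong (2 * n ∸_) ∣χ∣≡n) (trans (m+n∸m≡n n (n + 0)) (+-identityʳ n)))
    A = proj₁ (bijection χ ∣χ∣≡n ∣∁χ∣≡n)
    A-true = proj₁ (proj₂ (bijection χ ∣χ∣≡n ∣∁χ∣≡n))
    A-false = proj₂ (proj₂ (bijection χ ∣χ∣≡n ∣∁χ∣≡n))

  exists-equal : ∀ {P : Subset (2 * n) → Bool} → count P < central n → ∃ λ χ → ∣ χ ∣ ≡ n × P χ ≡ false
  exists-equal {P} few with count<⇒∃ {P = P} (subst (count P <_) (sym count-equal) few)
  ... | χ , ∣χ∣≡ᵇn , good = χ , ≡ᵇ⇒≡ _ _ (subst Bool.T (sym ∣χ∣≡ᵇn) _) , good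

  -- The selections need 4^j T ≤ ∣X∣, which is guaranteed only when n variables occur. With fewer,
  -- the smaller side has at most n - 1 of them, and the trivial bound is below 2^n.
  few-variables⇒¬FullMaxRank : ∀ {f} (Φ : Formula F (2 * n)) → ∣ vars F Φ ∣ < n → Computes F Φ f →
                               ¬ FullMaxRank F n f
  few-variables⇒¬FullMaxRank {f} Φ X<n computes
    -- Nothing has to be avoided: any colouring with n variables of each colour will do.
    with exists-equal {λ _ → false} (≤-trans (s≤s (≤-reflexive (count-none {2 * n} λ _ → refl))) (central>0 n))
  ... | χ , ∣χ∣≡n , _ = low-rank⇒¬FullMaxRank {f = f} {⟦_⟧ F Φ} χ ∣χ∣≡n (^-monoʳ-< 2 (s≤s (s≤s z≤n)) (∸-monoʳ-< {n} {1} {0} (s≤s z≤n) 1≤n)) computes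
    λ B S → Paths.rank-min F 0 0 B S χ Φ (n ∸ 1) (small-side χ (vars F Φ) (n ∸ 1) X≤)
    where
    1≤n : 1 ≤ n
    1≤n = ≤-trans (s≤s z≤n) X<n
    X≤ : ∣ vars F Φ ∣ ≤ suc ((n ∸ 1) + (n ∸ 1))
    X≤ = m≤n⇒m≤1+n (≤-trans (∸-monoˡ-≤ 1 X<n) (m≤m+n (n ∸ 1) (n ∸ 1)))

  module _ (q r : ℕ) (q≡3+r : q ≡ 3 + r) (17≤r : 17 ≤ r)
           (≤n : 2 ^ (8 * q) ≤ n) (n< : n < 2 ^ (8 * suc q)) where

    open Parameters n q r q≡3+r 17≤r ≤n n<

    small-formula⇒¬FullMaxRank : ∀ {s d f} (Φ : Formula F (2 * n)) → ProductSparse F s d Φ →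
      s * d < 2 ^ suc r → size F Φ ≤ 2 ^ (suc q * suc q) → Computes F Φ f → ¬ FullMaxRank F n f
    small-formula⇒¬FullMaxRank {s} {d} {f} Φ (ok , δ≡d) sd< size≤ computes =
      by-cases (n ≤? ∣ vars F Φ ∣)
      where
      good-colouring : n ≤ ∣ vars F Φ ∣ → ∃ λ χ → ∣ χ ∣ ≡ n × Paths.Bad F k T Φ χ ≡ false
      good-colouring n≤X = exists-equal {Paths.Bad F k T Φ} (few-bad {size F Φ} size≤
        (≤-trans (PathCount.Bad-bound F k T h P ≤-refl 1≤T small Φ j (≤-trans 4^jT≤n n≤X))
                 (≤-reflexive (cong (λ m → size F Φ * 2 ^ (n + m)) (+-identityʳ n)))))

      X≤ : ∣ vars F Φ ∣ ≤ (n ∸ half) + (n ∸ half) + k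
      X≤ = ≤-trans (∣p∣≤n (vars F Φ)) (≤-trans (≤-reflexive (cong (n +_) (+-identityʳ n))) full-rank-exponent)

      rank : ∀ χ → Paths.Bad F k T Φ χ ≡ false → ∀ {K} (B : Fin K → Fin (2 * n)) S →
             Rank.RankAtMost B S χ (size F Φ * 2 ^ (s * d) * 2 ^ (n ∸ half)) (⟦_⟧ F Φ)
      rank χ good B S = subst (λ d → Rank.RankAtMost B S χ (size F Φ * 2 ^ (s * d) * 2 ^ (n ∸ half)) (⟦_⟧ F Φ)) δ≡d
        (Paths.rank-good F k T B S χ s k+k≤T Φ ok good (n ∸ half) X≤)

      by-cases : Dec (n ≤ ∣ vars F Φ ∣) → ¬ FullMaxRank F n f
      by-cases (no n≰X)  = few-variables⇒¬FullMaxRank {f} Φ (≰⇒> n≰X) computes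
      by-cases (yes n≤X) = let χ , ∣χ∣≡n , good = good-colouring n≤X in
        low-rank⇒¬FullMaxRank {f = f} {⟦_⟧ F Φ} χ ∣χ∣≡n (rank-bound {size F Φ} {s * d} size≤ sd<) computes (rank χ good)

q₀≤log₂₅₆ : ∀ q₀ {n q} → 2 ^ (8 * q₀) ≤ n → n < 2 ^ (8 * suc q) → q₀ ≤ q
q₀≤log₂₅₆ q₀ ≤n n< = ≮⇒≥ λ q<q₀ → <⇒≱ (<-≤-trans n< (^-monoʳ-≤ 2 (*-monoʳ-≤ 8 q<q₀))) ≤n

lower-bound : ∀ {c ℓ₁ ℓ₂} q₀ → 20 ≤ q₀ → ∀ {n s d} → (8 * (s * d)) ^ 8 ≤ n → 2 ^ (8 * q₀) ≤ n →
              (F : HeytingField c ℓ₁ ℓ₂) (f : Poly F (2 * n)) → FullMaxRank F n f →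
              (Φ : Formula F (2 * n)) → ProductSparse F s d Φ → size F Φ ≤ n ^[ ε ·log₂] →
              ¬ Computes F Φ f
lower-bound q₀ 20≤q₀ {n} {s} {d} sd≤ 2^8q₀≤n F f full Φ sparse size≤ computes =
  small-formula⇒¬FullMaxRank F n q (q ∸ 3) q≡ 17≤ ≤n n< {s} {d} {f} Φ sparse
    (Parameters.sd-bound n q (q ∸ 3) q≡ 17≤ ≤n n< {s * d} sd≤)
    (Parameters.size-bound n q (q ∸ 3) q≡ 17≤ ≤n n< {size F Φ} size≤) computes full
  where
  log = log₂₅₆ n (≤-trans (m^n>0 2 (8 * q₀)) 2^8q₀≤n)
  q = proj₁ log
  ≤n = proj₁ (proj₂ log)
  n< = proj₂ (proj₂ log)
  20≤q = ≤-trans 20≤q₀ (q₀≤log₂₅₆ q₀ 2^8q₀≤n n<)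
  q≡ : q ≡ 3 + (q ∸ 3)
  q≡ = sym (m+[n∸m]≡n (≤-trans (≤ᵇ⇒≤ 3 20 _) 20≤q))
  17≤ : 17 ≤ q ∸ 3
  17≤ = ∸-monoˡ-≤ 3 20≤q

theorem7 : ∀ {c ℓ₁ ℓ₂} →
    Σ ℚ λ ε → 0ℚ <ℚ ε ×
    (∀ (s d : ℕ → ℕ) → IsLittleOEighthRoot (λ n → s n * d n) →
    ∃ λ N → ∀ n → n ≥ N →
    (F : HeytingField c ℓ₁ ℓ₂)
    (f : Poly F (2 * n)) → FullMaxRank F n f →
    (Φ : Formula F (2 * n)) → ProductSparse F (s n) (d n) Φ →
    size F Φ ≤ n ^[ ε ·log₂] →
    ¬ Computes F Φ f)
theorem7 = ε , toWitness {a? = 0ℚ ℚ.<? ε} _ , λ s d sd-small → let N , sd≤ = sd-small 8 in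
  -- The 20 is 3 + 17: it makes q at least 20, so that q = 3 + r with 17 ≤ r.
  N ⊔ 2 ^ (8 * 20) , λ n n≥ → lower-bound 20 ≤-refl {n} {s n} {d n}
    (sd≤ n (m⊔n≤o⇒m≤o N (2 ^ (8 * 20)) n≥)) (m⊔n≤o⇒n≤o N (2 ^ (8 * 20)) n≥)
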